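{- Let $n,k$ be integers with $0<k<n/2$. The generalized Petersen graph $G(n,k)$ is isomorphic to the underlying graph of $\mathrm{Cay}(M,C)$ for some monoid $M$ and some subset $C\subseteq M$ with $|C|=2$ and $M=\langle C\rangle$ if and only if one of the following holds: (a) $(n,k)=(5,2)$; (b) $k^2\equiv 1\pmod n$; (c) $k^2\equiv k\pmod n$ or $k^2\equiv -k\pmod n$.
   Context: $G(n,k)$ ($0<k<n/2$) has vertices $u_0,\dots,u_{n-1},v_0,\dots,v_{n-1}$ and edges $u_iu_{i+1}$, $v_iv_{i+k}$, $u_iv_i$ (indices mod $n$). For a semigroup $S$ and $C\subseteq S$, the Cayley graph $\mathrm{Cay}(S,C)$ is the directed multigraph (loops allowed) with vertex set $S$ and one arc $(s,sc)$ for each $s\in S$, $c\in C$; its underlying graph is obtained by deleting loops, forgetting orientations and merging parallel edges. $\langle C\rangle$ denotes the submonoid generated by $C$. -}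

module Defs where

open import Data.Nat using (ℕ; _+_)
open import Data.Fin using (Fin; toℕ)
open import Data.Sum using (_⊎_)
open import Data.Product using (Σ; _×_)
open import Data.Integer as ℤ using (ℤ; +_)
open import Data.Integer.Divisibility using (_∣_)
open import Relation.Binary.PropositionalEquality using (_≡_; _≢_)
open import Algebra.Structures using (IsMonoid)
open import Function.Bundles using (_↔_; _⇔_; Inverse)

CongMod : ℕ → ℕ → ℕ → Set
CongMod n a b = (+ n) ∣ ((+ a) ℤ.- (+ b))

data PVertex (n : ℕ) : Set where
  u : Fin n → PVertex n
  v : Fin n → PVertex n

data GPAdj (n k : ℕ) : PVertex n → PVertex n → Set where
  outer  : ∀ {i j} → CongMod n (toℕ i + 1) (toℕ j) → GPAdj n k (u i) (u j)
  outer′ : ∀ {i j} → CongMod n (toℕ j + 1) (toℕ i) → GPAdj n k (u i) (u j)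
  inner  : ∀ {i j} → CongMod n (toℕ i + k) (toℕ j) → GPAdj n k (v i) (v j)
  inner′ : ∀ {i j} → CongMod n (toℕ j + k) (toℕ i) → GPAdj n k (v i) (v j)
  spoke  : ∀ i → GPAdj n k (u i) (v i)
  spoke′ : ∀ i → GPAdj n k (v i) (u i)

InC : {A : Set} → A → A → A → Set
InC c₁ c₂ c = c ≡ c₁ ⊎ c ≡ c₂

data Gen {A : Set} (_∙_ : A → A → A) (e c₁ c₂ : A) : A → Set where
  gen-ε : Gen _∙_ e c₁ c₂ e
  gen-∙ : ∀ {x c} → Gen _∙_ e c₁ c₂ x → InC c₁ c₂ c → Gen _∙_ e c₁ c₂ (x ∙ c)

-- adjacency in the underlying simple graph of Cay(S, C): arcs (s, s c) for c ∈ C,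
-- loops deleted, orientations forgotten, parallel edges merged
CayAdj : {A : Set} → (A → A → A) → A → A → A → A → Set
CayAdj {A} _∙_ c₁ c₂ s t =
  s ≢ t × Σ A (λ c → InC c₁ c₂ c × (t ≡ s ∙ c ⊎ s ≡ t ∙ c))

record MonoidCayleyRep (n k : ℕ) : Set₁ where
  field
    M        : Set
    _∙_      : M → M → M
    e        : M
    isMonoid : IsMonoid _≡_ _∙_ e
    c₁ c₂    : M
    c₁≢c₂    : c₁ ≢ c₂
    generated : ∀ x → Gen _∙_ e c₁ c₂ x
    iso      : PVertex n ↔ M
    iso-adj  : ∀ x y → GPAdj n k x y ⇔ CayAdj _∙_ c₁ c₂ (Inverse.to iso x) (Inverse.to iso y)

{-# OPTIONS --safe #-}
-- Since e has three neighbours, one of the two generators, a, is a unit of order at least 3. Left multiplication by a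
-- is then an automorphism of G(n, k) that moves e to a neighbour. The numbers of closed walks of length 8 (or 10)
-- through paths of length two show that automorphisms preserve the set of spokes, unless G(n, k) is edge-transitive.
-- So a rotates G(n, k) by ± 1 or ± k, its powers form the rim of e, and the other generator b is the other end of the
-- spoke at e. If the powers of a meet all spokes, then b a = a^l b, where l = ± k or its inverse, and b b = e gives
-- l² = 1, while b b = a^j b gives l² = l. Otherwise e lies on one of several inner rims, and following the arcs that
-- are needed to cover all edges leads to a contradiction. Of the edge-transitive graphs only G(10, 2) and G(10, 3)
-- violate the conditions; there a symmetry makes a rotate a rim or, in G(10, 3), a hexagon, which is impossible as well.
--
-- Conversely, let b act on ℤ/n as multiplication by k, or by - k if k² = - k. This gives a semidirect product with
-- {1 , b}, where b² = 1 if k² = 1 and b² = b otherwise; G(5, 2) needs a monoid of its own.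
module Submission where

open import Defs
open import Algebra.Structures using (IsMonoid)
open import Data.Bool.Base using (Bool; true; false; if_then_else_; _∧_; _∨_; not)
open import Data.Empty using (⊥; ⊥-elim)
open import Data.Fin as Fin using (Fin; toℕ; fromℕ<)
import Data.Fin.Properties as Fin
open import Data.Fin.Patterns
open import Data.Integer as ℤ using (ℤ; +_)
  renaming (_+_ to _+ᶻ_; _*_ to _*ᶻ_; -_ to -ᶻ_; _-_ to _-ᶻ_)
import Data.Integer.DivMod as ℤ
import Data.Integer.Divisibility as ℤᵘ
open ℤᵘ using (_∣_)
open import Data.Integer.Divisibility.Signed as ℤˢ using (divides) renaming (_∣_ to _∣ˢ_)
import Data.Integer.Properties as ℤ
open import Data.Integer.Tactic.RingSolver using (solve-∀)
open import Data.List.Base using (List; []; _∷_; _++_; map; filter; filterᵇ; foldl; upTo)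
open import Data.List.Relation.Unary.All as All using (All; []; _∷_)
open import Data.List.Membership.Propositional using (_∈_)
import Data.List.Membership.Propositional.Properties as ∈
open import Data.List.Relation.Unary.Any as Any using (Any; here; there)
open import Data.Nat.ListAction using (sum)
open import Data.Nat.Base as ℕ using (ℕ; zero; suc; _+_; _*_; _<_; _≤_; z≤n; s≤s; NonZero)
open import Data.Nat.Divisibility as ℕᵈ using () renaming (_∣_ to _∣ℕ_; _∣?_ to _∣ℕ?_)
import Data.Nat.DivMod as ℕ
import Data.Nat.GCD as ℕ
import Data.Nat.Tactic.RingSolver as ℕSolver
import Data.Nat.Properties as ℕ
open import Data.Product using (Σ; ∃; _×_; _,_; proj₁; proj₂)
open import Data.Sum using (_⊎_; inj₁; inj₂; [_,_]′)
open import Function.Base using (_∘_; id; case_of_)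
open import Function.Bundles using (_↔_; _⇔_; Inverse; Equivalence; mk⇔; mk↔ₛ′)
open import Relation.Binary.Definitions using (DecidableEquality; tri<; tri≈; tri>)
open import Relation.Binary.PropositionalEquality
open import Relation.Nullary using (¬_; Dec; yes; no; contradiction)
open import Relation.Nullary.Decidable as Dec using (True; toWitness; does; _×-dec_; _→-dec_; _⊎-dec_; ¬?; from-yes; from-no; map′)

-- Since `b` may fail to be a unit, a single automorphism is available and the theory of regular
-- group actions does not apply. Three facts replace it. Left multiplication by `a` carries every
-- arc labelled `c` to an arc labelled `c`, so the arcs are determined by one vertex of each orbit.
-- Right multiplication by `a` is injective, so two `a`-arcs never share their end. Every set of
-- vertices without `e` is entered by some arc, because `M` is generated. As each edge needs an arc,
-- few configurations survive.
--
-- Length 8 comes from the cycles u_i u_(i+1) v_(i+1) v_(i+1+k) u_(i+1+k) u_(i+k) v_(i+k) v_i,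
-- present for all n and k. They contain paths that turn from a rim into a spoke, but no two
-- consecutive edges of a rim, so they make the counts uneven unless other closed walks compensate.
-- By Frucht, Graver and Watkins the edge-transitive graphs have (n, k) = (4, 1), (5, 2), (8, 3),
-- (10, 2), (10, 3), (12, 5) or (24, 5); all but the second, fourth and fifth satisfy k² = 1.

-- Congruences between integers

module Congruence (n : ℕ) where

  infix 4 _≋_ _≋?_
  -- A record, so that `i` and `j` can be recovered from the type, which their difference alone
  -- would not allow.
  record _≋_ (i j : ℤ) : Set where
    constructor mod
    field n∣i-j : + n ∣ˢ i -ᶻ j
  open _≋_ public

  _≋?_ : ∀ i j → Dec (i ≋ j)
  i ≋? j = Dec.map′ mod n∣i-j (+ n ℤˢ.∣? (i -ᶻ j))

  -- Congruences are derived as integer combinations of known ones: the coefficient is the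
  -- certificate, and the identity that remains is left to the ring solver.
  linear : ∀ {a b i j} c → i -ᶻ j ≡ c *ᶻ (a -ᶻ b) → a ≋ b → i ≋ j
  linear c eq (mod n∣) = mod (subst (+ n ∣ˢ_) (sym eq) (ℤˢ.∣n⇒∣m*n c n∣))

  linear₂ : ∀ {a b a′ b′ i j} c c′ → i -ᶻ j ≡ c *ᶻ (a -ᶻ b) +ᶻ c′ *ᶻ (a′ -ᶻ b′) →
            a ≋ b → a′ ≋ b′ → i ≋ j
  linear₂ c c′ eq (mod n∣) (mod n∣′) =
    mod (subst (+ n ∣ˢ_) (sym eq) (ℤˢ.∣m∣n⇒∣m+n (ℤˢ.∣n⇒∣m*n c n∣) (ℤˢ.∣n⇒∣m*n c′ n∣′)))

  ≡⇒≋ : ∀ {i j} → i ≡ j → i ≋ j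
  ≡⇒≋ {i} refl = mod (subst (+ n ∣ˢ_) (sym (ℤ.+-inverseʳ i)) (divides (+ 0) refl))

  ≋-sym : ∀ {i j} → i ≋ j → j ≋ i
  ≋-sym {i} {j} = linear (-ᶻ + 1) (lemma i j)
    where
    lemma : ∀ i j → j -ᶻ i ≡ -ᶻ + 1 *ᶻ (i -ᶻ j)
    lemma = solve-∀

  ≋-trans : ∀ {i j l} → i ≋ j → j ≋ l → i ≋ l
  ≋-trans {i} {j} {l} = linear₂ (+ 1) (+ 1) (lemma i j l)
    where
    lemma : ∀ i j l → i -ᶻ l ≡ + 1 *ᶻ (i -ᶻ j) +ᶻ + 1 *ᶻ (j -ᶻ l)
    lemma = solve-∀

  +-congʳ-≋ : ∀ {i j} l → i ≋ j → i +ᶻ l ≋ j +ᶻ l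
  +-congʳ-≋ {i} {j} l = linear (+ 1) (lemma i j l)
    where
    lemma : ∀ i j l → (i +ᶻ l) -ᶻ (j +ᶻ l) ≡ + 1 *ᶻ (i -ᶻ j)
    lemma = solve-∀

  +-cancelʳ-≋ : ∀ {i j} l → i +ᶻ l ≋ j +ᶻ l → i ≋ j
  +-cancelʳ-≋ {i} {j} l = linear (+ 1) (lemma i j l)
    where
    lemma : ∀ i j l → i -ᶻ j ≡ + 1 *ᶻ ((i +ᶻ l) -ᶻ (j +ᶻ l))
    lemma = solve-∀

  neg-cong-≋ : ∀ {i j} → i ≋ j → -ᶻ i ≋ -ᶻ j
  neg-cong-≋ {i} {j} = linear (-ᶻ + 1) (lemma i j)
    where
    lemma : ∀ i j → (-ᶻ i) -ᶻ (-ᶻ j) ≡ -ᶻ + 1 *ᶻ (i -ᶻ j)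
    lemma = solve-∀

  neg-cancel-≋ : ∀ {i j} → -ᶻ i ≋ -ᶻ j → i ≋ j
  neg-cancel-≋ {i} {j} = linear (-ᶻ + 1) (lemma i j)
    where
    lemma : ∀ i j → i -ᶻ j ≡ -ᶻ + 1 *ᶻ ((-ᶻ i) -ᶻ (-ᶻ j))
    lemma = solve-∀

  *-congʳ-≋ : ∀ {i j} l → i ≋ j → i *ᶻ l ≋ j *ᶻ l
  *-congʳ-≋ {i} {j} l = linear l (lemma i j l)
    where
    lemma : ∀ i j l → (i *ᶻ l) -ᶻ (j *ᶻ l) ≡ l *ᶻ (i -ᶻ j)
    lemma = solve-∀

  ≋⇒∣ : ∀ {i j} → i ≋ j → n ∣ℕ ℤ.∣ i -ᶻ j ∣
  ≋⇒∣ (mod n∣) = ℤˢ.∣⇒∣ᵤ n∣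

  ∣⇒≋ : ∀ {i j} → n ∣ℕ ℤ.∣ i -ᶻ j ∣ → i ≋ j
  ∣⇒≋ = mod ∘ ℤˢ.∣ᵤ⇒∣

  distinct : ∀ {i j} d → i -ᶻ j ≡ + d → 0 < d → d < n → ¬ i ≋ j
  distinct {i} {j} d eq 0<d d<n i≋j with ≋⇒∣ i≋j
  ... | n∣ rewrite eq = ℕ.<⇒≱ d<n (ℕᵈ.∣⇒≤ {{ℕ.>-nonZero 0<d}} n∣)

  apart : ∀ a b → b < a → a < n → ¬ + a ≋ + b
  apart a b b<a a<n = distinct (a ℕ.∸ b) (trans (ℤ.m-n≡m⊖n a b) (ℤ.⊖-≥ (ℕ.<⇒≤ b<a)))
    (ℕ.m<n⇒0<n∸m b<a) (ℕ.≤-<-trans (ℕ.m∸n≤m a b) a<n)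

  module _ .{{_ : NonZero n}} where

    residue : ℤ → ℕ
    residue i = i ℤ.%ℕ n

    residue<n : ∀ i → residue i < n
    residue<n i = ℤ.n%ℕd<d i n

    ≋-residue : ∀ i → i ≋ + residue i
    ≋-residue i = mod (divides (i ℤ./ℕ n) (lemma i (+ residue i) (i ℤ./ℕ n *ᶻ + n) (ℤ.a≡a%ℕn+[a/ℕn]*n i n)))
      where
      lemma : ∀ i r q → i ≡ r +ᶻ q → i -ᶻ r ≡ q
      lemma _ r q refl = cancel r q
        where
        cancel : ∀ r q → (r +ᶻ q) -ᶻ r ≡ q
        cancel = solve-∀

    residue-unique : ∀ {a b} → a < n → b < n → + a ≋ + b → a ≡ b
    residue-unique {a} {b} a<n b<n a≋b with ℕ.<-cmp a b
    ... | tri< a<b _ _ = contradiction (≋-sym a≋b) (apart b a a<b b<n)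
    ... | tri≈ _ a≡b _ = a≡b
    ... | tri> _ _ b<a = contradiction a≋b (apart a b b<a a<n)

-- Integer coordinates on generalized Petersen graphs

data Side : Set where
  out inn : Side

flip : Side → Side
flip out = inn
flip inn = out

data Dir : Set where
  fwd bwd spk : Dir

rev : Dir → Dir
rev fwd = bwd
rev bwd = fwd
rev spk = spk

_≟ˢ_ : DecidableEquality Side
out ≟ˢ out = yes refl
out ≟ˢ inn = no λ ()
inn ≟ˢ out = no λ ()
inn ≟ˢ inn = yes refl

_≟ᵈ_ : DecidableEquality Dir
fwd ≟ᵈ fwd = yes refl
fwd ≟ᵈ bwd = no λ ()
fwd ≟ᵈ spk = no λ ()
bwd ≟ᵈ fwd = no λ ()
bwd ≟ᵈ bwd = yes refl
bwd ≟ᵈ spk = no λ ()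
spk ≟ᵈ fwd = no λ ()
spk ≟ᵈ bwd = no λ ()
spk ≟ᵈ spk = yes refl

Label : Set
Label = Side × ℤ

module Petersen (n k : ℕ) where
  open Congruence n

  κ : Side → ℤ
  κ out = + 1
  κ inn = + k

  nbr : Label → Dir → Label
  nbr (s , i) fwd = s , i +ᶻ κ s
  nbr (s , i) bwd = s , i -ᶻ κ s
  nbr (s , i) spk = flip s , i

  -- Coordinates that identify a relation with G(n, k). Indices are integers up to congruence, and
  -- the symmetries of G(n, k) turn a labelling into another one; changing the labelling is how
  -- positions are normalised without loss of generality.
  record Labelling {M : Set} (Adj : M → M → Set) : Set where
    field
      P      : Label → M
      P-cong : ∀ {s i j} → i ≋ j → P (s , i) ≡ P (s , j)
      P-inj  : ∀ {s i t j} → P (s , i) ≡ P (t , j) → s ≡ t × i ≋ j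
      cover  : ∀ x → ∃ λ l → x ≡ P l
      adj⇒   : ∀ {l y} → Adj (P l) y → ∃ λ d → y ≡ P (nbr l d)
      adj⇐   : ∀ l d → Adj (P l) (P (nbr l d))

  translate : ∀ {M} {Adj : M → M → Set} → ℤ → Labelling Adj → Labelling Adj
  translate {Adj = Adj} t L = record
    { P      = λ { (s , i) → P (s , i +ᶻ t) }
    ; P-cong = λ i≋j → P-cong (+-congʳ-≋ t i≋j)
    ; P-inj  = λ eq → proj₁ (P-inj eq) , +-cancelʳ-≋ t (proj₂ (P-inj eq))
    ; cover  = λ x → case cover x of λ
        { ((s , i) , eq) → (s , i -ᶻ t) , trans eq (cong (λ j → P (s , j)) (back i t)) }
    ; adj⇒   = λ { {s , i} adj → case adj⇒ adj of λ
        { (fwd , eq) → fwd , trans eq (cong (λ j → P (s , j)) (comm i t (κ s)))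
        ; (bwd , eq) → bwd , trans eq (cong (λ j → P (s , j)) (comm i t (-ᶻ κ s)))
        ; (spk , eq) → spk , eq } }
    ; adj⇐   = λ
        { (s , i) fwd → subst (λ j → Adj _ (P (s , j))) (comm i t (κ s)) (adj⇐ (s , i +ᶻ t) fwd)
        ; (s , i) bwd → subst (λ j → Adj _ (P (s , j))) (comm i t (-ᶻ κ s)) (adj⇐ (s , i +ᶻ t) bwd)
        ; (s , i) spk → adj⇐ (s , i +ᶻ t) spk }
    }
    where
    open Labelling L
    back : ∀ i t → i ≡ i -ᶻ t +ᶻ t
    back = solve-∀
    comm : ∀ i t κ → i +ᶻ t +ᶻ κ ≡ i +ᶻ κ +ᶻ t
    comm = solve-∀

  reflect : ∀ {M} {Adj : M → M → Set} → Labelling Adj → Labelling Adj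
  reflect {Adj = Adj} L = record
    { P      = λ { (s , i) → P (s , -ᶻ i) }
    ; P-cong = λ i≋j → P-cong (neg-cong-≋ i≋j)
    ; P-inj  = λ eq → proj₁ (P-inj eq) , neg-cancel-≋ (proj₂ (P-inj eq))
    ; cover  = λ x → case cover x of λ
        { ((s , i) , eq) → (s , -ᶻ i) , trans eq (cong (λ j → P (s , j)) (sym (ℤ.neg-involutive i))) }
    ; adj⇒   = λ { {s , i} adj → case adj⇒ adj of λ
        { (fwd , eq) → bwd , trans eq (cong (λ j → P (s , j)) (neg-bwd i (κ s)))
        ; (bwd , eq) → fwd , trans eq (cong (λ j → P (s , j)) (neg-fwd i (κ s)))
        ; (spk , eq) → spk , eq } }
    ; adj⇐   = λ
        { (s , i) fwd → subst (λ j → Adj _ (P (s , j))) (neg-fwd i (κ s)) (adj⇐ (s , -ᶻ i) bwd)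
        ; (s , i) bwd → subst (λ j → Adj _ (P (s , j))) (neg-bwd i (κ s)) (adj⇐ (s , -ᶻ i) fwd)
        ; (s , i) spk → adj⇐ (s , -ᶻ i) spk }
    }
    where
    open Labelling L
    neg-fwd : ∀ i κ → -ᶻ i -ᶻ κ ≡ -ᶻ (i +ᶻ κ)
    neg-fwd = solve-∀
    neg-bwd : ∀ i κ → -ᶻ i +ᶻ κ ≡ -ᶻ (i -ᶻ κ)
    neg-bwd = solve-∀

module Vertices (n k : ℕ) .{{_ : NonZero n}} where
  open Congruence n
  open Petersen n k

  modFin : ℤ → Fin n
  modFin i = fromℕ< (residue<n i)

  modFin-≋ : ∀ i → i ≋ + toℕ (modFin i)
  modFin-≋ i = subst (λ r → i ≋ + r) (sym (Fin.toℕ-fromℕ< (residue<n i))) (≋-residue i)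

  modFin-unique : ∀ {i f} → i ≋ + toℕ f → f ≡ modFin i
  modFin-unique {i} {f} i≋f = Fin.toℕ-injective (residue-unique (Fin.toℕ<n f) (Fin.toℕ<n (modFin i))
    (≋-trans (≋-sym i≋f) (modFin-≋ i)))

  vertex : Label → PVertex n
  vertex (out , i) = u (modFin i)
  vertex (inn , i) = v (modFin i)

  vertex-cong : ∀ {s i j} → i ≋ j → vertex (s , i) ≡ vertex (s , j)
  vertex-cong {out} i≋j = cong u (modFin-unique (≋-trans (≋-sym i≋j) (modFin-≋ _)))
  vertex-cong {inn} i≋j = cong v (modFin-unique (≋-trans (≋-sym i≋j) (modFin-≋ _)))

  vertex-inj : ∀ {s i t j} → vertex (s , i) ≡ vertex (t , j) → s ≡ t × i ≋ j
  vertex-inj {out} {i} {out} {j} eq = refl , same (u-inj eq)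
    where
    u-inj : ∀ {f g} → u f ≡ u g → f ≡ g
    u-inj refl = refl
    same : modFin i ≡ modFin j → i ≋ j
    same f≡g = ≋-trans (modFin-≋ i) (≋-trans (≡⇒≋ (cong (λ f → + toℕ f) f≡g)) (≋-sym (modFin-≋ j)))
  vertex-inj {inn} {i} {inn} {j} eq = refl , same (v-inj eq)
    where
    v-inj : ∀ {f g} → v f ≡ v g → f ≡ g
    v-inj refl = refl
    same : modFin i ≡ modFin j → i ≋ j
    same f≡g = ≋-trans (modFin-≋ i) (≋-trans (≡⇒≋ (cong (λ f → + toℕ f) f≡g)) (≋-sym (modFin-≋ j)))

  vertex-cover : ∀ x → ∃ λ l → x ≡ vertex l
  vertex-cover (u f) = (out , + toℕ f) , cong u (modFin-unique (≡⇒≋ refl))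
  vertex-cover (v f) = (inn , + toℕ f) , cong v (modFin-unique (≡⇒≋ refl))

  private
    forward : ∀ f g c → CongMod n (toℕ f + c) (toℕ g) → + toℕ f +ᶻ + c ≋ + toℕ g
    forward f g c n∣ = ∣⇒≋ {+ toℕ {n} f +ᶻ + c} {+ toℕ {n} g} n∣

    backward : ∀ f g c → CongMod n (toℕ g + c) (toℕ f) → + toℕ f -ᶻ + c ≋ + toℕ g
    backward f g c n∣ = linear (-ᶻ + 1) (lemma (+ toℕ {n} f) (+ toℕ {n} g) (+ c)) (forward g f c n∣)
      where
      lemma : ∀ f g c → (f -ᶻ c) -ᶻ g ≡ -ᶻ + 1 *ᶻ ((g +ᶻ c) -ᶻ f)
      lemma = solve-∀

    follow : ∀ i f c → + toℕ (modFin i) +ᶻ c ≋ + toℕ f → f ≡ modFin (i +ᶻ c)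
    follow i f c step = modFin-unique (≋-trans (+-congʳ-≋ c (modFin-≋ i)) step)

  gpadj⇒ : ∀ l {y} → GPAdj n k (vertex l) y → ∃ λ d → y ≡ vertex (nbr l d)
  gpadj⇒ (out , i) (outer {j = f} n∣)  = fwd , cong u (follow i f (+ 1) (forward (modFin i) f 1 n∣))
  gpadj⇒ (out , i) (outer′ {j = f} n∣) = bwd , cong u (follow i f (-ᶻ + 1) (backward (modFin i) f 1 n∣))
  gpadj⇒ (out , i) (spoke _)           = spk , refl
  gpadj⇒ (inn , i) (inner {j = f} n∣)  = fwd , cong v (follow i f (+ k) (forward (modFin i) f k n∣))
  gpadj⇒ (inn , i) (inner′ {j = f} n∣) = bwd , cong v (follow i f (-ᶻ + k) (backward (modFin i) f k n∣))
  gpadj⇒ (inn , i) (spoke′ _)          = spk , refl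

  private
    ahead : ∀ i c → CongMod n (toℕ (modFin i) + c) (toℕ (modFin (i +ᶻ + c)))
    ahead i c = ≋⇒∣ {+ toℕ (modFin i) +ᶻ + c} {+ toℕ (modFin (i +ᶻ + c))}
      (≋-trans (+-congʳ-≋ (+ c) (≋-sym (modFin-≋ i))) (modFin-≋ (i +ᶻ + c)))

    behind : ∀ i c → CongMod n (toℕ (modFin (i -ᶻ + c)) + c) (toℕ (modFin i))
    behind i c = ≋⇒∣ {+ toℕ (modFin (i -ᶻ + c)) +ᶻ + c} {+ toℕ (modFin i)}
      (≋-trans (+-congʳ-≋ (+ c) (≋-sym (modFin-≋ (i -ᶻ + c))))
      (≋-trans (≡⇒≋ (lemma i (+ c))) (modFin-≋ i)))
      where
      lemma : ∀ i c → i -ᶻ c +ᶻ c ≡ i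
      lemma = solve-∀

  gpadj⇐ : ∀ l d → GPAdj n k (vertex l) (vertex (nbr l d))
  gpadj⇐ (out , i) fwd = outer (ahead i 1)
  gpadj⇐ (out , i) bwd = outer′ (behind i 1)
  gpadj⇐ (out , i) spk = spoke (modFin i)
  gpadj⇐ (inn , i) fwd = inner (ahead i k)
  gpadj⇐ (inn , i) bwd = inner′ (behind i k)
  gpadj⇐ (inn , i) spk = spoke′ (modFin i)

  labelling : ∀ {M : Set} {Adj : M → M → Set} (iso : PVertex n ↔ M) →
              (∀ x y → GPAdj n k x y ⇔ Adj (Inverse.to iso x) (Inverse.to iso y)) → Labelling Adj
  labelling {Adj = Adj} iso iso-adj = record
    { P      = to ∘ vertex
    ; P-cong = cong to ∘ vertex-cong
    ; P-inj  = vertex-inj ∘ to-injective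
    ; cover  = λ x → let l , eq = vertex-cover (from x) in l , trans (sym (to∘from x)) (cong to eq)
    ; adj⇒   = λ {l} {y} adj → let
        d , eq = gpadj⇒ l (Equivalence.from (iso-adj (vertex l) (from y)) (subst (Adj _) (sym (to∘from y)) adj))
        in d , trans (sym (to∘from y)) (cong to eq)
    ; adj⇐   = λ l d → Equivalence.to (iso-adj _ _) (gpadj⇐ l d)
    }
    where
    open Inverse iso using (to; from)
    to∘from : ∀ y → to (from y) ≡ y
    to∘from y = Inverse.inverseˡ iso refl
    to-injective : ∀ {x y} → to x ≡ to y → x ≡ y
    to-injective eq = trans (sym (Inverse.inverseʳ iso refl)) (trans (cong from eq) (Inverse.inverseʳ iso refl))

module Distances (n k : ℕ) (0<k : 0 < k) (2k<n : 2 * k < n) where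
  open Congruence n
  open Petersen n k

  step : Side → ℕ
  step out = 1
  step inn = k

  κ≡step : ∀ s → κ s ≡ + step s
  κ≡step out = refl
  κ≡step inn = refl

  0<step : ∀ s → 0 < step s
  0<step out = s≤s z≤n
  0<step inn = 0<k

  step≤k : ∀ s → step s ≤ k
  step≤k out = 0<k
  step≤k inn = ℕ.≤-refl

  2step<n : ∀ s → step s + step s < n
  2step<n s = ℕ.≤-<-trans (ℕ.+-mono-≤ (step≤k s) (ℕ.≤-trans (step≤k s) (ℕ.≤-reflexive (sym (ℕ.+-identityʳ k))))) 2k<n

  step<n : ∀ s → step s < n
  step<n s = ℕ.≤-<-trans (ℕ.m≤m+n (step s) (step s)) (2step<n s)

  2<n : 2 < n
  2<n = 2step<n out

  n≢0 : NonZero n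
  n≢0 = ℕ.>-nonZero (ℕ.≤-<-trans z≤n 2<n)

  κ≢0 : ∀ s i → ¬ i +ᶻ κ s ≋ i
  κ≢0 s i = distinct (step s) (trans (lemma i (κ s)) (κ≡step s)) (0<step s) (step<n s)
    where
    lemma : ∀ i κ → (i +ᶻ κ) -ᶻ i ≡ κ
    lemma = solve-∀

  -- The bound 2 k < n keeps the two neighbours on a rim apart, so that the graph is cubic.
  2κ≢0 : ∀ s i → ¬ i +ᶻ κ s ≋ i -ᶻ κ s
  2κ≢0 s i = distinct (step s + step s) (trans (lemma i (κ s)) (cong₂ _+ᶻ_ (κ≡step s) (κ≡step s)))
    (ℕ.≤-trans (0<step s) (ℕ.m≤m+n (step s) (step s))) (2step<n s)
    where
    lemma : ∀ i κ → (i +ᶻ κ) -ᶻ (i -ᶻ κ) ≡ κ +ᶻ κ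
    lemma = solve-∀

  flip-≢ : ∀ {s} → s ≢ flip s
  flip-≢ {out} ()
  flip-≢ {inn} ()

  flip² : ∀ s → flip (flip s) ≡ s
  flip² out = refl
  flip² inn = refl

  module _ {M : Set} {Adj : M → M → Set} (L : Labelling Adj) where
    open Labelling L

    _≟ᴹ_ : DecidableEquality M
    x ≟ᴹ y with cover x | cover y
    ... | (s , i) , refl | (t , j) , refl with s ≟ˢ t
    ...   | no s≢t = no (s≢t ∘ proj₁ ∘ P-inj)
    ...   | yes refl = Dec.map′ P-cong (proj₂ ∘ P-inj) (i ≋? j)

    P-≡ : ∀ s {i j} → i ≡ j → P (s , i) ≡ P (s , j)
    P-≡ s = cong (λ j → P (s , j))

    sides-disjoint : ∀ {s i j} → P (s , i) ≢ P (flip s , j)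
    sides-disjoint eq = flip-≢ (proj₁ (P-inj eq))

    nbr-inj : ∀ l d d′ → P (nbr l d) ≡ P (nbr l d′) → d ≡ d′
    nbr-inj l fwd fwd eq = refl
    nbr-inj (s , i) fwd bwd eq = contradiction (proj₂ (P-inj eq)) (2κ≢0 s i)
    nbr-inj l fwd spk eq = contradiction eq sides-disjoint
    nbr-inj (s , i) bwd fwd eq = contradiction (proj₂ (P-inj (sym eq))) (2κ≢0 s i)
    nbr-inj l bwd bwd eq = refl
    nbr-inj l bwd spk eq = contradiction eq sides-disjoint
    nbr-inj l spk fwd eq = contradiction (sym eq) sides-disjoint
    nbr-inj l spk bwd eq = contradiction (sym eq) sides-disjoint
    nbr-inj l spk spk eq = refl

    nbr-rev : ∀ l d → P (nbr (nbr l d) (rev d)) ≡ P l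
    nbr-rev (s , i) fwd = P-≡ s (lemma i (κ s))
      where
      lemma : ∀ i κ → i +ᶻ κ -ᶻ κ ≡ i
      lemma = solve-∀
    nbr-rev (s , i) bwd = P-≡ s (lemma i (κ s))
      where
      lemma : ∀ i κ → i -ᶻ κ +ᶻ κ ≡ i
      lemma = solve-∀
    nbr-rev (s , i) spk = cong (λ t → P (t , i)) (flip² s)

-- A unit among the two generators

-- The vertex e has three neighbours, so some neighbour z of e is not a generator; it is the inverse of a generator a.
record UnitRep (n k : ℕ) : Set₁ where
  open Petersen n k
  field
    M         : Set
    _∙_       : M → M → M
    e         : M
    isMonoid  : IsMonoid _≡_ _∙_ e
    a b z     : M
    generated : ∀ x → Gen _∙_ e a b x
    za≡e      : z ∙ a ≡ e
    az≡e      : a ∙ z ≡ e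
    z≢a       : z ≢ a
    z≢b       : z ≢ b
    a≢b       : a ≢ b
    lab       : Labelling (CayAdj _∙_ a b)
  open IsMonoid isMonoid public using (assoc) renaming (identityˡ to e∙; identityʳ to ∙e)
  open Labelling lab public

module Units {n k : ℕ} (0<k : 0 < k) (2k<n : 2 * k < n) (rep : MonoidCayleyRep n k) where
  open MonoidCayleyRep rep
  open IsMonoid isMonoid using (assoc) renaming (identityˡ to e∙; identityʳ to ∙e)
  open Congruence n
  open Petersen n k
  open Distances n k 0<k 2k<n

  instance
    nonZero : NonZero n
    nonZero = n≢0

  open Vertices n k

  lab₀ : Labelling (CayAdj _∙_ c₁ c₂)
  lab₀ = labelling iso iso-adj
  open Labelling lab₀

  index : PVertex n → Fin (n + n)
  index (u i) = Fin.join n n (inj₁ i)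
  index (v i) = Fin.join n n (inj₂ i)

  index-inj : ∀ {x y} → index x ≡ index y → x ≡ y
  index-inj {x} {y} eq = lemma x y (trans (sym (Fin.splitAt-join n n (tag x)))
    (trans (cong (Fin.splitAt n) (trans (sym (index≡ x)) (trans eq (index≡ y)))) (Fin.splitAt-join n n (tag y))))
    where
    tag : PVertex n → Fin n ⊎ Fin n
    tag (u i) = inj₁ i
    tag (v i) = inj₂ i
    index≡ : ∀ x → index x ≡ Fin.join n n (tag x)
    index≡ (u i) = refl
    index≡ (v i) = refl
    lemma : ∀ x y → tag x ≡ tag y → x ≡ y
    lemma (u i) (u .i) refl = refl
    lemma (v i) (v .i) refl = refl

  pow : M → ℕ → M
  pow c zero = e
  pow c (suc m) = c ∙ pow c m

  -- Two powers of c coincide by finiteness, and cancelling with w on the left makes w a power of c.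
  left-inverse⇒right : ∀ {w c} → w ∙ c ≡ e → c ∙ w ≡ e
  left-inverse⇒right {w} {c} wc≡e
    with Fin.pigeonhole (ℕ.n<1+n (n + n)) (index ∘ Inverse.from iso ∘ pow c ∘ toℕ)
  ... | i , j , i<j , eq = powers i<j (from-inj (index-inj eq))
    where
    from-inj : ∀ {x y} → Inverse.from iso x ≡ Inverse.from iso y → x ≡ y
    from-inj eq = trans (sym (Inverse.inverseˡ iso refl)) (trans (cong (Inverse.to iso) eq) (Inverse.inverseˡ iso refl))
    cancel : ∀ x → w ∙ (c ∙ x) ≡ x
    cancel x = trans (sym (assoc w c x)) (trans (cong (_∙ x) wc≡e) (e∙ x))
    powers : ∀ {i j} → i < j → pow c i ≡ pow c j → c ∙ w ≡ e
    powers {zero} {suc j} _ eq = trans (cong (c ∙_) (trans (trans (sym (∙e w)) (cong (w ∙_) eq)) (cancel _))) (sym eq)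
    powers {suc i} {suc j} (s≤s i<j) eq = powers i<j (trans (sym (cancel _)) (trans (cong (w ∙_) eq) (cancel _)))

  swap : ∀ {s t} → CayAdj _∙_ c₁ c₂ s t → CayAdj _∙_ c₂ c₁ s t
  swap (s≢t , c , inj₁ eq , arc) = s≢t , c , inj₂ eq , arc
  swap (s≢t , c , inj₂ eq , arc) = s≢t , c , inj₁ eq , arc

  swap⁻¹ : ∀ {s t} → CayAdj _∙_ c₂ c₁ s t → CayAdj _∙_ c₁ c₂ s t
  swap⁻¹ (s≢t , c , inj₁ eq , arc) = s≢t , c , inj₂ eq , arc
  swap⁻¹ (s≢t , c , inj₂ eq , arc) = s≢t , c , inj₁ eq , arc

  swap-Gen : ∀ {x} → Gen _∙_ e c₁ c₂ x → Gen _∙_ e c₂ c₁ x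
  swap-Gen gen-ε = gen-ε
  swap-Gen (gen-∙ g (inj₁ eq)) = gen-∙ (swap-Gen g) (inj₂ eq)
  swap-Gen (gen-∙ g (inj₂ eq)) = gen-∙ (swap-Gen g) (inj₁ eq)

  unitRep : UnitRep n k
  unitRep with cover e
  ... | l , e≡ = result
    where
    _≟_ = _≟ᴹ_ lab₀
    p : Dir → M
    p d = P (nbr l d)

    generator? : ∀ d → (p d ≡ c₁ ⊎ p d ≡ c₂) ⊎ (p d ≢ c₁ × p d ≢ c₂)
    generator? d with p d ≟ c₁ | p d ≟ c₂
    ... | yes eq | _ = inj₁ (inj₁ eq)
    ... | no _ | yes eq = inj₁ (inj₂ eq)
    ... | no ≢₁ | no ≢₂ = inj₂ (≢₁ , ≢₂)

    clash : ∀ {c} d d′ → d ≢ d′ → p d ≡ c → p d′ ≡ c → ⊥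
    clash d d′ d≢d′ eq eq′ = d≢d′ (nbr-inj lab₀ l d d′ (trans eq (sym eq′)))

    third : ∃ λ d → p d ≢ c₁ × p d ≢ c₂
    third with generator? fwd | generator? bwd | generator? spk
    ... | inj₂ neither | _ | _ = fwd , neither
    ... | inj₁ _ | inj₂ neither | _ = bwd , neither
    ... | inj₁ _ | inj₁ _ | inj₂ neither = spk , neither
    ... | inj₁ (inj₁ f) | inj₁ (inj₁ g) | inj₁ _ = ⊥-elim (clash fwd bwd (λ ()) f g)
    ... | inj₁ (inj₂ f) | inj₁ (inj₂ g) | inj₁ _ = ⊥-elim (clash fwd bwd (λ ()) f g)
    ... | inj₁ (inj₁ f) | inj₁ (inj₂ g) | inj₁ (inj₁ h) = ⊥-elim (clash fwd spk (λ ()) f h)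
    ... | inj₁ (inj₁ f) | inj₁ (inj₂ g) | inj₁ (inj₂ h) = ⊥-elim (clash bwd spk (λ ()) g h)
    ... | inj₁ (inj₂ f) | inj₁ (inj₁ g) | inj₁ (inj₁ h) = ⊥-elim (clash bwd spk (λ ()) g h)
    ... | inj₁ (inj₂ f) | inj₁ (inj₁ g) | inj₁ (inj₂ h) = ⊥-elim (clash fwd spk (λ ()) f h)

    result : UnitRep n k
    result with third
    ... | d , z≢c₁ , z≢c₂ with adj⇐ l d
    ...   | _ , c , inj₁ refl , inj₁ eq = ⊥-elim (z≢c₁ (trans eq (trans (cong (_∙ c₁) (sym e≡)) (e∙ c₁))))
    ...   | _ , c , inj₂ refl , inj₁ eq = ⊥-elim (z≢c₂ (trans eq (trans (cong (_∙ c₂) (sym e≡)) (e∙ c₂))))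
    ...   | _ , c , inj₁ refl , inj₂ eq = record
      { isMonoid = isMonoid ; a = c₁ ; b = c₂ ; z = p d ; generated = generated
      ; za≡e = sym (trans e≡ eq) ; az≡e = left-inverse⇒right (sym (trans e≡ eq))
      ; z≢a = z≢c₁ ; z≢b = z≢c₂ ; a≢b = c₁≢c₂ ; lab = lab₀ }
    ...   | _ , c , inj₂ refl , inj₂ eq = record
      { isMonoid = isMonoid ; a = c₂ ; b = c₁ ; z = p d ; generated = swap-Gen ∘ generated
      ; za≡e = sym (trans e≡ eq) ; az≡e = left-inverse⇒right (sym (trans e≡ eq))
      ; z≢a = z≢c₂ ; z≢b = z≢c₁ ; a≢b = c₁≢c₂ ∘ sym
      ; lab = labelling iso λ x y → mk⇔ (swap ∘ Equivalence.to (iso-adj x y)) (Equivalence.from (iso-adj x y) ∘ swap⁻¹) }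

-- Counting non-backtracking closed walks

data Rim : Dir → Set where
  fwd : Rim fwd
  bwd : Rim bwd

rim? : ∀ d → d ≡ spk ⊎ Rim d
rim? fwd = inj₂ fwd
rim? bwd = inj₂ bwd
rim? spk = inj₁ refl

rim-rev : ∀ {d} → Rim d → Rim (rev d)
rim-rev fwd = bwd
rim-rev bwd = fwd

rim-other : ∀ {f g} → Rim f → g ≢ f → g ≢ spk → g ≡ rev f
rim-other {g = fwd} fwd g≢f _ = contradiction refl g≢f
rim-other {g = bwd} fwd _ _ = refl
rim-other {g = spk} _ _ g≢spk = contradiction refl g≢spk
rim-other {g = fwd} bwd _ _ = refl
rim-other {g = bwd} bwd g≢f _ = contradiction refl g≢f

exchanged : (π : Dir → Dir) → (∀ d d′ → π d ≡ π d′ → d ≡ d′) → Rim (π spk) →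
            ∃ λ d → Rim d × π d ≡ spk × π (rev d) ≡ rev (π spk)
exchanged π inj r with π fwd ≟ᵈ spk | π bwd ≟ᵈ spk
... | yes πf≡spk | _ = fwd , fwd , πf≡spk ,
  rim-other r (λ eq → case inj _ _ eq of λ ()) (λ eq → case inj _ _ (trans eq (sym πf≡spk)) of λ ())
... | no _ | yes πb≡spk = bwd , bwd , πb≡spk ,
  rim-other r (λ eq → case inj _ _ eq of λ ()) (λ eq → case inj _ _ (trans eq (sym πb≡spk)) of λ ())
... | no πf≢spk | no πb≢spk = case inj fwd bwd (trans
  (rim-other r (λ eq → case inj _ _ eq of λ ()) πf≢spk)
  (sym (rim-other r (λ eq → case inj _ _ eq of λ ()) πb≢spk))) of λ ()

next₁ next₂ : Dir → Dir
next₁ fwd = fwd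
next₁ bwd = bwd
next₁ spk = fwd
next₂ fwd = spk
next₂ bwd = spk
next₂ spk = bwd

next₁≢rev : ∀ d → next₁ d ≢ rev d
next₁≢rev fwd ()
next₁≢rev bwd ()
next₁≢rev spk ()

next₂≢rev : ∀ d → next₂ d ≢ rev d
next₂≢rev fwd ()
next₂≢rev bwd ()
next₂≢rev spk ()

next₁≢next₂ : ∀ d → next₁ d ≢ next₂ d
next₁≢next₂ fwd ()
next₁≢next₂ bwd ()
next₁≢next₂ spk ()

next-cases : ∀ d f → f ≢ rev d → f ≡ next₁ d ⊎ f ≡ next₂ d
next-cases fwd fwd _ = inj₁ refl
next-cases fwd bwd f≢ = contradiction refl f≢
next-cases fwd spk _ = inj₂ refl
next-cases bwd fwd f≢ = contradiction refl f≢
next-cases bwd bwd _ = inj₁ refl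
next-cases bwd spk _ = inj₂ refl
next-cases spk fwd _ = inj₁ refl
next-cases spk bwd _ = inj₂ refl
next-cases spk spk f≢ = contradiction refl f≢

next-both : ∀ d f g → f ≢ rev d → g ≢ rev d → f ≢ g →
            (f ≡ next₁ d × g ≡ next₂ d) ⊎ (f ≡ next₂ d × g ≡ next₁ d)
next-both d f g f≢ g≢ f≢g with next-cases d f f≢ | next-cases d g g≢
... | inj₁ refl | inj₁ refl = contradiction refl f≢g
... | inj₁ f≡ | inj₂ g≡ = inj₁ (f≡ , g≡)
... | inj₂ f≡ | inj₁ g≡ = inj₂ (f≡ , g≡)
... | inj₂ refl | inj₂ refl = contradiction refl f≢g

𝟙 : Bool → ℕ
𝟙 b = if b then 1 else 0

-- The place reached from the origin by p outer and q inner steps.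
Place : Set
Place = Side × ℤ × ℤ

go : Place → Dir → Place
go (out , p , q) fwd = out , p +ᶻ + 1 , q
go (out , p , q) bwd = out , p -ᶻ + 1 , q
go (out , p , q) spk = inn , p , q
go (inn , p , q) fwd = inn , p , q +ᶻ + 1
go (inn , p , q) bwd = inn , p , q -ᶻ + 1
go (inn , p , q) spk = out , p , q

mirror : Dir → Dir
mirror fwd = bwd
mirror bwd = fwd
mirror spk = spk

mirrorᴾ : Place → Place
mirrorᴾ (s , p , q) = s , -ᶻ p , -ᶻ q

go-mirror : ∀ x d → go (mirrorᴾ x) (mirror d) ≡ mirrorᴾ (go x d)
go-mirror (out , p , q) fwd = cong (λ p → out , p , -ᶻ q) (sym (ℤ.neg-distrib-+ p (+ 1)))
go-mirror (out , p , q) bwd = cong (λ p → out , p , -ᶻ q) (sym (ℤ.neg-distrib-+ p (-ᶻ + 1)))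
go-mirror (out , p , q) spk = refl
go-mirror (inn , p , q) fwd = cong (λ q → inn , -ᶻ p , q) (sym (ℤ.neg-distrib-+ q (+ 1)))
go-mirror (inn , p , q) bwd = cong (λ q → inn , -ᶻ p , q) (sym (ℤ.neg-distrib-+ q (-ᶻ + 1)))
go-mirror (inn , p , q) spk = refl

-- Endpoints on side t of the non-backtracking walks of l + 1 steps starting with direction d.
ends : ℕ → Place → Dir → Side → List (ℤ × ℤ)
ends zero x d t with go x d
... | s , p , q = if does (s ≟ˢ t) then (p , q) ∷ [] else []
ends (suc l) x d t = ends l (go x d) (next₁ d) t ++ ends l (go x d) (next₂ d) t

-- The walks that leave s in direction d′, seen from its neighbour in direction d.
walks : ℕ → Side → Dir → Dir → List (ℤ × ℤ)
walks l s d d′ with go (s , + 0 , + 0) d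
... | t , p , q = ends l (s , -ᶻ p , -ᶻ q) d′ t

module Walks (n k : ℕ) where
  χ : ℤ → ℕ
  χ i = 𝟙 (does (n ∣ℕ? ℤ.∣ i ∣))

  at : ℤ × ℤ → ℤ
  at (p , q) = p +ᶻ q *ᶻ + k

  closed : List (ℤ × ℤ) → ℕ
  closed = sum ∘ map (χ ∘ at)

  -- The number of closed walks of length l + 2 (in the sense of walks) that pass a vertex of the rim s,
  -- coming from its neighbour in direction d and leaving in direction d′.
  F : ℕ → Side → Dir → Dir → ℕ
  F l s d d′ = closed (walks l s d d′)

  -- The walks of length l + 2 do not tell apart the four kinds of paths of length two.
  Constant : ℕ → Set
  Constant l = (F l out bwd fwd ≡ F l out bwd spk) × (F l out bwd fwd ≡ F l inn spk fwd) ×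
               (F l out bwd fwd ≡ F l inn bwd fwd)

  constant? : ∀ l → Dec (Constant l)
  constant? l = (F l out bwd fwd ℕ.≟ F l out bwd spk) ×-dec (F l out bwd fwd ℕ.≟ F l inn spk fwd) ×-dec
                (F l out bwd fwd ℕ.≟ F l inn bwd fwd)

  closed-++ : ∀ xs ys → closed (xs ++ ys) ≡ closed xs + closed ys
  closed-++ [] ys = refl
  closed-++ (x ∷ xs) ys = trans (cong (λ m → χ (at x) + m) (closed-++ xs ys)) (sym (ℕ.+-assoc (χ (at x)) _ _))

  χ-neg : ∀ i → χ (-ᶻ i) ≡ χ i
  χ-neg i = cong (λ m → 𝟙 (does (n ∣ℕ? m))) (ℤ.∣-i∣≡∣i∣ i)

  χ-at-neg : ∀ p q → χ (at (-ᶻ p , -ᶻ q)) ≡ χ (at (p , q))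
  χ-at-neg p q = trans (cong χ (lemma p q (+ k))) (χ-neg (at (p , q)))
    where
    lemma : ∀ p q k → -ᶻ p +ᶻ -ᶻ q *ᶻ k ≡ -ᶻ (p +ᶻ q *ᶻ k)
    lemma = solve-∀

  closed-ends-mirror : ∀ l x d t → closed (ends l (mirrorᴾ x) (mirror d) t) ≡ closed (ends l x d t)
  closed-ends-mirror zero x d t rewrite go-mirror x d with go x d
  ... | s , p , q with does (s ≟ˢ t)
  ...   | true  = cong (_+ 0) (χ-at-neg p q)
  ...   | false = refl
  closed-ends-mirror (suc l) x d t rewrite go-mirror x d = begin
    closed (ends l y′ (next₁ (mirror d)) t ++ ends l y′ (next₂ (mirror d)) t)
      ≡⟨ closed-++ (ends l y′ (next₁ (mirror d)) t) _ ⟩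
    closed (ends l y′ (next₁ (mirror d)) t) + closed (ends l y′ (next₂ (mirror d)) t)
      ≡⟨ next d ⟩
    closed (ends l y (next₁ d) t) + closed (ends l y (next₂ d) t)
      ≡⟨ sym (closed-++ (ends l y (next₁ d) t) _) ⟩
    closed (ends l y (next₁ d) t ++ ends l y (next₂ d) t) ∎
    where
    open ≡-Reasoning
    y y′ : Place
    y = go x d
    y′ = mirrorᴾ y
    next : ∀ d → closed (ends l y′ (next₁ (mirror d)) t) + closed (ends l y′ (next₂ (mirror d)) t)
               ≡ closed (ends l y (next₁ d) t) + closed (ends l y (next₂ d) t)
    next fwd = cong₂ _+_ (closed-ends-mirror l y fwd t) (closed-ends-mirror l y spk t)
    next bwd = cong₂ _+_ (closed-ends-mirror l y bwd t) (closed-ends-mirror l y spk t)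
    next spk = trans (cong₂ _+_ (closed-ends-mirror l y bwd t) (closed-ends-mirror l y fwd t))
                     (ℕ.+-comm (closed (ends l y bwd t)) _)

  -- The reflection `i ↦ - i` reverses all rims at once, which is why `Constant` can pick one
  -- direction for each kind of path.
  F-mirror : ∀ l s d d′ → F l s (mirror d) (mirror d′) ≡ F l s d d′
  F-mirror l out fwd d′ = closed-ends-mirror l (out , -ᶻ + 1 , + 0) d′ out
  F-mirror l out bwd d′ = closed-ends-mirror l (out , + 1 , + 0) d′ out
  F-mirror l out spk d′ = closed-ends-mirror l (out , + 0 , + 0) d′ inn
  F-mirror l inn fwd d′ = closed-ends-mirror l (inn , + 0 , -ᶻ + 1) d′ inn
  F-mirror l inn bwd d′ = closed-ends-mirror l (inn , + 0 , + 1) d′ inn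
  F-mirror l inn spk d′ = closed-ends-mirror l (inn , + 0 , + 0) d′ out

  F-along : ∀ l s {d} → Rim d → F l s d (rev d) ≡ F l s bwd fwd
  F-along l s fwd = F-mirror l s bwd fwd
  F-along l s bwd = refl

  F-leave : ∀ l s {d} → Rim d → F l s d spk ≡ F l s bwd spk
  F-leave l s fwd = F-mirror l s bwd spk
  F-leave l s bwd = refl

  F-enter : ∀ l s {d} → Rim d → F l s spk d ≡ F l s spk fwd
  F-enter l s fwd = refl
  F-enter l s bwd = F-mirror l s spk fwd

  F-along⁻ : ∀ l s {d} → Rim d → F l s (rev d) d ≡ F l s bwd fwd
  F-along⁻ l s fwd = refl
  F-along⁻ l s bwd = F-mirror l s bwd fwd

-- Automorphisms and the set of spokes

module Rigidity {n k : ℕ} (0<k : 0 < k) (2k<n : 2 * k < n) {M : Set} {Adj : M → M → Set}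
                (L : Petersen.Labelling n k Adj) where
  open Congruence n
  open Petersen n k
  open Labelling L
  open Distances n k 0<k 2k<n
  open Walks n k

  δ : M → M → ℕ
  δ x y = 𝟙 (does (_≟ᴹ_ L x y))

  -- The same count inside the graph, where an automorphism can act on the walks; `count-walks`
  -- equates it with `F`, which is independent of the labelling and can be evaluated.
  count : ℕ → Label → Dir → M → ℕ
  count zero l d t = δ (P (nbr l d)) t
  count (suc m) l d t = count m (nbr l d) (next₁ d) t + count m (nbr l d) (next₂ d) t

  place : ℤ → Place → Label
  place i (s , p , q) = s , i +ᶻ at (p , q)

  nbr-place : ∀ i x d → nbr (place i x) d ≡ place i (go x d)
  nbr-place i (out , p , q) fwd = cong (out ,_) (lemma i p q (+ k))
    where
    lemma : ∀ i p q k → (i +ᶻ (p +ᶻ q *ᶻ k)) +ᶻ + 1 ≡ i +ᶻ ((p +ᶻ + 1) +ᶻ q *ᶻ k)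
    lemma = solve-∀
  nbr-place i (out , p , q) bwd = cong (out ,_) (lemma i p q (+ k))
    where
    lemma : ∀ i p q k → (i +ᶻ (p +ᶻ q *ᶻ k)) -ᶻ + 1 ≡ i +ᶻ ((p -ᶻ + 1) +ᶻ q *ᶻ k)
    lemma = solve-∀
  nbr-place i (out , p , q) spk = refl
  nbr-place i (inn , p , q) fwd = cong (inn ,_) (lemma i p q (+ k))
    where
    lemma : ∀ i p q k → (i +ᶻ (p +ᶻ q *ᶻ k)) +ᶻ k ≡ i +ᶻ (p +ᶻ (q +ᶻ + 1) *ᶻ k)
    lemma = solve-∀
  nbr-place i (inn , p , q) bwd = cong (inn ,_) (lemma i p q (+ k))
    where
    lemma : ∀ i p q k → (i +ᶻ (p +ᶻ q *ᶻ k)) -ᶻ k ≡ i +ᶻ (p +ᶻ (q -ᶻ + 1) *ᶻ k)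
    lemma = solve-∀
  nbr-place i (inn , p , q) spk = refl

  δ-place : ∀ i x t → δ (P (place i x)) (P (t , i)) ≡
            closed (if does (proj₁ x ≟ˢ t) then proj₂ x ∷ [] else [])
  δ-place i (s , p , q) t with s ≟ˢ t
  ... | yes refl = trans (cong 𝟙 (Dec.does-⇔ (mk⇔ onward back) (_≟ᴹ_ L (P (s , i +ᶻ j)) (P (s , i))) (n ∣ℕ? ℤ.∣ j ∣)))
                         (sym (ℕ.+-identityʳ _))
    where
    j : ℤ
    j = at (p , q)
    cancel : ∀ i j → (i +ᶻ j) -ᶻ i ≡ j
    cancel = solve-∀
    onward : P (s , i +ᶻ j) ≡ P (s , i) → n ∣ℕ ℤ.∣ j ∣
    onward eq = subst (λ d → n ∣ℕ ℤ.∣ d ∣) (cancel i j) (≋⇒∣ (proj₂ (P-inj eq)))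
    back : n ∣ℕ ℤ.∣ j ∣ → P (s , i +ᶻ j) ≡ P (s , i)
    back n∣j = P-cong (∣⇒≋ (subst (λ d → n ∣ℕ ℤ.∣ d ∣) (sym (cancel i j)) n∣j))
  ... | no s≢t with _≟ᴹ_ L (P (s , i +ᶻ at (p , q))) (P (t , i))
  ...   | yes eq = contradiction (proj₁ (P-inj eq)) s≢t
  ...   | no _ = refl

  count-ends : ∀ m i x d t → count m (place i x) d (P (t , i)) ≡ closed (ends m x d t)
  count-ends zero i x d t = trans (cong (λ l → δ (P l) (P (t , i))) (nbr-place i x d)) (δ-place i (go x d) t)
  count-ends (suc m) i x d t rewrite nbr-place i x d =
    trans (cong₂ _+_ (count-ends m i (go x d) (next₁ d) t) (count-ends m i (go x d) (next₂ d) t))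
          (sym (closed-++ (ends m (go x d) (next₁ d) t) _))

  private
    start : ∀ s i d → let t , p , q = go (s , + 0 , + 0) d in
            place (proj₂ (nbr (s , i) d)) (s , -ᶻ p , -ᶻ q) ≡ (s , i)
    start out i fwd = cong (out ,_) (lemma i (+ k))
      where
      lemma : ∀ i k → (i +ᶻ + 1) +ᶻ (-ᶻ + 1 +ᶻ + 0 *ᶻ k) ≡ i
      lemma = solve-∀
    start out i bwd = cong (out ,_) (lemma i (+ k))
      where
      lemma : ∀ i k → (i -ᶻ + 1) +ᶻ (+ 1 +ᶻ + 0 *ᶻ k) ≡ i
      lemma = solve-∀
    start out i spk = cong (out ,_) (lemma i (+ k))
      where
      lemma : ∀ i k → i +ᶻ (+ 0 +ᶻ + 0 *ᶻ k) ≡ i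
      lemma = solve-∀
    start inn i fwd = cong (inn ,_) (lemma i (+ k))
      where
      lemma : ∀ i k → (i +ᶻ k) +ᶻ (+ 0 +ᶻ (-ᶻ + 1) *ᶻ k) ≡ i
      lemma = solve-∀
    start inn i bwd = cong (inn ,_) (lemma i (+ k))
      where
      lemma : ∀ i k → (i -ᶻ k) +ᶻ (+ 0 +ᶻ + 1 *ᶻ k) ≡ i
      lemma = solve-∀
    start inn i spk = cong (inn ,_) (lemma i (+ k))
      where
      lemma : ∀ i k → i +ᶻ (+ 0 +ᶻ + 0 *ᶻ k) ≡ i
      lemma = solve-∀

    side-nbr : ∀ s i d → proj₁ (nbr (s , i) d) ≡ proj₁ (go (s , + 0 , + 0) d)
    side-nbr out i fwd = refl
    side-nbr out i bwd = refl
    side-nbr out i spk = refl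
    side-nbr inn i fwd = refl
    side-nbr inn i bwd = refl
    side-nbr inn i spk = refl

  count-walks : ∀ m s i d d′ → count m (s , i) d′ (P (nbr (s , i) d)) ≡ F m s d d′
  count-walks m s i d d′ = trans
    (cong₂ (λ l t → count m l d′ (P (t , proj₂ (nbr (s , i) d)))) (sym (start s i d)) (side-nbr s i d))
    (count-ends m (proj₂ (nbr (s , i) d)) _ d′ _)

  module Automorphism (α : M → M) (α-inj : ∀ {x y} → α x ≡ α y → x ≡ y)
                      (α-adj : ∀ {x y} → Adj x y → Adj (α x) (α y)) where

    image : ∀ {l l′} d → α (P l) ≡ P l′ → ∃ λ f → α (P (nbr l d)) ≡ P (nbr l′ f)
    image {l} d αl = adj⇒ (subst (λ x → Adj x (α (P (nbr l d)))) αl (α-adj (adj⇐ l d)))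

    δ-image : ∀ x y → δ x y ≡ δ (α x) (α y)
    δ-image x y = cong 𝟙 (Dec.does-⇔ (mk⇔ (cong α) α-inj) (_≟ᴹ_ L x y) (_≟ᴹ_ L (α x) (α y)))

    distinct-images : ∀ l l′ {d f d′ f′} → α (P (nbr l d)) ≡ P (nbr l′ f) → α (P (nbr l d′)) ≡ P (nbr l′ f′) →
                      d ≢ d′ → f ≢ f′
    distinct-images l l′ p p′ d≢d′ refl = d≢d′ (nbr-inj L l _ _ (α-inj (trans p (sym p′))))

    -- An automorphism respects backtracking, so it takes the two continuations after `d` to the two
    -- continuations after `f`, possibly in the other order, and the sum ignores the order.
    count-image : ∀ m {l l′} d f t → α (P l) ≡ P l′ → α (P (nbr l d)) ≡ P (nbr l′ f) →
                  count m l d t ≡ count m l′ f (α t)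
    count-image zero {l} d f t αl αd = trans (δ-image (P (nbr l d)) t) (cong (λ x → δ x (α t)) αd)
    count-image (suc m) {l} {l′} d f t αl αd
      with image (next₁ d) αd | image (next₂ d) αd
    ... | g₁ , α₁ | g₂ , α₂ with next-both f g₁ g₂
          (distinct-images (nbr l d) (nbr l′ f) α₁ αback (next₁≢rev d))
          (distinct-images (nbr l d) (nbr l′ f) α₂ αback (next₂≢rev d))
          (distinct-images (nbr l d) (nbr l′ f) α₁ α₂ (next₁≢next₂ d))
      where
      αback : α (P (nbr (nbr l d) (rev d))) ≡ P (nbr (nbr l′ f) (rev f))
      αback = trans (cong α (nbr-rev L l d)) (trans αl (sym (nbr-rev L l′ f)))
    ...   | inj₁ (refl , refl) = cong₂ _+_ (count-image m (next₁ d) _ t αd α₁) (count-image m (next₂ d) _ t αd α₂)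
    ...   | inj₂ (refl , refl) = trans
      (cong₂ _+_ (count-image m (next₁ d) _ t αd α₁) (count-image m (next₂ d) _ t αd α₂))
      (ℕ.+-comm (count m (nbr l′ f) (next₂ f) (α t)) _)

    F-image : ∀ m {s i t j} d d′ f f′ → α (P (s , i)) ≡ P (t , j) →
              α (P (nbr (s , i) d)) ≡ P (nbr (t , j) f) → α (P (nbr (s , i) d′)) ≡ P (nbr (t , j) f′) →
              F m s d d′ ≡ F m t f f′
    F-image m {s} {i} {t} {j} d d′ f f′ αl αd αd′ = begin
      F m s d d′ ≡⟨ sym (count-walks m s i d d′) ⟩
      count m (s , i) d′ (P (nbr (s , i) d)) ≡⟨ count-image m d′ f′ _ αl αd′ ⟩
      count m (t , j) f′ (α (P (nbr (s , i) d))) ≡⟨ cong (count m (t , j) f′) αd ⟩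
      count m (t , j) f′ (P (nbr (t , j) f)) ≡⟨ count-walks m t j f f′ ⟩
      F m t f f′ ∎
      where open ≡-Reasoning

    -- With the sides exchanged and a spoke sent to a rim edge, the three paths of length two
    -- centred at the vertex go to the three centred at its image. This links all four kinds of
    -- paths in a chain.
    constant-if-crossed : ∀ m s {i j d f} → α (P (s , i)) ≡ P (flip s , j) → Rim d → Rim f →
               α (P (nbr (s , i) d)) ≡ P (nbr (flip s , j) spk) →
               α (P (nbr (s , i) (rev d))) ≡ P (nbr (flip s , j) (rev f)) →
               α (P (nbr (s , i) spk)) ≡ P (nbr (flip s , j) f) → Constant m
    constant-if-crossed m out {d = d} {f} αl rd rf αd αd′ αs =
      trans OO≡SI (sym OS≡SI) , OO≡SI , trans OO≡SI (trans (sym OS≡SI) OS≡II)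
      where
      OO≡SI : F m out bwd fwd ≡ F m inn spk fwd
      OO≡SI = trans (sym (F-along m out rd))
        (trans (F-image m d (rev d) spk (rev f) αl αd αd′) (F-enter m inn (rim-rev rf)))
      OS≡SI : F m out bwd spk ≡ F m inn spk fwd
      OS≡SI = trans (sym (F-leave m out rd)) (trans (F-image m d spk spk f αl αd αs) (F-enter m inn rf))
      OS≡II : F m out bwd spk ≡ F m inn bwd fwd
      OS≡II = trans (sym (F-leave m out (rim-rev rd)))
        (trans (F-image m (rev d) spk (rev f) f αl αd′ αs) (F-along⁻ m inn rf))
    constant-if-crossed m inn {d = d} {f} αl rd rf αd αd′ αs =
      trans (sym SI≡OO) SI≡OS , sym SI≡OO , trans (sym SI≡OO) (trans SI≡OS (sym II≡OS))
      where
      SI≡OS : F m inn spk fwd ≡ F m out bwd spk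
      SI≡OS = trans (sym (F-enter m inn rd)) (trans (F-image m spk d f spk αl αs αd) (F-leave m out rf))
      SI≡OO : F m inn spk fwd ≡ F m out bwd fwd
      SI≡OO = trans (sym (F-enter m inn (rim-rev rd)))
        (trans (F-image m spk (rev d) f (rev f) αl αs αd′) (F-along m out rf))
      II≡OS : F m inn bwd fwd ≡ F m out bwd spk
      II≡OS = trans (sym (F-along⁻ m inn rd))
        (trans (F-image m (rev d) d (rev f) spk αl αd′ αd) (F-leave m out (rim-rev rf)))

    module At {l l′} (αl : α (P l) ≡ P l′) where
      π : Dir → Dir
      π d = proj₁ (image d αl)

      α-nbr : ∀ d → α (P (nbr l d)) ≡ P (nbr l′ (π d))
      α-nbr d = proj₂ (image d αl)

      α-nbr-at : ∀ d {f} → π d ≡ f → α (P (nbr l d)) ≡ P (nbr l′ f)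
      α-nbr-at d refl = α-nbr d

      π-inj : ∀ d d′ → π d ≡ π d′ → d ≡ d′
      π-inj d d′ eq = nbr-inj L l d d′ (α-inj (trans (α-nbr d) (trans (cong (P ∘ nbr l′) eq) (sym (α-nbr d′)))))

    crossing : ∀ m → ¬ Constant m → ∀ s {i j f} → α (P (s , i)) ≡ P (flip s , j) →
               Rim f → α (P (flip s , i)) ≢ P (nbr (flip s , j) f)
    crossing m varied s {i} {j} {f} αl rf αs =
      let d , rd , πd , πd′ = exchanged π π-inj (subst Rim (sym πs) rf)
      in varied (constant-if-crossed m s αl rd rf (α-nbr-at d πd)
                  (α-nbr-at (rev d) (trans πd′ (cong rev πs))) αs)
      where
      open At {s , i} {flip s , j} αl
      πs : π spk ≡ f
      πs = nbr-inj L (flip s , j) (π spk) f (trans (sym (α-nbr spk)) αs)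

    private
      -- The other end of the spoke lands on the rim of `s`, hence changes sides, and its own spoke
      -- leads back along that rim edge. So `crossing` applies at that end.
      same-side : ∀ m → ¬ Constant m → ∀ s {i j f} → Rim f → α (P (s , i)) ≡ P (s , j) →
                  α (P (flip s , i)) ≢ P (nbr (s , j) f)
      same-side m varied s {i} {j} {f} rf αl αs = back (rim? (π spk))
        where
        rim-side : ∀ {f} → Rim f → nbr (s , j) f ≡ (s , proj₂ (nbr (s , j) f))
        rim-side fwd = refl
        rim-side bwd = refl
        α-end : α (P (flip s , i)) ≡ P (flip (flip s) , proj₂ (nbr (s , j) f))
        α-end = trans αs (cong P (trans (rim-side rf) (cong (_, proj₂ (nbr (s , j) f)) (sym (flip² s)))))
        open At {flip s , i} {flip (flip s) , proj₂ (nbr (s , j) f)} α-end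
        α-start : α (P (flip (flip s) , i)) ≡ P (s , j)
        α-start = trans (cong (λ t → α (P (t , i))) (flip² s)) αl
        back : π spk ≡ spk ⊎ Rim (π spk) → ⊥
        back (inj₁ πs) = sides-disjoint L
          (trans (sym α-start) (trans (α-nbr-at spk πs) (cong (λ t → P (flip t , proj₂ (nbr (s , j) f))) (flip² s))))
        back (inj₂ r) = crossing m varied (flip s) α-end r (α-nbr spk)

      -- A spoke sent to a rim edge has an end that changes sides.
      spoke-not-rim : ∀ m → ¬ Constant m → ∀ s t {i j f} → Rim f →
                      α (P (s , i)) ≡ P (t , j) → α (P (flip s , i)) ≢ P (nbr (t , j) f)
      spoke-not-rim m varied out out = same-side m varied out
      spoke-not-rim m varied inn inn = same-side m varied inn
      spoke-not-rim m varied out inn rf αl = crossing m varied out αl rf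
      spoke-not-rim m varied inn out rf αl = crossing m varied inn αl rf

    spokes-preserved : ∀ m → ¬ Constant m → ∀ s i {t j} → α (P (s , i)) ≡ P (t , j) →
                       α (P (flip s , i)) ≡ P (flip t , j)
    spokes-preserved m varied s i {t} {j} αl with image {s , i} {t , j} spk αl
    ... | spk , αs = αs
    ... | fwd , αs = ⊥-elim (spoke-not-rim m varied s t fwd αl αs)
    ... | bwd , αs = ⊥-elim (spoke-not-rim m varied s t bwd αl αs)

-- Left multiplication by the unit as a rotation

record Rotational {n k : ℕ} (R : UnitRep n k) : Set where
  open UnitRep R
  open Petersen n k
  field
    s   : Side
    K   : ℤ
    K≡  : K ≡ κ s ⊎ K ≡ -ᶻ κ s
    e≡  : e ≡ P (s , + 0)
    b≡  : b ≡ P (flip s , + 0)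
    rot : ∀ t i → a ∙ P (t , i) ≡ P (t , i +ᶻ K)

module _ {n k : ℕ} (R : UnitRep n k) where
  open Petersen n k
  open UnitRep R

  with-labelling : Labelling (CayAdj _∙_ a b) → UnitRep n k
  with-labelling L = record
    { isMonoid = isMonoid ; generated = generated ; za≡e = za≡e ; az≡e = az≡e
    ; z≢a = z≢a ; z≢b = z≢b ; a≢b = a≢b ; lab = L }

  centred : ∃ λ s → Σ (UnitRep n k) λ R₀ → UnitRep.e R₀ ≡ UnitRep.P R₀ (s , + 0)
  centred with cover e
  ... | (s , i) , e≡ = s , with-labelling (translate i lab) , trans e≡ (cong (λ j → P (s , j)) (sym (ℤ.+-identityˡ i)))

module Core {n k : ℕ} (0<k : 0 < k) (2k<n : 2 * k < n) (R : UnitRep n k) where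
  open UnitRep R
  open Congruence n
  open Petersen n k
  open Distances n k 0<k 2k<n

  instance
    nonZero : NonZero n
    nonZero = n≢0

  Adj : M → M → Set
  Adj = CayAdj _∙_ a b

  _≟_ : DecidableEquality M
  _≟_ = _≟ᴹ_ lab

  z∙a∙ : ∀ x → z ∙ (a ∙ x) ≡ x
  z∙a∙ x = trans (sym (assoc z a x)) (trans (cong (_∙ x) za≡e) (e∙ x))

  ∙a∙z : ∀ x → (x ∙ a) ∙ z ≡ x
  ∙a∙z x = trans (assoc x a z) (trans (cong (x ∙_) az≡e) (∙e x))

  ∙z∙a : ∀ x → (x ∙ z) ∙ a ≡ x
  ∙z∙a x = trans (assoc x z a) (trans (cong (x ∙_) za≡e) (∙e x))

  cancelˡ : ∀ {x y} → a ∙ x ≡ a ∙ y → x ≡ y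
  cancelˡ eq = trans (sym (z∙a∙ _)) (trans (cong (z ∙_) eq) (z∙a∙ _))

  cancelʳ : ∀ {x y} → x ∙ a ≡ y ∙ a → x ≡ y
  cancelʳ eq = trans (sym (∙a∙z _)) (trans (cong (_∙ z) eq) (∙a∙z _))

  aa≢e : a ∙ a ≢ e
  aa≢e eq = z≢a (trans (sym (∙e z)) (trans (cong (z ∙_) (sym eq)) (z∙a∙ a)))

  a≢e : a ≢ e
  a≢e eq = aa≢e (trans (cong (a ∙_) eq) (trans (∙e a) eq))

  z≢e : z ≢ e
  z≢e eq = a≢e (trans (sym (e∙ a)) (trans (cong (_∙ a) (sym eq)) za≡e))

  a∙-adj : ∀ {x y} → Adj x y → Adj (a ∙ x) (a ∙ y)
  a∙-adj (x≢y , c , c∈C , inj₁ eq) = x≢y ∘ cancelˡ , c , c∈C , inj₁ (trans (cong (a ∙_) eq) (sym (assoc a _ c)))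
  a∙-adj (x≢y , c , c∈C , inj₂ eq) = x≢y ∘ cancelˡ , c , c∈C , inj₂ (trans (cong (a ∙_) eq) (sym (assoc a _ c)))

  move : ∀ l {c} → InC a b c → P l ∙ c ≡ P l ⊎ ∃ λ d → P l ∙ c ≡ P (nbr l d)
  move l {c} c∈C with (P l ∙ c) ≟ P l
  ... | yes eq = inj₁ eq
  ... | no ≢ = inj₂ (adj⇒ (≢ ∘ sym , c , c∈C , inj₁ refl))

  arc : ∀ l d → ∃ λ c → InC a b c × (P l ∙ c ≡ P (nbr l d) ⊎ P (nbr l d) ∙ c ≡ P l)
  arc l d with adj⇐ l d
  ... | _ , c , c∈C , inj₁ eq = c , c∈C , inj₁ (sym eq)
  ... | _ , c , c∈C , inj₂ eq = c , c∈C , inj₂ (sym eq)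

  open Rigidity 0<k 2k<n lab using (module Automorphism)
  open Automorphism (a ∙_) cancelˡ a∙-adj public

  e-a : Adj e a
  e-a = a≢e ∘ sym , a , inj₁ refl , inj₁ (sym (e∙ a))

  e-z : Adj e z
  e-z = z≢e ∘ sym , a , inj₁ refl , inj₂ (sym za≡e)

  module _ {l} (e≡ : e ≡ P l) where
    nbr-of-e : ∀ {y} → Adj e y → ∃ λ d → y ≡ P (nbr l d)
    nbr-of-e adj = adj⇒ (subst (λ x → Adj x _) e≡ adj)

    -- If `b` were `e`, its arcs would all be loops and the edge at `e` that avoids `a` and `z`
    -- would have no arc. So `b` is a neighbour of `e` different from `a` and `z`, and one place is
    -- left.
    b-nbr : ∀ d → a ≢ P (nbr l d) → z ≢ P (nbr l d) → b ≡ P (nbr l d)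
    b-nbr d a≢y z≢y = third (b ≟ e)
      where
      y : M
      y = P (nbr l d)
      third : Dec (b ≡ e) → b ≡ y
      third (yes b≡e) with adj⇐ l d
      ... | l≢y , _ , inj₁ refl , inj₁ eq = contradiction (sym (trans eq (trans (cong (_∙ a) (sym e≡)) (e∙ a)))) a≢y
      ... | l≢y , _ , inj₂ refl , inj₁ eq = contradiction (sym (trans eq (trans (cong (P l ∙_) b≡e) (∙e (P l))))) l≢y
      ... | l≢y , _ , inj₁ refl , inj₂ eq = contradiction (trans (sym (e∙ z)) (trans (cong (_∙ z) (trans e≡ eq)) (∙a∙z y))) z≢y
      ... | l≢y , _ , inj₂ refl , inj₂ eq = contradiction (trans eq (trans (cong (y ∙_) b≡e) (∙e y))) l≢y
      third (no b≢e) with nbr-of-e (b≢e ∘ sym , b , inj₂ refl , inj₁ (sym (e∙ b))) | nbr-of-e e-a | nbr-of-e e-z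
      ... | db , b≡ | da , a≡ | dz , z≡ = trans b≡ (cong (P ∘ nbr l) (only-one-left da dz d db
        (λ { refl → z≢a (trans z≡ (sym a≡)) }) (λ { refl → a≢y a≡ }) (λ { refl → z≢y z≡ })
        (λ { refl → a≢b (trans a≡ (sym b≡)) }) (λ { refl → z≢b (trans z≡ (sym b≡)) })))
        where
        only-one-left : ∀ da dz d db → da ≢ dz → da ≢ d → dz ≢ d → da ≢ db → dz ≢ db → db ≡ d
        only-one-left fwd fwd _ _ p _ _ _ _ = contradiction refl p
        only-one-left bwd bwd _ _ p _ _ _ _ = contradiction refl p
        only-one-left spk spk _ _ p _ _ _ _ = contradiction refl p
        only-one-left fwd _ fwd _ _ p _ _ _ = contradiction refl p
        only-one-left bwd _ bwd _ _ p _ _ _ = contradiction refl p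
        only-one-left spk _ spk _ _ p _ _ _ = contradiction refl p
        only-one-left _ fwd fwd _ _ _ p _ _ = contradiction refl p
        only-one-left _ bwd bwd _ _ _ p _ _ = contradiction refl p
        only-one-left _ spk spk _ _ _ p _ _ = contradiction refl p
        only-one-left fwd _ _ fwd _ _ _ p _ = contradiction refl p
        only-one-left bwd _ _ bwd _ _ _ p _ = contradiction refl p
        only-one-left spk _ _ spk _ _ _ p _ = contradiction refl p
        only-one-left _ fwd _ fwd _ _ _ _ p = contradiction refl p
        only-one-left _ bwd _ bwd _ _ _ _ p = contradiction refl p
        only-one-left _ spk _ spk _ _ _ _ p = contradiction refl p
        only-one-left _ _ fwd fwd _ _ _ _ _ = refl
        only-one-left _ _ bwd bwd _ _ _ _ _ = refl
        only-one-left _ _ spk spk _ _ _ _ _ = refl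

  module _ (SP : ∀ s i {t j} → a ∙ P (s , i) ≡ P (t , j) → a ∙ P (flip s , i) ≡ P (flip t , j)) where

    Sign : ℤ → Set
    Sign σ = σ ≡ + 1 ⊎ σ ≡ -ᶻ + 1

    -- The image of the next rim vertex cannot go back, by injectivity, and cannot use the spoke,
    -- whose end is already the image of a spoke end.
    line-step : ∀ {σ} → Sign σ → ∀ j q → a ∙ P (out , j) ≡ P (out , q) → a ∙ P (out , j +ᶻ + 1) ≡ P (out , q +ᶻ σ) →
                a ∙ P (out , j +ᶻ + 1 +ᶻ + 1) ≡ P (out , q +ᶻ σ +ᶻ σ)
    line-step {σ} sign j q αj αj′ = by-direction (image {out , j +ᶻ + 1} {out , q +ᶻ σ} fwd αj′) sign
      where
      no-return : ∀ {i} → i ≡ q → a ∙ P (out , j +ᶻ + 1 +ᶻ + 1) ≢ P (out , i)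
      no-return refl αf = 2κ≢0 out (j +ᶻ + 1)
        (proj₂ (P-inj (trans (cancelˡ (trans αf (sym αj))) (P-≡ lab out (lemma j)))))
        where
        lemma : ∀ j → j ≡ j +ᶻ + 1 -ᶻ + 1
        lemma = solve-∀
      plus-minus : ∀ q → q +ᶻ + 1 -ᶻ + 1 ≡ q
      plus-minus = solve-∀
      minus-plus : ∀ q → q -ᶻ + 1 +ᶻ + 1 ≡ q
      minus-plus = solve-∀
      by-direction : (∃ λ f → a ∙ P (out , j +ᶻ + 1 +ᶻ + 1) ≡ P (nbr (out , q +ᶻ σ) f)) → Sign σ →
                     a ∙ P (out , j +ᶻ + 1 +ᶻ + 1) ≡ P (out , q +ᶻ σ +ᶻ σ)
      by-direction (spk , αf) _ = contradiction (cancelˡ (trans αf (sym (SP out (j +ᶻ + 1) αj′)))) (sides-disjoint lab)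
      by-direction (fwd , αf) (inj₁ refl) = αf
      by-direction (bwd , αf) (inj₂ refl) = αf
      by-direction (bwd , αf) (inj₁ refl) = contradiction αf (no-return (plus-minus q))
      by-direction (fwd , αf) (inj₂ refl) = contradiction αf (no-return (minus-plus q))

    module Line {σ} (sign : Sign σ) (i p : ℤ) (αi : a ∙ P (out , i) ≡ P (out , p))
                (αi′ : a ∙ P (out , i +ᶻ + 1) ≡ P (out , p +ᶻ σ)) where

      line-ℕ : ∀ m → a ∙ P (out , i +ᶻ + m) ≡ P (out , p +ᶻ + m *ᶻ σ) ×
                     a ∙ P (out , i +ᶻ + m +ᶻ + 1) ≡ P (out , p +ᶻ + m *ᶻ σ +ᶻ σ)
      line-ℕ zero =
        subst₂ (λ i p → a ∙ P (out , i) ≡ P (out , p)) (sym (ℤ.+-identityʳ i)) (sym (lemma p σ)) αi ,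
        subst₂ (λ i p → a ∙ P (out , i +ᶻ + 1) ≡ P (out , p +ᶻ σ)) (sym (ℤ.+-identityʳ i)) (sym (lemma p σ)) αi′
        where
        lemma : ∀ p σ → p +ᶻ + 0 *ᶻ σ ≡ p
        lemma = solve-∀
      line-ℕ (suc m) with line-ℕ m
      ... | αm , αm′ =
        subst₂ (λ i p → a ∙ P (out , i) ≡ P (out , p)) (next i (+ m)) (next′ p (+ m) σ) αm′ ,
        subst₂ (λ i p → a ∙ P (out , i +ᶻ + 1) ≡ P (out , p +ᶻ σ)) (next i (+ m)) (next′ p (+ m) σ)
          (line-step sign (i +ᶻ + m) (p +ᶻ + m *ᶻ σ) αm αm′)
        where
        next : ∀ i m → i +ᶻ m +ᶻ + 1 ≡ i +ᶻ (+ 1 +ᶻ m)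
        next = solve-∀
        next′ : ∀ p m σ → p +ᶻ m *ᶻ σ +ᶻ σ ≡ p +ᶻ (+ 1 +ᶻ m) *ᶻ σ
        next′ = solve-∀

      line : ∀ j → a ∙ P (out , j) ≡ P (out , p +ᶻ (j -ᶻ i) *ᶻ σ)
      line j = begin
        a ∙ P (out , j) ≡⟨ cong (a ∙_) (P-cong (linear (+ 1) (lemma i j (+ m)) j-i≋m)) ⟩
        a ∙ P (out , i +ᶻ + m) ≡⟨ proj₁ (line-ℕ m) ⟩
        P (out , p +ᶻ + m *ᶻ σ) ≡⟨ P-cong (linear σ (lemma′ i j (+ m) p σ) (≋-sym j-i≋m)) ⟩
        P (out , p +ᶻ (j -ᶻ i) *ᶻ σ) ∎
        where
        open ≡-Reasoning
        m : ℕ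
        m = residue (j -ᶻ i)
        j-i≋m : j -ᶻ i ≋ + m
        j-i≋m = ≋-residue (j -ᶻ i)
        lemma : ∀ i j m → j -ᶻ (i +ᶻ m) ≡ + 1 *ᶻ ((j -ᶻ i) -ᶻ m)
        lemma = solve-∀
        lemma′ : ∀ i j m p σ → (p +ᶻ m *ᶻ σ) -ᶻ (p +ᶻ (j -ᶻ i) *ᶻ σ) ≡ σ *ᶻ (m -ᶻ (j -ᶻ i))
        lemma′ = solve-∀

    rot-from-outer : ∀ i K → a ∙ P (out , i) ≡ P (out , i +ᶻ K) →
                     a ∙ P (out , i +ᶻ + 1) ≡ P (out , i +ᶻ K +ᶻ + 1) →
                     ∀ t j → a ∙ P (t , j) ≡ P (t , j +ᶻ K)
    rot-from-outer i K αi αi′ out j = trans (Line.line (inj₁ refl) i (i +ᶻ K) αi αi′ j) (P-≡ lab out (lemma i j K))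
      where
      lemma : ∀ i j K → (i +ᶻ K) +ᶻ (j -ᶻ i) *ᶻ + 1 ≡ j +ᶻ K
      lemma = solve-∀
    rot-from-outer i K αi αi′ inn j = SP out j (rot-from-outer i K αi αi′ out j)

    -- For `s = out` the images of two consecutive outer vertices are known. For `s = inn` only the
    -- image of one spoke is, and the sense in which the outer rim is traversed has to be decided.
    rot-about : ∀ s {K} → K ≡ κ s ⊎ K ≡ -ᶻ κ s → e ≡ P (s , + 0) → a ≡ P (s , K) → z ≡ P (s , -ᶻ K) →
                ∀ t j → a ∙ P (t , j) ≡ P (t , j +ᶻ K)
    rot-about out (inj₁ refl) e≡ a≡ z≡ = rot-from-outer (-ᶻ + 1) (+ 1)
      (trans (cong (a ∙_) (sym z≡)) (trans az≡e e≡)) (trans (cong (a ∙_) (sym e≡)) (trans (∙e a) a≡))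
    rot-about out (inj₂ refl) e≡ a≡ z≡ = rot-from-outer (+ 0) (-ᶻ + 1)
      (trans (cong (a ∙_) (sym e≡)) (trans (∙e a) a≡)) (trans (cong (a ∙_) (sym z≡)) (trans az≡e e≡))
    rot-about inn {K} _ e≡ a≡ z≡ = result (image {out , + 0} {out , K} fwd αu₀)
      where
      αv₀ : a ∙ P (inn , + 0) ≡ P (inn , K)
      αv₀ = trans (cong (a ∙_) (sym e≡)) (trans (∙e a) a≡)
      αu₀ : a ∙ P (out , + 0) ≡ P (out , K)
      αu₀ = SP inn (+ 0) αv₀
      reflected : ∀ K → K +ᶻ (K -ᶻ + 0) *ᶻ (-ᶻ + 1) ≡ + 0
      reflected = solve-∀
      result : (∃ λ f → a ∙ P (out , + 0 +ᶻ + 1) ≡ P (nbr (out , K) f)) → ∀ t j → a ∙ P (t , j) ≡ P (t , j +ᶻ K)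
      result (fwd , αf) = rot-from-outer (+ 0) K (trans αu₀ (P-≡ lab out (sym (ℤ.+-identityˡ K))))
        (trans αf (P-≡ lab out (cong (_+ᶻ + 1) (sym (ℤ.+-identityˡ K)))))
      result (spk , αf) = contradiction (sym (cancelˡ (trans αf (sym αv₀)))) (sides-disjoint lab)
      -- Were the outer rim reflected, a would be an involution.
      result (bwd , αf) = contradiction
        (trans (cong (a ∙_) a≡) (trans (SP out K (trans (Line.line (inj₂ refl) (+ 0) K αu₀ αf K)
          (P-≡ lab out (reflected K)))) (sym e≡)))
        aa≢e

    -- Were `a` the other end of the spoke at `e`, preserving spokes would make left multiplication
    -- by `a` swap the two ends, so `a ∙ a ≡ e`. Were `z` that end, `a` and `z` would coincide.
    rotational : ∀ s → e ≡ P (s , + 0) → Rotational R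
    rotational s e≡ = by-directions (nbr-of-e e≡ e-a) (nbr-of-e e≡ e-z)
      where
      e≡′ : e ≡ P (flip (flip s) , + 0)
      e≡′ = trans e≡ (cong (λ t → P (t , + 0)) (sym (flip² s)))
      a-not-spoke : a ≢ P (flip s , + 0)
      a-not-spoke a≡ = aa≢e (trans (cong (a ∙_) a≡)
        (trans (SP s (+ 0) (trans (cong (a ∙_) (sym e≡)) (trans (∙e a) a≡))) (sym e≡′)))
      z-not-spoke : z ≢ P (flip s , + 0)
      z-not-spoke z≡ = z≢a (trans z≡ (trans (sym (SP (flip s) (+ 0) (trans (cong (a ∙_) (sym z≡)) (trans az≡e e≡))))
        (trans (cong (a ∙_) (sym e≡′)) (∙e a))))
      by-directions : (∃ λ d → a ≡ P (nbr (s , + 0) d)) → (∃ λ d → z ≡ P (nbr (s , + 0) d)) → Rotational R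
      by-directions (spk , a≡) _ = contradiction a≡ a-not-spoke
      by-directions _ (spk , z≡) = contradiction z≡ z-not-spoke
      by-directions (fwd , a≡) (fwd , z≡) = contradiction (trans z≡ (sym a≡)) z≢a
      by-directions (bwd , a≡) (bwd , z≡) = contradiction (trans z≡ (sym a≡)) z≢a
      by-directions (fwd , a≡) (bwd , z≡) = record
        { s = s ; K = κ s ; K≡ = inj₁ refl ; e≡ = e≡ ; b≡ = b-nbr e≡ spk a-not-spoke z-not-spoke
        ; rot = rot-about s (inj₁ refl) e≡ (trans a≡ (P-≡ lab s (ℤ.+-identityˡ _))) (trans z≡ (P-≡ lab s (ℤ.+-identityˡ _))) }
      by-directions (bwd , a≡) (fwd , z≡) = record
        { s = s ; K = -ᶻ κ s ; K≡ = inj₂ refl ; e≡ = e≡ ; b≡ = b-nbr e≡ spk a-not-spoke z-not-spoke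
        ; rot = rot-about s (inj₂ refl) e≡ (trans a≡ (P-≡ lab s (ℤ.+-identityˡ _)))
            (trans z≡ (P-≡ lab s (trans (ℤ.+-identityˡ _) (sym (ℤ.neg-involutive _))))) }

-- Powers of the unit that meet all spokes

module Rotation {n k : ℕ} (0<k : 0 < k) (2k<n : 2 * k < n) (R : UnitRep n k) (rotation : Rotational R) where
  open UnitRep R
  open Congruence n
  open Petersen n k
  open Distances n k 0<k 2k<n
  open Core 0<k 2k<n R
  open Rotational rotation

  -- A l is a^l.
  abstract
    A : ℤ → M
    A l = P (s , l *ᶻ K)

    A-P : ∀ l → A l ≡ P (s , l *ᶻ K)
    A-P l = refl

  A-cong : ∀ {l m} → l ≋ m → A l ≡ A m
  A-cong l≋m = trans (A-P _) (trans (P-cong (*-congʳ-≋ K l≋m)) (sym (A-P _)))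

  A-0 : A (+ 0) ≡ e
  A-0 = trans (A-P (+ 0)) (sym e≡)

  A-act : ∀ l t i → A l ∙ P (t , i) ≡ P (t , i +ᶻ l *ᶻ K)
  A-act l t i = begin
    A l ∙ P (t , i) ≡⟨ cong (_∙ P (t , i)) (A-cong (≋-residue l)) ⟩
    A (+ residue l) ∙ P (t , i) ≡⟨ act (residue l) ⟩
    P (t , i +ᶻ + residue l *ᶻ K) ≡⟨ P-cong (linear K (lemma i l (+ residue l) K) (≋-sym (≋-residue l))) ⟩
    P (t , i +ᶻ l *ᶻ K) ∎
    where
    open ≡-Reasoning
    lemma : ∀ i l m K → (i +ᶻ m *ᶻ K) -ᶻ (i +ᶻ l *ᶻ K) ≡ K *ᶻ (m -ᶻ l)
    lemma = solve-∀
    act : ∀ m → A (+ m) ∙ P (t , i) ≡ P (t , i +ᶻ + m *ᶻ K)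
    act zero = trans (cong (_∙ P (t , i)) A-0) (trans (e∙ _) (P-≡ lab t (sym (ℤ.+-identityʳ i))))
    act (suc m) = begin
      A (+ suc m) ∙ P (t , i) ≡⟨ cong (_∙ P (t , i)) A-suc ⟩
      (a ∙ A (+ m)) ∙ P (t , i) ≡⟨ trans (assoc a _ _) (cong (a ∙_) (act m)) ⟩
      a ∙ P (t , i +ᶻ + m *ᶻ K) ≡⟨ trans (rot t _) (P-≡ lab t (next′ i (+ m) K)) ⟩
      P (t , i +ᶻ + suc m *ᶻ K) ∎
      where
      next : ∀ m K → (+ 1 +ᶻ m) *ᶻ K ≡ m *ᶻ K +ᶻ K
      next = solve-∀
      A-suc : A (+ suc m) ≡ a ∙ A (+ m)
      A-suc = trans (A-P _) (trans (P-≡ lab s (next (+ m) K)) (trans (sym (rot s (+ m *ᶻ K))) (cong (a ∙_) (sym (A-P _)))))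
      next′ : ∀ i m K → i +ᶻ m *ᶻ K +ᶻ K ≡ i +ᶻ (+ 1 +ᶻ m) *ᶻ K
      next′ = solve-∀

  a≡ : a ≡ P (s , K)
  a≡ = trans (sym (∙e a)) (trans (cong (a ∙_) e≡) (trans (rot s (+ 0)) (P-≡ lab s (ℤ.+-identityˡ K))))

  A-1 : A (+ 1) ≡ a
  A-1 = trans (A-P (+ 1)) (trans (P-≡ lab s (ℤ.*-identityˡ K)) (sym a≡))

  A-∙ : ∀ l m → A l ∙ A m ≡ A (l +ᶻ m)
  A-∙ l m = trans (cong (A l ∙_) (A-P m)) (trans (A-act l s _) (trans (P-≡ lab s (lemma l m K)) (sym (A-P _))))
    where
    lemma : ∀ l m K → m *ᶻ K +ᶻ l *ᶻ K ≡ (l +ᶻ m) *ᶻ K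
    lemma = solve-∀

  A-b : ∀ l → A l ∙ b ≡ P (flip s , l *ᶻ K)
  A-b l = trans (cong (A l ∙_) b≡) (trans (A-act l (flip s) (+ 0)) (P-≡ lab (flip s) (ℤ.+-identityˡ _)))

  ba≢e : b ∙ a ≢ e
  ba≢e eq = z≢b (sym (cancelʳ (trans eq (sym za≡e))))

  -- With y inverse to K, b a = a^l b forces l² = 1 or l² = l, where l K is a step of the rim of b or 0.
  module Coprime (y : ℤ) (yK≋1 : y *ᶻ K ≋ + 1) where

    -- The exponent for which a^x advances by one step on the rim of `b`.
    x : ℤ
    x = y *ᶻ κ (flip s)

    cancel-K : ∀ l m → l *ᶻ K ≋ m *ᶻ K → l ≋ m
    cancel-K l m eq = linear₂ y (m -ᶻ l) (lemma l m y K) eq yK≋1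
      where
      lemma : ∀ l m y K → l -ᶻ m ≡ y *ᶻ (l *ᶻ K -ᶻ m *ᶻ K) +ᶻ (m -ᶻ l) *ᶻ (y *ᶻ K -ᶻ + 1)
      lemma = solve-∀

    A-inj : ∀ {l m} → A l ≡ A m → l ≋ m
    A-inj {l} {m} eq = cancel-K l m (proj₂ (P-inj (trans (sym (A-P l)) (trans eq (A-P m)))))

    A-x : ∀ σ → P (flip s , + 0 +ᶻ σ *ᶻ κ (flip s)) ≡ A (σ *ᶻ x) ∙ b
    A-x σ = trans (P-cong (linear (-ᶻ (σ *ᶻ κ (flip s))) (lemma σ y K (κ (flip s))) yK≋1)) (sym (A-b (σ *ᶻ x)))
      where
      lemma : ∀ σ y K κ → (+ 0 +ᶻ σ *ᶻ κ) -ᶻ (σ *ᶻ (y *ᶻ κ)) *ᶻ K ≡ -ᶻ (σ *ᶻ κ) *ᶻ (y *ᶻ K -ᶻ + 1)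
      lemma = solve-∀

    Unit : ℤ → Set
    Unit σ = σ ≡ + 0 ⊎ (σ ≡ + 1 ⊎ σ ≡ -ᶻ + 1)

    around-b : ∀ {c} → InC a b c → b ∙ c ≡ e ⊎ ∃ λ σ → Unit σ × b ∙ c ≡ A (σ *ᶻ x) ∙ b
    around-b {c} c∈C with move (flip s , + 0) c∈C
    ... | inj₁ eq = inj₂ (+ 0 , inj₁ refl ,
      trans (cong (_∙ c) b≡) (trans eq (trans (sym b≡) (trans (sym (e∙ b)) (cong (_∙ b) (sym A-0))))))
    ... | inj₂ (fwd , eq) = inj₂ (+ 1 , inj₂ (inj₁ refl) ,
      trans (cong (_∙ c) b≡) (trans eq (trans (P-≡ lab (flip s) (lemma (κ (flip s)))) (A-x (+ 1)))))
      where
      lemma : ∀ κ → + 0 +ᶻ κ ≡ + 0 +ᶻ + 1 *ᶻ κ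
      lemma = solve-∀
    ... | inj₂ (bwd , eq) = inj₂ (-ᶻ + 1 , inj₂ (inj₂ refl) ,
      trans (cong (_∙ c) b≡) (trans eq (trans (P-≡ lab (flip s) (lemma (κ (flip s)))) (A-x (-ᶻ + 1)))))
      where
      lemma : ∀ κ → + 0 -ᶻ κ ≡ + 0 +ᶻ (-ᶻ + 1) *ᶻ κ
      lemma = solve-∀
    ... | inj₂ (spk , eq) = inj₁
      (trans (cong (_∙ c) b≡) (trans eq (trans (cong (λ t → P (t , + 0)) (flip² s)) (sym e≡))))

    ba : ∃ λ σ → Unit σ × b ∙ a ≡ A (σ *ᶻ x) ∙ b
    ba with around-b (inj₁ refl)
    ... | inj₁ eq = contradiction eq ba≢e
    ... | inj₂ result = result

    module _ (l : ℤ) (ba≡ : b ∙ a ≡ A l ∙ b) where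
      b-A : ∀ m → b ∙ A m ≡ A (l *ᶻ m) ∙ b
      b-A m = trans (cong (b ∙_) (A-cong (≋-residue m))) (trans (powers (residue m))
        (cong (_∙ b) (A-cong {l *ᶻ + residue m} {l *ᶻ m} (linear l (lemma l m (+ residue m)) (≋-sym (≋-residue m))))))
        where
        lemma : ∀ l m r → l *ᶻ r -ᶻ l *ᶻ m ≡ l *ᶻ (r -ᶻ m)
        lemma = solve-∀
        powers : ∀ m → b ∙ A (+ m) ≡ A (l *ᶻ + m) ∙ b
        powers zero = trans (cong (b ∙_) A-0) (trans (∙e b) (trans (sym (e∙ b))
          (cong (_∙ b) (trans (sym A-0) (A-cong (≡⇒≋ (sym (ℤ.*-zeroʳ l))))))))
        powers (suc m) = begin
          b ∙ A (+ suc m) ≡⟨ cong (b ∙_) (trans (A-cong (≡⇒≋ (next (+ m)))) (sym (A-∙ (+ m) (+ 1)))) ⟩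
          b ∙ (A (+ m) ∙ A (+ 1)) ≡⟨ sym (assoc b _ _) ⟩
          (b ∙ A (+ m)) ∙ A (+ 1) ≡⟨ cong₂ _∙_ (powers m) A-1 ⟩
          (A (l *ᶻ + m) ∙ b) ∙ a ≡⟨ trans (assoc _ b a) (cong (A (l *ᶻ + m) ∙_) ba≡) ⟩
          A (l *ᶻ + m) ∙ (A l ∙ b) ≡⟨ sym (assoc _ _ b) ⟩
          (A (l *ᶻ + m) ∙ A l) ∙ b ≡⟨ cong (_∙ b) (trans (A-∙ (l *ᶻ + m) l) (A-cong (≡⇒≋ (next′ l (+ m))))) ⟩
          A (l *ᶻ + suc m) ∙ b ∎
          where
          open ≡-Reasoning
          next : ∀ m → + 1 +ᶻ m ≡ m +ᶻ + 1
          next = solve-∀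
          next′ : ∀ l m → l *ᶻ m +ᶻ l ≡ l *ᶻ (+ 1 +ᶻ m)
          next′ = solve-∀

      -- Moving `a` past `b` multiplies its exponent by `l`, and here it passes twice. The cases
      -- below compare this with `b ∙ b` being `e`, past which the exponent stays 1, or a^j b, past
      -- which it becomes `l`.
      bb-a : (b ∙ b) ∙ a ≡ A (l *ᶻ l) ∙ (b ∙ b)
      bb-a = trans (assoc b b a) (trans (cong (b ∙_) ba≡) (trans (sym (assoc b _ b))
        (trans (cong (_∙ b) (b-A l)) (assoc _ b b))))

      group-case : b ∙ b ≡ e → l *ᶻ l ≋ + 1
      group-case bb≡e = A-inj (begin
        A (l *ᶻ l) ≡⟨ sym (∙e _) ⟩
        A (l *ᶻ l) ∙ e ≡⟨ cong (A (l *ᶻ l) ∙_) (sym bb≡e) ⟩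
        A (l *ᶻ l) ∙ (b ∙ b) ≡⟨ sym bb-a ⟩
        (b ∙ b) ∙ a ≡⟨ trans (cong (_∙ a) bb≡e) (e∙ a) ⟩
        a ≡⟨ sym A-1 ⟩
        A (+ 1) ∎)
        where open ≡-Reasoning

      A-b-inj : ∀ {l m} → A l ∙ b ≡ A m ∙ b → l ≋ m
      A-b-inj {l} {m} eq = cancel-K l m (proj₂ (P-inj (trans (sym (A-b _)) (trans eq (A-b _)))))

      A-A-b : ∀ l m → A l ∙ (A m ∙ b) ≡ A (l +ᶻ m) ∙ b
      A-A-b l m = trans (sym (assoc _ _ b)) (cong (_∙ b) (A-∙ l m))

      idempotent-case : ∀ j → b ∙ b ≡ A j ∙ b → l *ᶻ l ≋ l
      idempotent-case j bb≡ = linear (+ 1) (lemma (l *ᶻ l) l j) (A-b-inj (begin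
        A (l *ᶻ l +ᶻ j) ∙ b ≡⟨ sym (A-A-b (l *ᶻ l) j) ⟩
        A (l *ᶻ l) ∙ (A j ∙ b) ≡⟨ cong (A (l *ᶻ l) ∙_) (sym bb≡) ⟩
        A (l *ᶻ l) ∙ (b ∙ b) ≡⟨ sym bb-a ⟩
        (b ∙ b) ∙ a ≡⟨ cong (_∙ a) bb≡ ⟩
        (A j ∙ b) ∙ a ≡⟨ trans (assoc _ b a) (cong (A j ∙_) ba≡) ⟩
        A j ∙ (A l ∙ b) ≡⟨ A-A-b j l ⟩
        A (j +ᶻ l) ∙ b ∎))
        where
        open ≡-Reasoning
        lemma : ∀ q l j → q -ᶻ l ≡ + 1 *ᶻ ((q +ᶻ j) -ᶻ (j +ᶻ l))
        lemma = solve-∀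

      -- Here a and b would both fix b, leaving the rim of b without arcs.
      no-degenerate-case : l ≡ + 0 → ∀ j → b ∙ b ≢ A j ∙ b
      no-degenerate-case refl j bb≡ = uncovered (arc (flip s , + 0) fwd)
        where
        open ≡-Reasoning
        ba≡b : b ∙ a ≡ b
        ba≡b = trans ba≡ (trans (cong (_∙ b) A-0) (e∙ b))
        lemma : ∀ j → (j -ᶻ + 0) ≡ + 1 *ᶻ ((j +ᶻ j) -ᶻ j)
        lemma = solve-∀
        j≋0 : j ≋ + 0
        j≋0 = linear (+ 1) (lemma j) (A-b-inj (begin
          A (j +ᶻ j) ∙ b ≡⟨ sym (A-A-b j j) ⟩
          A j ∙ (A j ∙ b) ≡⟨ cong (A j ∙_) (sym bb≡) ⟩
          A j ∙ (b ∙ b) ≡⟨ sym (assoc _ b b) ⟩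
          (A j ∙ b) ∙ b ≡⟨ cong (_∙ b) (sym bb≡) ⟩
          (b ∙ b) ∙ b ≡⟨ trans (assoc b b b) (cong (b ∙_) bb≡) ⟩
          b ∙ (A j ∙ b) ≡⟨ trans (sym (assoc b _ b)) (cong (_∙ b) (b-A j)) ⟩
          (A (+ 0 *ᶻ j) ∙ b) ∙ b ≡⟨ cong (λ y → (y ∙ b) ∙ b) A-0 ⟩
          (e ∙ b) ∙ b ≡⟨ cong (_∙ b) (e∙ b) ⟩
          b ∙ b ≡⟨ bb≡ ⟩
          A j ∙ b ∎))
        bb≡b : b ∙ b ≡ b
        bb≡b = trans bb≡ (trans (cong (_∙ b) (trans (A-cong j≋0) A-0)) (e∙ b))
        bc≡b : ∀ {c} → InC a b c → b ∙ c ≡ b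
        bc≡b (inj₁ refl) = ba≡b
        bc≡b (inj₂ refl) = bb≡b
        next : P (flip s , + 0 +ᶻ κ (flip s)) ≡ A (+ 1 *ᶻ x) ∙ b
        next = trans (P-≡ lab (flip s) (cong (+ 0 +ᶻ_) (sym (ℤ.*-identityˡ (κ (flip s)))))) (A-x (+ 1))
        rim : P (flip s , + 0 +ᶻ κ (flip s)) ≢ P (flip s , + 0)
        rim eq = κ≢0 (flip s) (+ 0) (proj₂ (P-inj eq))
        uncovered : (∃ λ c → InC a b c × (P (flip s , + 0) ∙ c ≡ P (flip s , + 0 +ᶻ κ (flip s)) ⊎
                                          P (flip s , + 0 +ᶻ κ (flip s)) ∙ c ≡ P (flip s , + 0))) → ⊥
        uncovered (c , c∈C , inj₁ eq) = rim (trans (sym eq) (trans (cong (_∙ c) (sym b≡)) (trans (bc≡b c∈C) b≡)))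
        uncovered (c , c∈C , inj₂ eq) = rim (trans next (trans (cong (A (+ 1 *ᶻ x) ∙_) (sym (bc≡b c∈C)))
          (trans (sym (assoc _ b c)) (trans (cong (_∙ c) (sym next)) eq))))

    square : x *ᶻ x ≋ + 1 ⊎ (x *ᶻ x ≋ x ⊎ x *ᶻ x ≋ -ᶻ x)
    square with ba | around-b (inj₂ refl)
    ... | _ , inj₂ (inj₁ refl) , ba≡ | inj₁ bb≡e = inj₁ (linear (+ 1) (lemma x) (group-case _ ba≡ bb≡e))
      where
      lemma : ∀ x → x *ᶻ x -ᶻ + 1 ≡ + 1 *ᶻ ((+ 1 *ᶻ x) *ᶻ (+ 1 *ᶻ x) -ᶻ + 1)
      lemma = solve-∀
    ... | _ , inj₂ (inj₂ refl) , ba≡ | inj₁ bb≡e = inj₁ (linear (+ 1) (lemma x) (group-case _ ba≡ bb≡e))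
      where
      lemma : ∀ x → x *ᶻ x -ᶻ + 1 ≡ + 1 *ᶻ ((-ᶻ + 1 *ᶻ x) *ᶻ (-ᶻ + 1 *ᶻ x) -ᶻ + 1)
      lemma = solve-∀
    ... | _ , inj₁ refl , ba≡ | inj₁ bb≡e = contradiction (≋-sym (group-case _ ba≡ bb≡e))
      (distinct 1 refl (s≤s z≤n) (ℕ.<-trans (s≤s (s≤s z≤n)) 2<n))
    ... | _ , inj₁ refl , ba≡ | inj₂ (_ , _ , bb≡) = contradiction bb≡ (no-degenerate-case _ ba≡ refl _)
    ... | _ , inj₂ (inj₁ refl) , ba≡ | inj₂ (_ , _ , bb≡) = inj₂ (inj₁ (linear (+ 1) (lemma x) (idempotent-case _ ba≡ _ bb≡)))
      where
      lemma : ∀ x → x *ᶻ x -ᶻ x ≡ + 1 *ᶻ ((+ 1 *ᶻ x) *ᶻ (+ 1 *ᶻ x) -ᶻ + 1 *ᶻ x)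
      lemma = solve-∀
    ... | _ , inj₂ (inj₂ refl) , ba≡ | inj₂ (_ , _ , bb≡) = inj₂ (inj₂ (linear (+ 1) (lemma x) (idempotent-case _ ba≡ _ bb≡)))
      where
      lemma : ∀ x → x *ᶻ x -ᶻ (-ᶻ x) ≡ + 1 *ᶻ ((-ᶻ + 1 *ᶻ x) *ᶻ (-ᶻ + 1 *ᶻ x) -ᶻ (-ᶻ + 1 *ᶻ x))
      lemma = solve-∀

-- Several inner rims

-- If the powers of a form an inner rim, then the inner rims are a single cycle.
module NonCoprime {n k : ℕ} (0<k : 0 < k) (2k<n : 2 * k < n) (g : ℕ) (2≤g : 2 ≤ g) (g∣n : g ∣ℕ n) (g∣k : g ∣ℕ k)
                  (bezout : ∃ λ y → Congruence._≋_ n (y *ᶻ + k) (+ g)) where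
  open Congruence n
  open Petersen n k
  open Distances n k 0<k 2k<n
  module G = Congruence g

  instance
    nonZero : NonZero n
    nonZero = n≢0

  g<n : g < n
  g<n = ℕ.≤-<-trans (ℕᵈ.∣⇒≤ {{ℕ.>-nonZero 0<k}} g∣k) (step<n inn)

  ≋⇒G : ∀ {i j} → i ≋ j → i G.≋ j
  ≋⇒G {i} {j} i≋j = G.∣⇒≋ {i} {j} (ℕᵈ.∣-trans g∣n (≋⇒∣ i≋j))

  1≢0ᴳ : ¬ + 1 G.≋ + 0
  1≢0ᴳ = G.distinct 1 refl (s≤s z≤n) 2≤g

  k≋0ᴳ : + k G.≋ + 0
  k≋0ᴳ = G.∣⇒≋ {+ k} {+ 0} (subst (g ∣ℕ_) (sym (ℕ.+-identityʳ k)) g∣k)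

  K≋0ᴳ : ∀ {K} → K ≡ + k ⊎ K ≡ -ᶻ + k → K G.≋ + 0
  K≋0ᴳ (inj₁ refl) = k≋0ᴳ
  K≋0ᴳ (inj₂ refl) = G.neg-cong-≋ k≋0ᴳ

  multiple : ∀ {K} → K ≡ + k ⊎ K ≡ -ᶻ + k → ∃ λ y → y *ᶻ K ≋ + g
  multiple (inj₁ refl) = bezout
  multiple (inj₂ refl) = -ᶻ proj₁ bezout , linear (+ 1) (lemma (proj₁ bezout) (+ k) (+ g)) (proj₂ bezout)
    where
    lemma : ∀ y k g → -ᶻ y *ᶻ -ᶻ k -ᶻ g ≡ + 1 *ᶻ (y *ᶻ k -ᶻ g)
    lemma = solve-∀

  -- Modulo `n` the multiples of `K` are the multiples of `g`. So residues modulo `g` label the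
  -- inner rims, and a power of `a` translates between any two indices with the same residue.
  shifts : ∀ {K} → K ≡ + k ⊎ K ≡ -ᶻ + k → ∀ {i j} → i G.≋ j → ∃ λ m → j ≋ i +ᶻ m *ᶻ K
  shifts {K} K≡ {i} {j} (G.mod (divides q eq)) with multiple K≡
  ... | y , yK≋g = -ᶻ q *ᶻ y , linear q (trans (lemma i j q y K)
    (trans (cong (λ d → q *ᶻ (y *ᶻ K) -ᶻ d) eq) (lemma′ q (y *ᶻ K) (+ g)))) yK≋g
    where
    lemma : ∀ i j q y K → j -ᶻ (i +ᶻ -ᶻ q *ᶻ y *ᶻ K) ≡ q *ᶻ (y *ᶻ K) -ᶻ (i -ᶻ j)
    lemma = solve-∀
    lemma′ : ∀ q z g → q *ᶻ z -ᶻ q *ᶻ g ≡ q *ᶻ (z -ᶻ g)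
    lemma′ = solve-∀

  module Inner (R : UnitRep n k) (rotation : Rotational R) (s≡inn : Rotational.s rotation ≡ inn) where
    open UnitRep R
    open Core 0<k 2k<n R
    open Rotational rotation
    open Rotation 0<k 2k<n R rotation

    U V : ℤ → M
    U i = P (out , i)
    V i = P (inn , i)

    u≢v : ∀ {i j} → U i ≢ V j
    u≢v eq = case proj₁ (P-inj eq) of λ ()

    u-inj : ∀ {i j} → U i ≡ U j → i ≋ j
    u-inj eq = proj₂ (P-inj eq)

    v-inj : ∀ {i j} → V i ≡ V j → i ≋ j
    v-inj eq = proj₂ (P-inj eq)

    K≡k : K ≡ + k ⊎ K ≡ -ᶻ + k
    K≡k = subst (λ s → K ≡ κ s ⊎ K ≡ -ᶻ κ s) s≡inn K≡

    e≡v₀ : e ≡ V (+ 0)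
    e≡v₀ = subst (λ s → e ≡ P (s , + 0)) s≡inn e≡

    b≡u₀ : b ≡ U (+ 0)
    b≡u₀ = subst (λ s → b ≡ P (flip s , + 0)) s≡inn b≡

    A-v : ∀ m → A m ≡ V (m *ᶻ K)
    A-v m = trans (A-P m) (cong (λ s → P (s , m *ᶻ K)) s≡inn)

    -- Left multiplication by a power of `a` carries arcs to arcs with the same label, so the arcs
    -- at index `i` depend only on the residue of `i` modulo `g`.
    shift : ∀ {t t′ c i j} i′ j′ → i G.≋ i′ → i′ -ᶻ i ≡ j′ -ᶻ j →
            P (t , i) ∙ c ≡ P (t′ , j) → P (t , i′) ∙ c ≡ P (t′ , j′)
    shift {t} {t′} {c} {i} {j} i′ j′ i≋i′ eq arc with shifts K≡k i≋i′
    ... | m , i′≋ = begin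
      P (t , i′) ∙ c ≡⟨ cong (_∙ c) (trans (P-cong i′≋) (sym (A-act m t i))) ⟩
      (A m ∙ P (t , i)) ∙ c ≡⟨ trans (assoc _ _ c) (cong (A m ∙_) arc) ⟩
      A m ∙ P (t′ , j) ≡⟨ A-act m t′ j ⟩
      P (t′ , j +ᶻ m *ᶻ K) ≡⟨ P-cong (linear (-ᶻ + 1) (trans (lemma j j′ (m *ᶻ K))
                                (trans (cong (λ d → -ᶻ (d -ᶻ m *ᶻ K)) (sym eq)) (lemma′ i i′ (m *ᶻ K)))) i′≋) ⟩
      P (t′ , j′) ∎
      where
      open ≡-Reasoning
      lemma : ∀ j j′ m → (j +ᶻ m) -ᶻ j′ ≡ -ᶻ (j′ -ᶻ j -ᶻ m)
      lemma = solve-∀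
      lemma′ : ∀ i i′ m → -ᶻ (i′ -ᶻ i -ᶻ m) ≡ -ᶻ + 1 *ᶻ (i′ -ᶻ (i +ᶻ m))
      lemma′ = solve-∀

    ahead≋ : ∀ i → i +ᶻ + k G.≋ i
    ahead≋ i = G.linear (+ 1) (lemma i (+ k)) k≋0ᴳ
      where
      lemma : ∀ i k → i +ᶻ k -ᶻ i ≡ + 1 *ᶻ (k -ᶻ + 0)
      lemma = solve-∀

    behind≋ : ∀ i → i -ᶻ + k G.≋ i
    behind≋ i = G.linear (-ᶻ + 1) (lemma i (+ k)) k≋0ᴳ
      where
      lemma : ∀ i k → i -ᶻ k -ᶻ i ≡ -ᶻ + 1 *ᶻ (k -ᶻ + 0)
      lemma = solve-∀

    -- A product of generators that ends on an inner rim without `e` has to come in through a spoke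
    -- of that rim, and all its spokes behave alike by `shift`.
    entered : ∀ j → ¬ j G.≋ + 0 → ∃ λ c → InC a b c × U j ∙ c ≡ V j
    entered j j≢0 = path (generated (V j)) j refl (G.≡⇒≋ refl)
      where
      path : ∀ {x} → Gen _∙_ e a b x → ∀ i → x ≡ V i → i G.≋ j → ∃ λ c → InC a b c × U j ∙ c ≡ V j
      path gen-ε i eq i≋j = contradiction
        (G.≋-trans (G.≋-sym i≋j) (≋⇒G (v-inj (trans (sym eq) e≡v₀)))) j≢0
      path (gen-∙ {x} {c} gx c∈C) i eq i≋j with cover x
      ... | (out , i′) , refl with move (out , i′) c∈C
      ...   | inj₁ stay = contradiction (trans (sym stay) eq) u≢v
      ...   | inj₂ (fwd , hop) = contradiction (trans (sym hop) eq) u≢v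
      ...   | inj₂ (bwd , hop) = contradiction (trans (sym hop) eq) u≢v
      ...   | inj₂ (spk , hop) = c , c∈C , shift j j
        (G.≋-trans (≋⇒G (v-inj (trans (sym hop) eq))) i≋j) refl hop
      path (gen-∙ {x} {c} gx c∈C) i eq i≋j | (inn , i′) , refl with move (inn , i′) c∈C
      ...   | inj₁ stay = path gx i′ refl (G.≋-trans (≋⇒G (v-inj (trans (sym stay) eq))) i≋j)
      ...   | inj₂ (fwd , hop) = path gx i′ refl (G.≋-trans (G.≋-sym (ahead≋ i′))
        (G.≋-trans (≋⇒G (v-inj (trans (sym hop) eq))) i≋j))
      ...   | inj₂ (bwd , hop) = path gx i′ refl (G.≋-trans (G.≋-sym (behind≋ i′))
        (G.≋-trans (≋⇒G (v-inj (trans (sym hop) eq))) i≋j))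
      ...   | inj₂ (spk , hop) = contradiction (trans (sym hop) eq) u≢v

    -- If `a` fixed `V j` or moved it along its rim, the end of that arc would also be the end of an
    -- `a`-arc coming through a spoke, against right cancellation.
    spoke-swapped : ∀ j → U j ∙ a ≡ V j → V j ∙ a ≡ U j
    spoke-swapped j uj with move (inn , j) (inj₁ refl)
    ... | inj₁ stay = contradiction (cancelʳ (trans uj (sym stay))) u≢v
    ... | inj₂ (fwd , eq) = contradiction
      (cancelʳ (trans (shift (j +ᶻ + k) (j +ᶻ + k) (G.≋-sym (ahead≋ j)) refl uj) (sym eq))) u≢v
    ... | inj₂ (bwd , eq) = contradiction
      (cancelʳ (trans (shift (j -ᶻ + k) (j -ᶻ + k) (G.≋-sym (behind≋ j)) refl uj) (sym eq))) u≢v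
    ... | inj₂ (spk , eq) = eq

    -- The rim edges need arcs, and only `b` is left; whichever way such an arc points, translation
    -- along the rim gives one that starts at `V j`.
    b-along-inner : ∀ j → (∀ i → i G.≋ j → V i ∙ a ≢ V (i +ᶻ + k) × V (i +ᶻ + k) ∙ a ≢ V i) →
                    ∃ λ q → q G.≋ j × V j ∙ b ≡ V q
    b-along-inner j not-a with arc (inn , j) fwd
    ... | _ , inj₁ refl , inj₁ eq = contradiction eq (proj₁ (not-a j (G.≡⇒≋ refl)))
    ... | _ , inj₁ refl , inj₂ eq = contradiction eq (proj₂ (not-a j (G.≡⇒≋ refl)))
    ... | _ , inj₂ refl , inj₁ eq = j +ᶻ + k , ahead≋ j , eq
    ... | _ , inj₂ refl , inj₂ eq = j -ᶻ + k , behind≋ j , shift j (j -ᶻ + k) (ahead≋ j) (lemma j (+ k)) eq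
      where
      lemma : ∀ j k → j -ᶻ (j +ᶻ k) ≡ j -ᶻ k -ᶻ j
      lemma = solve-∀

    module Fixed (ba≡b : b ∙ a ≡ b) where
      b-fixed : ∀ {x} → Gen _∙_ e a b x → (b ∙ x) ∙ a ≡ b ∙ x
      b-fixed gen-ε = trans (cong (_∙ a) (∙e b)) (trans ba≡b (sym (∙e b)))
      b-fixed (gen-∙ {x} gx (inj₁ refl)) = trans (cong (_∙ a) bxa≡bx) (trans (b-fixed gx) (sym bxa≡bx))
        where
        bxa≡bx : b ∙ (x ∙ a) ≡ b ∙ x
        bxa≡bx = trans (sym (assoc b x a)) (b-fixed gx)
      b-fixed (gen-∙ {x} gx (inj₂ refl)) = trans (assoc b _ a) (cong (b ∙_) (trans (assoc x b a) (cong (x ∙_) ba≡b)))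

      power-or-fixed : ∀ {x} → Gen _∙_ e a b x → (∃ λ m → x ≡ A m) ⊎ (∃ λ m → ∃ λ y → x ≡ A m ∙ (b ∙ y))
      power-or-fixed gen-ε = inj₁ (+ 0 , sym A-0)
      power-or-fixed (gen-∙ gx (inj₁ refl)) with power-or-fixed gx
      ... | inj₁ (m , refl) = inj₁ (m +ᶻ + 1 , trans (cong (A m ∙_) (sym A-1)) (A-∙ m (+ 1)))
      ... | inj₂ (m , y , refl) = inj₂ (m , y ∙ a , trans (assoc _ _ a) (cong (A m ∙_) (assoc b y a)))
      power-or-fixed (gen-∙ gx (inj₂ refl)) with power-or-fixed gx
      ... | inj₁ (m , refl) = inj₂ (m , e , cong (A m ∙_) (sym (∙e b)))
      ... | inj₂ (m , y , refl) = inj₂ (m , y ∙ b , trans (assoc _ _ b) (cong (A m ∙_) (assoc b y b)))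

      -- The powers of `a` have indices divisible by `g`. Every other element has the form a^m b y,
      -- and `b ∙ a ≡ b` makes all of these fixed under right multiplication by `a`.
      v-fixed : ∀ j → ¬ j G.≋ + 0 → V j ∙ a ≡ V j
      v-fixed j j≢0 with power-or-fixed (generated (V j))
      ... | inj₁ (m , eq) = contradiction (G.≋-trans (≋⇒G (v-inj (trans eq (A-v m))))
          (G.linear m (lemma m K) (K≋0ᴳ K≡k))) j≢0
        where
        lemma : ∀ m K → m *ᶻ K -ᶻ + 0 ≡ m *ᶻ (K -ᶻ + 0)
        lemma = solve-∀
      ... | inj₂ (m , y , eq) = trans (cong (_∙ a) eq) (trans (assoc (A m) _ a)
          (trans (cong (A m ∙_) (b-fixed (generated y))) (sym eq)))

      -- `V j` has no `a`-arc to another vertex and spends its `b`-arc on the inner rim, so the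
      -- spoke is covered from `U j`. By `spoke-swapped` the label there cannot be `a`.
      u-to-v : ∀ j → ¬ j G.≋ + 0 → U j ∙ b ≡ V j
      u-to-v j j≢0 = by-arc (b-along-inner j not-a) (arc (inn , j) spk)
        where
        not-a : ∀ i → i G.≋ j → V i ∙ a ≢ V (i +ᶻ + k) × V (i +ᶻ + k) ∙ a ≢ V i
        not-a i i≋j =
          (λ eq → κ≢0 inn i (v-inj (trans (sym eq) (v-fixed i (j≢0 ∘ G.≋-trans (G.≋-sym i≋j)))))) ,
          (λ eq → κ≢0 inn i (v-inj (trans (sym (v-fixed (i +ᶻ + k)
            (j≢0 ∘ G.≋-trans (G.≋-sym i≋j) ∘ G.≋-trans (G.≋-sym (ahead≋ i))))) eq)))
        by-arc : (∃ λ q → q G.≋ j × V j ∙ b ≡ V q) →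
                 (∃ λ c → InC a b c × (V j ∙ c ≡ U j ⊎ U j ∙ c ≡ V j)) → U j ∙ b ≡ V j
        by-arc _ (_ , inj₁ refl , inj₁ eq) = contradiction (trans (sym eq) (v-fixed j j≢0)) u≢v
        by-arc (_ , _ , vb) (_ , inj₂ refl , inj₁ eq) = contradiction (trans (sym eq) vb) u≢v
        by-arc _ (_ , inj₁ refl , inj₂ eq) = contradiction (trans (sym (spoke-swapped j eq)) (v-fixed j j≢0)) u≢v
        by-arc _ (_ , inj₂ refl , inj₂ eq) = eq

      u₀a : U (+ 0) ∙ a ≡ U (+ 0)
      u₀a = subst (λ x → x ∙ a ≡ x) b≡u₀ ba≡b

      -1≢0ᴳ : ¬ -ᶻ + 1 G.≋ + 0
      -1≢0ᴳ eq = 1≢0ᴳ (G.neg-cancel-≋ eq)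

      -- `U (+ 0)` is fixed by `a` and `U j` uses its `b`-arc for the spoke. The edge is therefore a
      -- `b`-arc from `U (+ 0)`; this cannot hold towards both sides.
      leaves : ∀ d j → P (nbr (out , + 0) d) ≡ U j → ¬ j G.≋ + 0 → ¬ j ≋ + 0 → U (+ 0) ∙ b ≡ U j
      leaves d j end j≢0ᴳ j≢0 with arc (out , + 0) d
      ... | _ , inj₁ refl , inj₁ eq = contradiction (u-inj (trans (sym end) (trans (sym eq) u₀a))) j≢0
      ... | _ , inj₂ refl , inj₁ eq = trans eq end
      ... | _ , inj₁ refl , inj₂ eq = contradiction (u-inj (trans (sym end) (cancelʳ (trans eq (sym u₀a))))) j≢0
      ... | _ , inj₂ refl , inj₂ eq = contradiction (trans (sym eq) (trans (cong (_∙ b) end) (u-to-v j j≢0ᴳ))) u≢v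

      impossible : ⊥
      impossible = 2κ≢0 out (+ 0) (u-inj (trans
        (sym (leaves fwd (+ 1) refl 1≢0ᴳ (1≢0ᴳ ∘ ≋⇒G))) (leaves bwd (-ᶻ + 1) refl -1≢0ᴳ (-1≢0ᴳ ∘ ≋⇒G))))

module Moving {n k : ℕ} (0<k : 0 < k) (2k<n : 2 * k < n) (g : ℕ) (2≤g : 2 ≤ g) (g∣n : g ∣ℕ n) (g∣k : g ∣ℕ k)
              (bezout : ∃ λ y → Congruence._≋_ n (y *ᶻ + k) (+ g))
              (R : UnitRep n k) (rotation : Rotational R) (s≡inn : Rotational.s rotation ≡ inn)
              (ba≡u₁ : UnitRep._∙_ R (UnitRep.b R) (UnitRep.a R) ≡ UnitRep.P R (out , + 1)) where
  open Congruence n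
  open Petersen n k
  open Distances n k 0<k 2k<n
  open NonCoprime 0<k 2k<n g 2≤g g∣n g∣k bezout
  open UnitRep R
  open Core 0<k 2k<n R hiding (nonZero)
  open Rotational rotation
  open Rotation 0<k 2k<n R rotation
  open Inner R rotation s≡inn

  u-≢ : ∀ i d → 0 < d → d < n → U (+ (d + i)) ≢ U (+ i)
  u-≢ i d 0<d d<n eq = distinct d (lemma (+ d) (+ i)) 0<d d<n (u-inj eq)
    where
    lemma : ∀ d i → (d +ᶻ i) -ᶻ i ≡ d
    lemma = solve-∀

  +-1 : ∀ i → + i +ᶻ + 1 ≡ + suc i
  +-1 i = cong +_ (ℕ.+-comm i 1)

  u₀a : U (+ 0) ∙ a ≡ U (+ 1)
  u₀a = trans (cong (_∙ a) (sym b≡u₀)) ba≡u₁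

  module Advancing (not-back : U (+ 1) ∙ a ≢ U (+ 0)) where
    -- Right cancellation excludes stopping and turning back. It also excludes the spoke: by
    -- `spoke-swapped`, `V (+ suc j)` would then be a second source of an `a`-arc into
    -- `U (+ suc j)`.
    run : ∀ j → U (+ j) ∙ a ≡ U (+ suc j) × U (+ suc j) ∙ a ≢ U (+ j)
    run zero = u₀a , not-back
    run (suc j) = advance (run j) (move (out , + suc j) (inj₁ refl))
      where
      advance : U (+ j) ∙ a ≡ U (+ suc j) × U (+ suc j) ∙ a ≢ U (+ j) →
                U (+ suc j) ∙ a ≡ U (+ suc j) ⊎ (∃ λ d → U (+ suc j) ∙ a ≡ P (nbr (out , + suc j) d)) →
                U (+ suc j) ∙ a ≡ U (+ suc (suc j)) × U (+ suc (suc j)) ∙ a ≢ U (+ suc j)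
      advance (uj , _) (inj₁ stay) = contradiction (cancelʳ (trans stay (sym uj)))
        (u-≢ j 1 (s≤s z≤n) (ℕ.<-trans (s≤s (s≤s z≤n)) 2<n))
      advance (uj , _) (inj₂ (fwd , eq)) = trans eq (P-≡ lab out (+-1 (suc j))) ,
        λ back → u-≢ j 2 (s≤s z≤n) 2<n (cancelʳ (trans back (sym uj)))
      advance (_ , uj′≢) (inj₂ (bwd , eq)) = contradiction eq uj′≢
      advance (uj , _) (inj₂ (spk , eq)) = contradiction
        (sym (cancelʳ (trans uj (sym (spoke-swapped (+ suc j) eq))))) (u≢v ∘ sym)

    b-A : ∀ j → b ∙ A (+ j) ≡ U (+ j)
    b-A zero = trans (cong (b ∙_) A-0) (trans (∙e b) b≡u₀)
    b-A (suc j) = trans (cong (b ∙_) (trans (A-cong (≡⇒≋ (sym (+-1 j)))) (sym (A-∙ (+ j) (+ 1)))))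
      (trans (sym (assoc b _ _)) (trans (cong₂ _∙_ (b-A j) A-1) (proj₁ (run j))))

    -- The order n / g of a is too small for b a^j to run through the whole outer rim.
    impossible : ⊥
    impossible = period g∣n
      where
      period : g ∣ℕ n → ⊥
      period (ℕᵈ.divides zero n≡0) = case subst (2 <_) n≡0 2<n of λ ()
      period (ℕᵈ.divides (suc q) n≡) =
        u-≢ 0 (suc q) (s≤s z≤n) q<n (trans (cong (λ j → U (+ j)) (ℕ.+-identityʳ (suc q))) (trans (sym (b-A (suc q)))
          (trans (cong (b ∙_) (trans (A-v (+ suc q)) (trans (P-cong qK≋0) (sym e≡v₀)))) (trans (∙e b) b≡u₀))))
        where
        q<n : suc q < n
        q<n = subst (suc q <_) (sym n≡) (ℕ.m<m*n (suc q) g 2≤g)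
        qk≋0 : + suc q *ᶻ + k ≋ + 0
        qk≋0 = ∣⇒≋ (subst (n ∣ℕ_) (sym (trans (cong ℤ.∣_∣ (ℤ.+-identityʳ (+ suc q *ᶻ + k))) (ℤ.abs-* (+ suc q) (+ k))))
          (subst (_∣ℕ suc q * k) (sym n≡) (ℕᵈ.*-monoʳ-∣ (suc q) g∣k)))
        qK≋0 : + suc q *ᶻ K ≋ + 0
        qK≋0 = [ (λ K≡ → subst (λ K → + suc q *ᶻ K ≋ + 0) (sym K≡) qk≋0)
               , (λ K≡ → subst (λ K → + suc q *ᶻ K ≋ + 0) (sym K≡)
                   (linear (-ᶻ + 1) (lemma (+ suc q) (+ k)) qk≋0)) ]′ K≡k
          where
          lemma : ∀ q k → q *ᶻ -ᶻ k -ᶻ + 0 ≡ -ᶻ + 1 *ᶻ (q *ᶻ k -ᶻ + 0)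
          lemma = solve-∀

  module Swapping (u₁a : U (+ 1) ∙ a ≡ U (+ 0)) where
    baa≡b : (b ∙ a) ∙ a ≡ b
    baa≡b = trans (cong (_∙ a) ba≡u₁) (trans u₁a (sym b≡u₀))

    bb≢e : b ∙ b ≢ e
    bb≢e bb≡e = aa≢e (begin
      a ∙ a ≡⟨ sym (e∙ _) ⟩
      e ∙ (a ∙ a) ≡⟨ cong (_∙ (a ∙ a)) (sym bb≡e) ⟩
      (b ∙ b) ∙ (a ∙ a) ≡⟨ assoc b b _ ⟩
      b ∙ (b ∙ (a ∙ a)) ≡⟨ cong (b ∙_) (trans (sym (assoc b a a)) baa≡b) ⟩
      b ∙ b ≡⟨ bb≡e ⟩
      e ∎)
      where open ≡-Reasoning

    u₁b : U (+ 1) ∙ b ≡ V (+ 1)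
    u₁b with entered (+ 1) 1≢0ᴳ
    ... | _ , inj₁ refl , eq = contradiction (trans (sym u₁a) eq) u≢v
    ... | _ , inj₂ refl , eq = eq

    -- Both arcs that leave u₁ are spoken for, by u₀ and v₁, and the only `a`-arc into u₁ comes from
    -- u₀.
    u₂b : U (+ 2) ∙ b ≡ U (+ 1)
    u₂b with arc (out , + 1) fwd
    ... | _ , inj₁ refl , inj₁ eq = contradiction (trans (sym eq) u₁a) (u-≢ 0 2 (s≤s z≤n) 2<n)
    ... | _ , inj₂ refl , inj₁ eq = contradiction (trans (sym eq) u₁b) u≢v
    ... | _ , inj₁ refl , inj₂ eq = contradiction (cancelʳ (trans eq (sym u₀a))) (u-≢ 0 2 (s≤s z≤n) 2<n)
    ... | _ , inj₂ refl , inj₂ eq = eq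

    -- Right multiplication by b leads from u_g = a^x b down to u₁ = b a, whence b^g = a^(-x) b a.
    module Descending (u₀b : U (+ 0) ∙ b ≡ U (-ᶻ + 1)) where
      in-range : ∀ i → 0 < i → i < g → ¬ + i G.≋ + 0
      in-range i 0<i i<g = G.distinct i (ℤ.+-identityʳ (+ i)) 0<i i<g

      -- Proved together with `to-spoke`: once `b` leads from u_i down the rim, only `a` can enter
      -- the inner rim at `i`. Then u_i has no arc up, and the `a`-arc into u_i comes from v_i, so
      -- the next rim edge is again a `b`-arc downwards. This stops at `g`, where the inner rim of
      -- `e` recurs.
      down : ∀ j → suc j < g → U (+ (2 + j)) ∙ b ≡ U (+ (1 + j))

      to-spoke : ∀ j → 2 + j < g → U (+ (2 + j)) ∙ a ≡ V (+ (2 + j))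
      to-spoke j 2+j<g = by-generator (entered (+ (2 + j)) (in-range (2 + j) (s≤s z≤n) 2+j<g))
        where
        by-generator : (∃ λ c → InC a b c × U (+ (2 + j)) ∙ c ≡ V (+ (2 + j))) → U (+ (2 + j)) ∙ a ≡ V (+ (2 + j))
        by-generator (_ , inj₁ refl , eq) = eq
        by-generator (_ , inj₂ refl , eq) = contradiction (trans (sym (down j (ℕ.<-trans (ℕ.n<1+n (suc j)) 2+j<g))) eq) u≢v

      down zero _ = u₂b
      down (suc j) 2+j<g = by-arc (arc (out , + (2 + j)) fwd)
        where
        next : P (nbr (out , + (2 + j)) fwd) ≡ U (+ (3 + j))
        next = P-≡ lab out (+-1 (2 + j))
        by-arc : (∃ λ c → InC a b c × (U (+ (2 + j)) ∙ c ≡ P (nbr (out , + (2 + j)) fwd) ⊎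
                                       P (nbr (out , + (2 + j)) fwd) ∙ c ≡ U (+ (2 + j)))) →
                 U (+ (3 + j)) ∙ b ≡ U (+ (2 + j))
        by-arc (_ , inj₁ refl , inj₁ eq) = contradiction (trans (sym eq) (to-spoke j 2+j<g)) u≢v
        by-arc (_ , inj₂ refl , inj₁ eq) = contradiction
          (trans (sym next) (trans (sym eq) (down j (ℕ.<-trans (ℕ.n<1+n (suc j)) 2+j<g))))
          (u-≢ (1 + j) 2 (s≤s z≤n) 2<n)
        by-arc (_ , inj₁ refl , inj₂ eq) = contradiction
          (cancelʳ (trans eq (sym (spoke-swapped (+ (2 + j)) (to-spoke j 2+j<g))))) u≢v
        by-arc (_ , inj₂ refl , inj₂ eq) = trans (cong (_∙ b) (sym next)) eq

      b^ : ℕ → M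
      b^ zero = e
      b^ (suc i) = b ∙ b^ i

      b^-comm : ∀ i → b ∙ b^ i ≡ b^ i ∙ b
      b^-comm zero = trans (∙e b) (sym (e∙ b))
      b^-comm (suc i) = trans (cong (b ∙_) (b^-comm i)) (sym (assoc b _ b))

      descend : ∀ i → i < g → U (+ (1 + i)) ∙ b^ i ≡ U (+ 1)
      descend zero _ = ∙e _
      descend (suc i) i<g = trans (sym (assoc _ b _))
        (trans (cong (_∙ b^ i) (down i i<g)) (descend i (ℕ.<-trans (ℕ.n<1+n i) i<g)))

      b-A : ∀ r → b ∙ A (+ r) ≡ b ⊎ b ∙ A (+ r) ≡ b ∙ a
      b-A zero = inj₁ (trans (cong (b ∙_) A-0) (∙e b))
      b-A (suc r) = [ inj₂ ∘ (λ eq → trans next (cong (_∙ a) eq))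
                    , inj₁ ∘ (λ eq → trans next (trans (cong (_∙ a) eq) baa≡b)) ]′ (b-A r)
        where
        next : b ∙ A (+ suc r) ≡ (b ∙ A (+ r)) ∙ a
        next = trans (cong (b ∙_) (trans (A-cong (≡⇒≋ (sym (+-1 r)))) (sym (A-∙ (+ r) (+ 1)))))
          (trans (sym (assoc b _ _)) (cong ((b ∙ A (+ r)) ∙_) A-1))

      B : M
      B = b^ g

      B≡A-u₁ : ∃ λ r → B ≡ A (+ r) ∙ U (+ 1) × A (+ r) ∙ U (+ 1) ≡ U (+ 1 -ᶻ + g)
      B≡A-u₁ = powers (multiple K≡k) g refl
        where
        powers : (∃ λ y → y *ᶻ K ≋ + g) → ∀ h → g ≡ h →
                 ∃ λ r → b^ h ≡ A (+ r) ∙ U (+ 1) × A (+ r) ∙ U (+ 1) ≡ U (+ 1 -ᶻ + g)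
        powers _ zero refl = case 2≤g of λ ()
        powers (y , yK≋g) (suc h) g≡ = r ,
          trans (sym (e∙ _)) (trans (cong (_∙ b^ (suc h)) (trans (sym A-0)
            (trans (A-cong (≡⇒≋ (sym (ℤ.+-inverseˡ y)))) (trans (sym (A-∙ (-ᶻ y) y)) (cong (_∙ A y) A-y≡)))))
            (trans (assoc _ _ _) (cong (A (+ r) ∙_) A-B)))
          , trans (cong (_∙ U (+ 1)) (sym A-y≡)) (trans (A-act (-ᶻ y) out (+ 1))
              (P-cong (linear (-ᶻ + 1) (lemma y K (+ g)) yK≋g)))
          where
          r : ℕ
          r = residue (-ᶻ y)
          A-y≡ : A (-ᶻ y) ≡ A (+ r)
          A-y≡ = A-cong (≋-residue (-ᶻ y))
          lemma : ∀ y K g → + 1 +ᶻ -ᶻ y *ᶻ K -ᶻ (+ 1 -ᶻ g) ≡ -ᶻ + 1 *ᶻ (y *ᶻ K -ᶻ g)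
          lemma = solve-∀
          lemma′ : ∀ y K g → + 0 +ᶻ y *ᶻ K -ᶻ g ≡ + 1 *ᶻ (y *ᶻ K -ᶻ g)
          lemma′ = solve-∀
          A-B : A y ∙ b^ (suc h) ≡ U (+ 1)
          A-B = begin
            A y ∙ (b ∙ b^ h) ≡⟨ sym (assoc _ b _) ⟩
            (A y ∙ b) ∙ b^ h ≡⟨ cong (λ x → (A y ∙ x) ∙ b^ h) b≡u₀ ⟩
            (A y ∙ U (+ 0)) ∙ b^ h ≡⟨ cong (_∙ b^ h) (trans (A-act y out (+ 0)) (P-cong (linear (+ 1) (lemma′ y K (+ g)) yK≋g))) ⟩
            U (+ g) ∙ b^ h ≡⟨ cong (λ i → U (+ i) ∙ b^ h) g≡ ⟩
            U (+ suc h) ∙ b^ h ≡⟨ descend h (subst (h <_) (sym g≡) (ℕ.n<1+n h)) ⟩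
            U (+ 1) ∎
            where open ≡-Reasoning

      r : ℕ
      r = proj₁ B≡A-u₁

      1-g≋1 : + 1 G.≋ + 1 -ᶻ + g
      1-g≋1 = G.∣⇒≋ {+ 1} {+ 1 -ᶻ + g} (subst (λ d → g ∣ℕ ℤ.∣ d ∣) (sym (lemma (+ g))) ℕᵈ.∣-refl)
        where
        lemma : ∀ g → + 1 -ᶻ (+ 1 -ᶻ g) ≡ g
        lemma = solve-∀

      Bb : B ∙ b ≡ V (+ 1 -ᶻ + g)
      Bb = trans (cong (_∙ b) (trans (proj₁ (proj₂ B≡A-u₁)) (proj₂ (proj₂ B≡A-u₁))))
        (shift (+ 1 -ᶻ + g) (+ 1 -ᶻ + g) 1-g≋1 refl u₁b)

      bB : b ∙ B ≡ (b ∙ A (+ r)) ∙ U (+ 1)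
      bB = trans (cong (b ∙_) (proj₁ (proj₂ B≡A-u₁))) (sym (assoc b _ _))

      bB≡Bb : b ∙ B ≡ V (+ 1 -ᶻ + g)
      bB≡Bb = trans (b^-comm g) Bb

      bu₁ : b ∙ U (+ 1) ≡ U (-ᶻ + 1) ∙ a
      bu₁ = trans (cong (b ∙_) (sym ba≡u₁)) (trans (sym (assoc b b a))
        (cong (_∙ a) (trans (cong (_∙ b) b≡u₀) u₀b)))

      data Size : Set where
        two  : g ≡ 2 → Size
        more : ∀ h → g ≡ 3 + h → Size

      size : Size
      size = by-value g refl
        where
        by-value : ∀ h → g ≡ h → Size
        by-value zero refl = case 2≤g of λ ()
        by-value (suc zero) refl = case 2≤g of λ { (s≤s ()) }
        by-value (suc (suc zero)) eq = two eq
        by-value (suc (suc (suc h))) eq = more h eq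

      2∣⇒ : ∀ i j → g ≡ 2 → 2 ∣ℕ ℤ.∣ i -ᶻ j ∣ → i G.≋ j
      2∣⇒ i j g≡2 2∣ = G.∣⇒≋ {i} {j} (subst (_∣ℕ ℤ.∣ i -ᶻ j ∣) (sym g≡2) 2∣)

      u₋₁a-two : g ≡ 2 → U (-ᶻ + 1) ∙ a ≡ U (-ᶻ + 2)
      u₋₁a-two g≡2 = shift (-ᶻ + 1) (-ᶻ + 2) (2∣⇒ (+ 1) (-ᶻ + 1) g≡2 (ℕᵈ.divides 1 refl)) refl u₁a

      u₋₁a-more : ∀ h → g ≡ 3 + h → U (-ᶻ + 1) ∙ a ≡ V (-ᶻ + 1)
      u₋₁a-more h g≡ = shift (-ᶻ + 1) (-ᶻ + 1)
        (G.∣⇒≋ {+ (2 + h)} { -ᶻ + 1} (subst₂ _∣ℕ_ refl (trans g≡ (ℕ.+-comm 1 (2 + h))) ℕᵈ.∣-refl)) refl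
        (to-spoke h (subst (2 + h <_) (sym g≡) (ℕ.n<1+n _)))

      -- Here `b ∙ B` is `b ∙ U (+ 1)`, that is u₋₁ a, and has to be v_(1-g). For g = 2 the vertex
      -- u₋₁ behaves like u₁, whose `a`-arc stays on the outer rim. For g ≥ 3, u₋₁ a is v₋₁, while g
      -- - 2 lies strictly between 0 and n.
      even : b ∙ A (+ r) ≢ b
      even eq = by-size size
        where
        v≡ : V (+ 1 -ᶻ + g) ≡ U (-ᶻ + 1) ∙ a
        v≡ = trans (sym bB≡Bb) (trans bB (trans (cong (_∙ U (+ 1)) eq) bu₁))
        by-size : Size → ⊥
        by-size (two g≡2) = u≢v (sym (trans v≡ (u₋₁a-two g≡2)))
        by-size (more h g≡) = distinct (suc h) (trans (cong (λ g → -ᶻ + 1 -ᶻ (+ 1 -ᶻ + g)) g≡) (lemma (+ h)))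
            (s≤s z≤n) (ℕ.≤-<-trans (subst (suc h ≤_) (sym g≡) (ℕ.m≤n+m (suc h) 2)) g<n)
            (v-inj (sym (trans v≡ (u₋₁a-more h g≡))))
          where
          lemma : ∀ h → -ᶻ + 1 -ᶻ (+ 1 -ᶻ (+ 3 +ᶻ h)) ≡ + 1 +ᶻ h
          lemma = solve-∀

      -- From v_(1-g) one `b`-arc can reach the outer rim only at an index congruent to 1 modulo
      -- `g`. Evaluated the other way, the same element is u₋₄ for g = 2, and an outer vertex of
      -- index congruent to -1 for g ≥ 3.
      odd : b ∙ A (+ r) ≢ b ∙ a
      odd eq = by-size size
        where
        v₁a : V (+ 1) ∙ a ≡ V (+ 1 -ᶻ + g)
        v₁a = begin
          V (+ 1) ∙ a ≡⟨ cong (_∙ a) (sym u₁b) ⟩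
          (U (+ 1) ∙ b) ∙ a ≡⟨ trans (assoc _ b a) (cong (U (+ 1) ∙_) ba≡u₁) ⟩
          U (+ 1) ∙ U (+ 1) ≡⟨ cong (_∙ U (+ 1)) (sym (trans eq ba≡u₁)) ⟩
          (b ∙ A (+ r)) ∙ U (+ 1) ≡⟨ sym bB ⟩
          b ∙ B ≡⟨ bB≡Bb ⟩
          V (+ 1 -ᶻ + g) ∎
          where open ≡-Reasoning
        -- Both sides are b^(g + 2).
        twice : ((U (-ᶻ + 1) ∙ a) ∙ b) ∙ a ≡ V (+ 1 -ᶻ + g) ∙ b
        twice = begin
          ((U (-ᶻ + 1) ∙ a) ∙ b) ∙ a ≡⟨ cong (λ x → (x ∙ b) ∙ a) (sym bu₁) ⟩
          ((b ∙ U (+ 1)) ∙ b) ∙ a ≡⟨ cong (_∙ a) (trans (assoc b _ b) (cong (b ∙_) u₁b)) ⟩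
          (b ∙ V (+ 1)) ∙ a ≡⟨ trans (assoc b _ a) (cong (b ∙_) v₁a) ⟩
          b ∙ V (+ 1 -ᶻ + g) ≡⟨ cong (b ∙_) (sym Bb) ⟩
          b ∙ (B ∙ b) ≡⟨ sym (assoc b B b) ⟩
          (b ∙ B) ∙ b ≡⟨ cong (_∙ b) bB≡Bb ⟩
          V (+ 1 -ᶻ + g) ∙ b ∎
          where open ≡-Reasoning
        to-u : ∀ i → U i ≡ V (+ 1 -ᶻ + g) ∙ b → i G.≋ + 1
        to-u i eq′ = by-move (move (inn , + 1 -ᶻ + g) (inj₂ refl))
          where
          by-move : V (+ 1 -ᶻ + g) ∙ b ≡ V (+ 1 -ᶻ + g) ⊎ (∃ λ d → V (+ 1 -ᶻ + g) ∙ b ≡ P (nbr (inn , + 1 -ᶻ + g) d)) →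
                    i G.≋ + 1
          by-move (inj₁ stay) = contradiction (trans eq′ stay) u≢v
          by-move (inj₂ (fwd , hop)) = contradiction (trans eq′ hop) u≢v
          by-move (inj₂ (bwd , hop)) = contradiction (trans eq′ hop) u≢v
          by-move (inj₂ (spk , hop)) = G.≋-trans (≋⇒G (u-inj (trans eq′ hop))) (G.≋-sym 1-g≋1)
        by-size : Size → ⊥
        by-size (two g≡2) = 5≢ (subst (_∣ℕ 5) g≡2 (G.≋⇒∣ (to-u (-ᶻ + 4) (trans (sym cycle) twice))))
          where
          5≢ : ¬ 2 ∣ℕ 5
          5≢ (ℕᵈ.divides (suc (suc zero)) ())
          5≢ (ℕᵈ.divides (suc (suc (suc _))) ())
          cycle : ((U (-ᶻ + 1) ∙ a) ∙ b) ∙ a ≡ U (-ᶻ + 4)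
          cycle = trans (cong (λ x → (x ∙ b) ∙ a) (u₋₁a-two g≡2))
            (trans (cong (_∙ a) (shift (-ᶻ + 2) (-ᶻ + 3) (2∣⇒ (+ 0) (-ᶻ + 2) g≡2 (ℕᵈ.divides 1 refl)) refl u₀b))
              (shift (-ᶻ + 3) (-ᶻ + 4) (2∣⇒ (+ 1) (-ᶻ + 3) g≡2 (ℕᵈ.divides 2 refl)) refl u₁a))
        by-size (more h g≡) = along (b-along-inner (-ᶻ + 1) not-a)
          where
          v₋₁a : V (-ᶻ + 1) ∙ a ≡ U (-ᶻ + 1)
          v₋₁a = spoke-swapped (-ᶻ + 1) (u₋₁a-more h g≡)
          va : ∀ i → i G.≋ -ᶻ + 1 → V i ∙ a ≡ U i
          va i i≋-1 = shift i i (G.≋-sym i≋-1) refl v₋₁a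
          not-a : ∀ i → i G.≋ -ᶻ + 1 → V i ∙ a ≢ V (i +ᶻ + k) × V (i +ᶻ + k) ∙ a ≢ V i
          not-a i i≋-1 = (λ eq → u≢v (trans (sym (va i i≋-1)) eq)) ,
                         (λ eq → u≢v (trans (sym (va (i +ᶻ + k) (G.≋-trans (ahead≋ i) i≋-1))) eq))
          along : (∃ λ q → q G.≋ -ᶻ + 1 × V (-ᶻ + 1) ∙ b ≡ V q) → ⊥
          along (q , q≋-1 , vb) = G.distinct 2 refl (s≤s z≤n) (subst (2 <_) (sym g≡) (s≤s (s≤s (s≤s z≤n))))
            (G.≋-trans (G.≋-sym (to-u q (trans (sym path) twice))) q≋-1)
            where
            path : ((U (-ᶻ + 1) ∙ a) ∙ b) ∙ a ≡ U q
            path = trans (cong (λ x → (x ∙ b) ∙ a) (u₋₁a-more h g≡)) (trans (cong (_∙ a) vb) (va q q≋-1))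

      impossible : ⊥
      impossible = [ even , odd ]′ (b-A r)

    impossible : ⊥
    impossible = by-move (move (out , + 0) (inj₂ refl))
      where
      by-move : U (+ 0) ∙ b ≡ U (+ 0) ⊎ (∃ λ d → U (+ 0) ∙ b ≡ P (nbr (out , + 0) d)) → ⊥
      -- Here `b` is idempotent, but multiplying u₂ by `b` gives u₁ and then v₁.
      by-move (inj₁ u₀b) = u≢v (trans (sym (trans (cong (U (+ 2) ∙_) (trans (cong (_∙ b) b≡u₀) (trans u₀b (sym b≡u₀)))) u₂b))
        (trans (sym (assoc _ b b)) (trans (cong (_∙ b) u₂b) u₁b)))
      -- Here b b = b a = u₁, so b (b a) and (b b) b agree; they are u₁ a = u₀ and u₁ b = v₁.
      by-move (inj₂ (fwd , u₀b)) = u≢v (begin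
        U (+ 0) ≡⟨ sym u₁a ⟩
        U (+ 1) ∙ a ≡⟨ cong (_∙ a) (trans (sym u₀b) (cong (_∙ b) (sym b≡u₀))) ⟩
        (b ∙ b) ∙ a ≡⟨ trans (assoc b b a) (cong (b ∙_) ba≡u₁) ⟩
        b ∙ U (+ 1) ≡⟨ cong (b ∙_) (trans (sym u₀b) (cong (_∙ b) (sym b≡u₀))) ⟩
        b ∙ (b ∙ b) ≡⟨ sym (assoc b b b) ⟩
        (b ∙ b) ∙ b ≡⟨ cong (_∙ b) (trans (cong (_∙ b) b≡u₀) u₀b) ⟩
        U (+ 1) ∙ b ≡⟨ u₁b ⟩
        V (+ 1) ∎)
        where open ≡-Reasoning
      by-move (inj₂ (bwd , u₀b)) = Descending.impossible u₀b
      by-move (inj₂ (spk , u₀b)) = bb≢e (trans (cong (_∙ b) b≡u₀) (trans u₀b (sym e≡v₀)))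

  impossible : ⊥
  impossible = by-cases ((U (+ 1) ∙ a) ≟ U (+ 0))
    where
    by-cases : Dec (U (+ 1) ∙ a ≡ U (+ 0)) → ⊥
    by-cases (yes eq) = Swapping.impossible eq
    by-cases (no ≢) = Advancing.impossible ≢

-- From the rotation to the congruences for k

Good : ℕ → ℕ → Set
Good n k = (+ n) ℤᵘ.∣ ((+ k) *ᶻ (+ k) -ᶻ + 1)
         ⊎ ((+ n) ℤᵘ.∣ ((+ k) *ᶻ (+ k) -ᶻ (+ k)) ⊎ (+ n) ℤᵘ.∣ ((+ k) *ᶻ (+ k) +ᶻ (+ k)))

module _ {n k : ℕ} (0<k : 0 < k) (2k<n : 2 * k < n) where
  open Congruence n
  open Petersen n k
  open Distances n k 0<k 2k<n

  good : + k *ᶻ + k ≋ + 1 ⊎ (+ k *ᶻ + k ≋ + k ⊎ + k *ᶻ + k ≋ -ᶻ + k) → Good n k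
  good (inj₁ eq) = inj₁ (≋⇒∣ eq)
  good (inj₂ (inj₁ eq)) = inj₂ (inj₁ (≋⇒∣ eq))
  good (inj₂ (inj₂ eq)) = inj₂ (inj₂ (subst (λ d → n ∣ℕ ℤ.∣ + k *ᶻ + k +ᶻ d ∣) (ℤ.neg-involutive (+ k)) (≋⇒∣ eq)))

  bezout : ∃ λ y → y *ᶻ + k ≋ + ℕ.gcd n k
  bezout with ℕ.Bézout.identity (ℕ.gcd-GCD n k)
  ... | ℕ.Bézout.+- x y eq = -ᶻ + y , mod (divides (-ᶻ + x) (lemma (+ x) (+ y) (+ n) (+ k) (+ ℕ.gcd n k)
    (trans (cong (+ ℕ.gcd n k +ᶻ_) (sym (ℤ.pos-* y k))) (trans (cong +_ eq) (ℤ.pos-* x n)))))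
    where
    lemma : ∀ x y n k g → g +ᶻ y *ᶻ k ≡ x *ᶻ n → -ᶻ y *ᶻ k -ᶻ g ≡ -ᶻ x *ᶻ n
    lemma x y n k g eq = trans (rearrange y k g) (trans (cong ℤ.-_ eq) (ℤ.neg-distribˡ-* x n))
      where
      rearrange : ∀ y k g → -ᶻ y *ᶻ k -ᶻ g ≡ -ᶻ (g +ᶻ y *ᶻ k)
      rearrange = solve-∀
  ... | ℕ.Bézout.-+ x y eq = + y , mod (divides (+ x) (lemma (+ x) (+ y) (+ n) (+ k) (+ ℕ.gcd n k)
    (trans (cong (+ ℕ.gcd n k +ᶻ_) (sym (ℤ.pos-* x n))) (trans (cong +_ eq) (ℤ.pos-* y k)))))
    where
    lemma : ∀ x y n k g → g +ᶻ x *ᶻ n ≡ y *ᶻ k → y *ᶻ k -ᶻ g ≡ x *ᶻ n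
    lemma x y n k g eq = trans (cong (_-ᶻ g) (sym eq)) (rearrange x n g)
      where
      rearrange : ∀ x n g → g +ᶻ x *ᶻ n -ᶻ g ≡ x *ᶻ n
      rearrange = solve-∀

  inverse-of-K : ∀ s {K} → (s ≡ inn → ℕ.gcd n k ≡ 1) → K ≡ κ s ⊎ K ≡ -ᶻ κ s → ∃ λ y → y *ᶻ K ≋ + 1
  inverse-of-K out _ (inj₁ refl) = + 1 , ≡⇒≋ refl
  inverse-of-K out _ (inj₂ refl) = -ᶻ + 1 , ≡⇒≋ refl
  inverse-of-K inn g≡1 (inj₁ refl) = proj₁ bezout , subst (λ g → proj₁ bezout *ᶻ + k ≋ + g) (g≡1 refl) (proj₂ bezout)
  inverse-of-K inn g≡1 (inj₂ refl) = -ᶻ proj₁ bezout ,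
    ≋-trans (≡⇒≋ (lemma (proj₁ bezout) (+ k))) (subst (λ g → proj₁ bezout *ᶻ + k ≋ + g) (g≡1 refl) (proj₂ bezout))
    where
    lemma : ∀ y k → -ᶻ y *ᶻ -ᶻ k ≡ y *ᶻ k
    lemma = solve-∀

  -- For `s = out`, `x` is ± k. For `s = inn` it is an inverse of ± k, so x² = ± x makes `x` equal
  -- to ± 1 and k² = 1 results. The coefficients exhibit each conclusion as a combination of the two
  -- hypotheses.
  square-of-k : ∀ s {K} y → K ≡ κ s ⊎ K ≡ -ᶻ κ s → y *ᶻ K ≋ + 1 → let x = y *ᶻ κ (flip s) in
                x *ᶻ x ≋ + 1 ⊎ (x *ᶻ x ≋ x ⊎ x *ᶻ x ≋ -ᶻ x) →
                + k *ᶻ + k ≋ + 1 ⊎ (+ k *ᶻ + k ≋ + k ⊎ + k *ᶻ + k ≋ -ᶻ + k)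
  square-of-k out y (inj₁ refl) yK (inj₁ sq) =
    inj₁ (linear₂ (+ 1) (-ᶻ ((y +ᶻ + 1) *ᶻ (+ k *ᶻ + k))) (lemma y (+ k)) sq yK)
    where
    lemma : ∀ y k → k *ᶻ k -ᶻ + 1 ≡
            (+ 1) *ᶻ ((y *ᶻ k) *ᶻ (y *ᶻ k) -ᶻ + 1) +ᶻ (-ᶻ ((y +ᶻ + 1) *ᶻ (k *ᶻ k))) *ᶻ (y *ᶻ + 1 -ᶻ + 1)
    lemma = solve-∀
  square-of-k out y (inj₁ refl) yK (inj₂ (inj₁ sq)) =
    inj₂ (inj₁ (linear₂ (+ 1) (+ k -ᶻ (y +ᶻ + 1) *ᶻ (+ k *ᶻ + k)) (lemma y (+ k)) sq yK))
    where
    lemma : ∀ y k → k *ᶻ k -ᶻ k ≡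
            (+ 1) *ᶻ ((y *ᶻ k) *ᶻ (y *ᶻ k) -ᶻ (y *ᶻ k)) +ᶻ (k -ᶻ (y +ᶻ + 1) *ᶻ (k *ᶻ k)) *ᶻ (y *ᶻ + 1 -ᶻ + 1)
    lemma = solve-∀
  square-of-k out y (inj₁ refl) yK (inj₂ (inj₂ sq)) =
    inj₂ (inj₂ (linear₂ (+ 1) (-ᶻ + k -ᶻ (y +ᶻ + 1) *ᶻ (+ k *ᶻ + k)) (lemma y (+ k)) sq yK))
    where
    lemma : ∀ y k → k *ᶻ k -ᶻ (-ᶻ k) ≡
            (+ 1) *ᶻ ((y *ᶻ k) *ᶻ (y *ᶻ k) -ᶻ (-ᶻ (y *ᶻ k))) +ᶻ (-ᶻ k -ᶻ (y +ᶻ + 1) *ᶻ (k *ᶻ k)) *ᶻ (y *ᶻ + 1 -ᶻ + 1)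
    lemma = solve-∀
  square-of-k out y (inj₂ refl) yK (inj₁ sq) =
    inj₁ (linear₂ (+ 1) ((y -ᶻ + 1) *ᶻ (+ k *ᶻ + k)) (lemma y (+ k)) sq yK)
    where
    lemma : ∀ y k → k *ᶻ k -ᶻ + 1 ≡
            (+ 1) *ᶻ ((y *ᶻ k) *ᶻ (y *ᶻ k) -ᶻ + 1) +ᶻ ((y -ᶻ + 1) *ᶻ (k *ᶻ k)) *ᶻ (y *ᶻ (-ᶻ + 1) -ᶻ + 1)
    lemma = solve-∀
  square-of-k out y (inj₂ refl) yK (inj₂ (inj₁ sq)) =
    inj₂ (inj₂ (linear₂ (+ 1) ((y -ᶻ + 1) *ᶻ (+ k *ᶻ + k) -ᶻ + k) (lemma y (+ k)) sq yK))
    where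
    lemma : ∀ y k → k *ᶻ k -ᶻ (-ᶻ k) ≡
            (+ 1) *ᶻ ((y *ᶻ k) *ᶻ (y *ᶻ k) -ᶻ (y *ᶻ k)) +ᶻ ((y -ᶻ + 1) *ᶻ (k *ᶻ k) -ᶻ k) *ᶻ (y *ᶻ (-ᶻ + 1) -ᶻ + 1)
    lemma = solve-∀
  square-of-k out y (inj₂ refl) yK (inj₂ (inj₂ sq)) =
    inj₂ (inj₁ (linear₂ (+ 1) ((y -ᶻ + 1) *ᶻ (+ k *ᶻ + k) +ᶻ + k) (lemma y (+ k)) sq yK))
    where
    lemma : ∀ y k → k *ᶻ k -ᶻ k ≡
            (+ 1) *ᶻ ((y *ᶻ k) *ᶻ (y *ᶻ k) -ᶻ (-ᶻ (y *ᶻ k))) +ᶻ ((y -ᶻ + 1) *ᶻ (k *ᶻ k) +ᶻ k) *ᶻ (y *ᶻ (-ᶻ + 1) -ᶻ + 1)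
    lemma = solve-∀
  square-of-k inn y (inj₁ refl) yK (inj₁ sq) =
    inj₁ (linear₂ (-ᶻ (+ k *ᶻ + k)) (y *ᶻ + k +ᶻ + 1) (lemma y (+ k)) sq yK)
    where
    lemma : ∀ y k → k *ᶻ k -ᶻ + 1 ≡
            (-ᶻ (k *ᶻ k)) *ᶻ ((y *ᶻ + 1) *ᶻ (y *ᶻ + 1) -ᶻ + 1) +ᶻ (y *ᶻ k +ᶻ + 1) *ᶻ (y *ᶻ k -ᶻ + 1)
    lemma = solve-∀
  square-of-k inn y (inj₁ refl) yK (inj₂ (inj₁ sq)) =
    inj₁ (linear₂ (-ᶻ ((+ k +ᶻ + 1) *ᶻ (+ k *ᶻ + k))) ((+ k +ᶻ + 1) *ᶻ (y *ᶻ + k +ᶻ + 1 -ᶻ + k)) (lemma y (+ k)) sq yK)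
    where
    lemma : ∀ y k → k *ᶻ k -ᶻ + 1 ≡
            (-ᶻ ((k +ᶻ + 1) *ᶻ (k *ᶻ k))) *ᶻ ((y *ᶻ + 1) *ᶻ (y *ᶻ + 1) -ᶻ (y *ᶻ + 1)) +ᶻ ((k +ᶻ + 1) *ᶻ (y *ᶻ k +ᶻ + 1 -ᶻ k)) *ᶻ (y *ᶻ k -ᶻ + 1)
    lemma = solve-∀
  square-of-k inn y (inj₁ refl) yK (inj₂ (inj₂ sq)) =
    inj₁ (linear₂ ((+ k -ᶻ + 1) *ᶻ (+ k *ᶻ + k)) (-ᶻ ((+ k -ᶻ + 1) *ᶻ (y *ᶻ + k +ᶻ + 1 +ᶻ + k))) (lemma y (+ k)) sq yK)
    where
    lemma : ∀ y k → k *ᶻ k -ᶻ + 1 ≡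
            ((k -ᶻ + 1) *ᶻ (k *ᶻ k)) *ᶻ ((y *ᶻ + 1) *ᶻ (y *ᶻ + 1) -ᶻ (-ᶻ (y *ᶻ + 1))) +ᶻ (-ᶻ ((k -ᶻ + 1) *ᶻ (y *ᶻ k +ᶻ + 1 +ᶻ k))) *ᶻ (y *ᶻ k -ᶻ + 1)
    lemma = solve-∀
  square-of-k inn y (inj₂ refl) yK (inj₁ sq) =
    inj₁ (linear₂ (-ᶻ (+ k *ᶻ + k)) (+ 1 -ᶻ y *ᶻ + k) (lemma y (+ k)) sq yK)
    where
    lemma : ∀ y k → k *ᶻ k -ᶻ + 1 ≡
            (-ᶻ (k *ᶻ k)) *ᶻ ((y *ᶻ + 1) *ᶻ (y *ᶻ + 1) -ᶻ + 1) +ᶻ (+ 1 -ᶻ y *ᶻ k) *ᶻ (y *ᶻ (-ᶻ k) -ᶻ + 1)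
    lemma = solve-∀
  square-of-k inn y (inj₂ refl) yK (inj₂ (inj₁ sq)) =
    inj₁ (linear₂ ((+ k -ᶻ + 1) *ᶻ (+ k *ᶻ + k)) (-ᶻ ((+ k -ᶻ + 1) *ᶻ (+ 1 +ᶻ + k -ᶻ y *ᶻ + k))) (lemma y (+ k)) sq yK)
    where
    lemma : ∀ y k → k *ᶻ k -ᶻ + 1 ≡
            ((k -ᶻ + 1) *ᶻ (k *ᶻ k)) *ᶻ ((y *ᶻ + 1) *ᶻ (y *ᶻ + 1) -ᶻ (y *ᶻ + 1)) +ᶻ (-ᶻ ((k -ᶻ + 1) *ᶻ (+ 1 +ᶻ k -ᶻ y *ᶻ k))) *ᶻ (y *ᶻ (-ᶻ k) -ᶻ + 1)
    lemma = solve-∀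
  square-of-k inn y (inj₂ refl) yK (inj₂ (inj₂ sq)) =
    inj₁ (linear₂ (-ᶻ ((+ k +ᶻ + 1) *ᶻ (+ k *ᶻ + k))) ((+ k +ᶻ + 1) *ᶻ (+ 1 -ᶻ + k -ᶻ y *ᶻ + k)) (lemma y (+ k)) sq yK)
    where
    lemma : ∀ y k → k *ᶻ k -ᶻ + 1 ≡
            (-ᶻ ((k +ᶻ + 1) *ᶻ (k *ᶻ k))) *ᶻ ((y *ᶻ + 1) *ᶻ (y *ᶻ + 1) -ᶻ (-ᶻ (y *ᶻ + 1))) +ᶻ ((k +ᶻ + 1) *ᶻ (+ 1 -ᶻ k -ᶻ y *ᶻ k)) *ᶻ (y *ᶻ (-ᶻ k) -ᶻ + 1)
    lemma = solve-∀

  module _ (R : UnitRep n k) (rotation : Rotational R) where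
    open UnitRep R
    open Core 0<k 2k<n R
    open Rotational rotation
    open Rotation 0<k 2k<n R rotation

    R′ : UnitRep n k
    R′ = with-labelling R (reflect lab)

    rotation′ : Rotational R′
    rotation′ = record
      { s = s ; K = -ᶻ K
      ; K≡ = [ (λ K≡ → inj₂ (cong ℤ.-_ K≡)) , (λ K≡ → inj₁ (trans (cong ℤ.-_ K≡) (ℤ.neg-involutive (κ s)))) ]′ K≡
      ; e≡ = e≡ ; b≡ = b≡
      ; rot = λ t i → trans (rot t (-ᶻ i)) (P-≡ lab t (lemma i K)) }
      where
      lemma : ∀ i K → -ᶻ i +ᶻ K ≡ -ᶻ (i +ᶻ -ᶻ K)
      lemma = solve-∀

    inner-coprime : s ≡ inn → ℕ.gcd n k ≡ 1
    inner-coprime s≡inn = by-value (ℕ.gcd n k) refl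
      where
      g∣n : ℕ.gcd n k ∣ℕ n
      g∣n = ℕ.gcd[m,n]∣m n k
      g∣k : ℕ.gcd n k ∣ℕ k
      g∣k = ℕ.gcd[m,n]∣n n k
      large : 2 ≤ ℕ.gcd n k → ⊥
      large 2≤g = by-move (move (out , + 0) (inj₁ refl))
        where
        open NonCoprime.Inner 0<k 2k<n (ℕ.gcd n k) 2≤g g∣n g∣k bezout R rotation s≡inn
        by-move : P (out , + 0) ∙ a ≡ P (out , + 0) ⊎ (∃ λ d → P (out , + 0) ∙ a ≡ P (nbr (out , + 0) d)) → ⊥
        by-move (inj₁ eq) = Fixed.impossible (trans (cong (_∙ a) b≡u₀) (trans eq (sym b≡u₀)))
        by-move (inj₂ (fwd , eq)) = Moving.impossible 0<k 2k<n (ℕ.gcd n k) 2≤g g∣n g∣k bezout R rotation s≡inn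
          (trans (cong (_∙ a) b≡u₀) eq)
        -- Reflecting the labels turns u₋₁ into u₁ and keeps `e` and `b` in place.
        by-move (inj₂ (bwd , eq)) = Moving.impossible 0<k 2k<n (ℕ.gcd n k) 2≤g g∣n g∣k bezout R′ rotation′ s≡inn
          (trans (cong (_∙ a) b≡u₀) eq)
        by-move (inj₂ (spk , eq)) = ba≢e (trans (cong (_∙ a) b≡u₀) (trans eq (sym e≡v₀)))
      by-value : ∀ g → ℕ.gcd n k ≡ g → ℕ.gcd n k ≡ 1
      by-value zero eq = case subst (2 <_) (ℕᵈ.0∣⇒≡0 (subst (_∣ℕ n) eq g∣n)) 2<n of λ ()
      by-value (suc zero) eq = eq
      by-value (suc (suc g)) eq = ⊥-elim (large (subst (2 ≤_) (sym eq) (s≤s (s≤s z≤n))))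

    rotation⇒good : Good n k
    rotation⇒good = good (square-of-k s y K≡ yK≋1 (Coprime.square y yK≋1))
      where
      y : ℤ
      y = proj₁ (inverse-of-K s inner-coprime K≡)
      yK≋1 : y *ᶻ K ≋ + 1
      yK≋1 = proj₂ (inverse-of-K s inner-coprime K≡)

-- When the walk counts tell spokes from rim edges

Exceptional : ℕ → ℕ → Set
Exceptional n k = n ≡ 10 × (k ≡ 2 ⊎ k ≡ 3)

-- Closed walks of length 10 are needed only for G(13, 5) and G(26, 5).
Outcome : ℕ → ℕ → Set
Outcome n k = ¬ Walks.Constant n k 6 ⊎ (¬ Walks.Constant n k 8 ⊎ (Good n k ⊎ ((n ≡ 5 × k ≡ 2) ⊎ Exceptional n k)))

good? : ∀ n k → Dec (Good n k)
good? n k = (_ ∣ℕ? _) ⊎-dec ((_ ∣ℕ? _) ⊎-dec (_ ∣ℕ? _))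

outcome? : ∀ n k → Dec (Outcome n k)
outcome? n k = ¬? (Walks.constant? n k 6) ⊎-dec (¬? (Walks.constant? n k 8) ⊎-dec (good? n k ⊎-dec
  (((n ℕ.≟ 5) ×-dec (k ℕ.≟ 2)) ⊎-dec ((n ℕ.≟ 10) ×-dec ((k ℕ.≟ 2) ⊎-dec (k ℕ.≟ 3))))))

-- The remaining n > 40 are treated in `Large`. The bound is 8 · 5: eight steps of size at most 5
-- add up to at most 40, so for k ≤ 5 such a sum vanishes modulo `n` only if it is zero.
small-outcome : ∀ {n} → n < 41 → ∀ {k} → k < n → 0 < k → 2 * k < n → Outcome n k
small-outcome = from-yes (ℕ.allUpTo? (λ n → ℕ.allUpTo? (λ k →
  (0 ℕ.<? k) →-dec ((2 * k ℕ.<? n) →-dec outcome? n k)) n) 41)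

module Large {n k : ℕ} (40<n : 40 < n) (2≤k : 2 ≤ k) (2k<n : 2 * k < n) where
  open Walks n k

  χ≡1 : ∀ z → n ∣ℕ ℤ.∣ z ∣ → χ z ≡ 1
  χ≡1 z n∣z = cong 𝟙 (Dec.dec-true (n ∣ℕ? ℤ.∣ z ∣) n∣z)

  χ≡0 : ∀ z → ¬ n ∣ℕ ℤ.∣ z ∣ → χ z ≡ 0
  χ≡0 z n∤z = cong 𝟙 (Dec.dec-false (n ∣ℕ? ℤ.∣ z ∣) n∤z)

  ∣-small : ∀ {m} → m < n → n ∣ℕ m → m ≡ 0
  ∣-small {zero} _ _ = refl
  ∣-small {suc m} m<n n∣m = contradiction (ℕᵈ.∣⇒≤ n∣m) (ℕ.<⇒≱ m<n)

  χ-small : ∀ z → 0 < ℤ.∣ z ∣ → ℤ.∣ z ∣ < n → χ z ≡ 0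
  χ-small z 0<z z<n = χ≡0 z λ n∣z → ℕ.<⇒≢ 0<z (sym (∣-small z<n n∣z))

  ∑ : List ℤ → ℕ
  ∑ = sum ∘ map χ

  zeros : List ℤ → ℕ
  zeros = sum ∘ map (λ z → 𝟙 (does (ℤ.∣ z ∣ ℕ.≟ 0)))

  ∣⇒zero : ∀ m → m ≤ 40 → 𝟙 (does (n ∣ℕ? m)) ≤ 𝟙 (does (m ℕ.≟ 0))
  ∣⇒zero m m≤40 with n ∣ℕ? m
  ... | no _ = z≤n
  ... | yes n∣m rewrite ∣-small (ℕ.≤-<-trans m≤40 40<n) n∣m = ℕ.≤-refl

  ∑≤zeros : ∀ {zs} → All (λ z → ℤ.∣ z ∣ ≤ 40) zs → ∑ zs ≤ zeros zs
  ∑≤zeros [] = z≤n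
  ∑≤zeros {z ∷ zs} (z≤40 ∷ bounds) = ℕ.+-mono-≤ (∣⇒zero ℤ.∣ z ∣ z≤40) (∑≤zeros bounds)

  closed≤∑ : (f : ℤ × ℤ → ℤ) → (∀ x → n ∣ℕ ℤ.∣ at x ∣ → n ∣ℕ ℤ.∣ f x ∣) → ∀ xs → closed xs ≤ ∑ (map f xs)
  closed≤∑ f n∣f [] = z≤n
  closed≤∑ f n∣f (x ∷ xs) = ℕ.+-mono-≤ head (closed≤∑ f n∣f xs)
    where
    head : χ (at x) ≤ χ (f x)
    head with n ∣ℕ? ℤ.∣ at x ∣
    ... | no _ = z≤n
    ... | yes n∣x = ℕ.≤-reflexive (sym (χ≡1 (f x) (n∣f x n∣x)))

  closed-filter : (p : ℤ × ℤ → Bool) → ∀ xs → closed xs ≡ closed (filterᵇ p xs) + closed (filterᵇ (not ∘ p) xs)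
  closed-filter p [] = refl
  closed-filter p (x ∷ xs) with p x
  ... | true = trans (cong (λ m → χ (at x) + m) (closed-filter p xs)) (sym (ℕ.+-assoc (χ (at x)) _ _))
  ... | false = trans (cong (λ m → χ (at x) + m) (closed-filter p xs)) (swap (χ (at x)) (closed (filterᵇ p xs)) (closed (filterᵇ (not ∘ p) xs)))
    where
    swap : ∀ a b c → a + (b + c) ≡ b + (a + c)
    swap a b c = trans (sym (ℕ.+-assoc a b c)) (trans (cong (λ m → m + c) (ℕ.+-comm a b)) (ℕ.+-assoc b a c))

  origin? : ℤ × ℤ → Bool
  origin? (p , q) = does (p ℤ.≟ + 0) ∧ does (q ℤ.≟ + 0)

  χ-origin : χ (at (+ 0 , + 0)) ≡ 1
  χ-origin = χ≡1 (+ 0) (n ℕᵈ.∣0)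

  -- The two origins among the endpoints are the cycles u₋₁ u₀ v₀ v_m u_m u_(m-1) v_(m-1) v₋₁ with m
  -- = ± k.
  2≤OS : 2 ≤ F 6 out bwd spk
  2≤OS = subst (2 ≤_) (sym (closed-filter origin? (walks 6 out bwd spk)))
    (ℕ.≤-trans (ℕ.≤-reflexive (sym (cong₂ (λ x y → x + (y + 0)) χ-origin χ-origin)))
               (ℕ.m≤m+n (closed (filterᵇ origin? (walks 6 out bwd spk))) _))

  -- If at most one of the closed walks along an inner 2-path survives modulo n, the counts differ.
  few-II : (f : ℤ × ℤ → ℤ) → (∀ x → n ∣ℕ ℤ.∣ at x ∣ → n ∣ℕ ℤ.∣ f x ∣) →
           All (λ z → ℤ.∣ z ∣ ≤ 40) (map f (walks 6 inn bwd fwd)) → zeros (map f (walks 6 inn bwd fwd)) ≤ 1 →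
           ¬ Constant 6
  few-II f n∣f bounds zeros≤1 (OO≡OS , _ , OO≡II) = ℕ.<⇒≱ (s≤s zeros≤1)
    (ℕ.≤-trans 2≤OS (ℕ.≤-trans (ℕ.≤-reflexive (trans (sym OO≡OS) OO≡II))
      (ℕ.≤-trans (closed≤∑ f n∣f (walks 6 inn bwd fwd)) (∑≤zeros bounds))))

  bounded? : ∀ zs → Dec (All (λ z → ℤ.∣ z ∣ ≤ 40) zs)
  bounded? = All.all? (λ z → ℤ.∣ z ∣ ℕ.≤? 40)

  when-k≡ : ∀ m → k ≡ m → let values = map (Walks.at n m) (walks 6 inn bwd fwd) in
            {True (bounded? values)} → {True (zeros values ℕ.≤? 1)} → ¬ Constant 6
  when-k≡ m refl {bounds} {zeros≤1} = few-II at (λ _ → id) (toWitness bounds) (toWitness zeros≤1)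

  -- Twice p + q k reduced by n = 2 k + 4: since 2 k is congruent to - 4, doubling eliminates `k`
  -- and leaves a bounded number.
  double : ℤ × ℤ → ℤ
  double (p , q) = + 2 *ᶻ p -ᶻ + 4 *ᶻ q

  when-n≡2k+4 : n ≡ 2 * k + 4 → ¬ Constant 6
  when-n≡2k+4 n≡ = few-II double doubled (from-yes (bounded? (map double (walks 6 inn bwd fwd))))
    (from-yes (zeros (map double (walks 6 inn bwd fwd)) ℕ.≤? 1))
    where
    n≡ᶻ : + n ≡ + 2 *ᶻ + k +ᶻ + 4
    n≡ᶻ = trans (cong +_ n≡) (cong (_+ᶻ + 4) (ℤ.pos-* 2 k))
    doubled : ∀ x → n ∣ℕ ℤ.∣ at x ∣ → n ∣ℕ ℤ.∣ double x ∣
    doubled (p , q) n∣x = ℤˢ.∣⇒∣ᵤ (subst (+ n ∣ˢ_) (lemma p q (+ k))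
      (ℤˢ.∣m∣n⇒∣m+n (ℤˢ.∣n⇒∣m*n (+ 2) (ℤˢ.∣ᵤ⇒∣ {+ n} {at (p , q)} n∣x))
        (ℤˢ.∣n⇒∣m*n (-ᶻ q) (ℤˢ.∣-reflexive n≡ᶻ))))
      where
      lemma : ∀ p q k → + 2 *ᶻ (p +ᶻ q *ᶻ k) +ᶻ -ᶻ q *ᶻ (+ 2 *ᶻ k +ᶻ + 4) ≡ + 2 *ᶻ p -ᶻ + 4 *ᶻ q
      lemma = solve-∀

  -- A congruence p + q k = 0 closes a walk along an outer path only if |q| ≥ 2 and 1 ≤ |p| ≤ 3. Except for 3 ± 3 k,
  -- which count twice, these close as many walks that turn into a spoke, besides two 8-cycles present for all n and k.
  module Generic (6≤k : 6 ≤ k) (n≢2k+4 : n ≢ 2 * k + 4) where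
    -- Then p + q k is not zero, because q k outweighs p, and it is too small to be another multiple
    -- of `n`.
    far : ∀ p q → ℤ.∣ p ∣ < ℤ.∣ q ∣ * k → ℤ.∣ p ∣ + ℤ.∣ q ∣ * k < n → χ (at (p , q)) ≡ 0
    far p q p<qk p+qk<n = χ≡0 (at (p , q)) λ n∣ →
      ℕ.<⇒≢ p<qk (trans (cong ℤ.∣_∣ (opposite (ℤ.∣i∣≡0⇒i≡0 (∣-small (ℕ.≤-<-trans bound p+qk<n) n∣))))
        (trans (ℤ.∣-i∣≡∣i∣ (q *ᶻ + k)) (ℤ.abs-* q (+ k))))
      where
      bound : ℤ.∣ at (p , q) ∣ ≤ ℤ.∣ p ∣ + ℤ.∣ q ∣ * k
      bound = ℕ.≤-trans (ℤ.∣i+j∣≤∣i∣+∣j∣ p (q *ᶻ + k)) (ℕ.≤-reflexive (cong (λ m → ℤ.∣ p ∣ + m) (ℤ.abs-* q (+ k))))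
      opposite : at (p , q) ≡ + 0 → p ≡ -ᶻ (q *ᶻ + k)
      opposite eq = trans (lemma p (q *ᶻ + k)) (trans (cong (_-ᶻ q *ᶻ + k) eq) (ℤ.+-identityˡ _))
        where
        lemma : ∀ p r → p ≡ p +ᶻ r -ᶻ r
        lemma = solve-∀

    near : ∀ p q → ℤ.∣ q ∣ ≡ 1 → {True (ℤ.∣ p ∣ ℕ.≤? 5)} → χ (at (p , q)) ≡ 0
    near p q ∣q∣≡1 {p≤5} = far p q
      (subst (λ m → ℤ.∣ p ∣ < m * k) (sym ∣q∣≡1) (subst (ℤ.∣ p ∣ <_) (sym (ℕ.*-identityˡ k)) p<k))
      (subst (λ m → ℤ.∣ p ∣ + m * k < n) (sym ∣q∣≡1) (ℕ.<-trans (ℕ.+-monoˡ-< (1 * k) p<k) 2k<n))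
      where
      p<k : ℤ.∣ p ∣ < k
      p<k = ℕ.≤-trans (s≤s (toWitness p≤5)) 6≤k

    0<2k : 0 < 2 * k
    0<2k = ℕ.≤-trans (s≤s z≤n) (ℕ.≤-trans 6≤k (ℕ.m≤m+n k (k + 0)))

    χ-2k : χ (at (+ 0 , + 2)) ≡ 0
    χ-2k = far (+ 0) (+ 2) 0<2k 2k<n

    χ-4+2k : χ (at (+ 4 , + 2)) ≡ 0
    χ-4+2k = χ≡0 (at (+ 4 , + 2)) (multiples ∘ subst (n ∣ℕ_) (cong ℤ.∣_∣ (cong (λ d → + 4 +ᶻ d) (sym (ℤ.pos-* 2 k)))))
      where
      multiples : ¬ n ∣ℕ 4 + 2 * k
      multiples (ℕᵈ.divides (suc zero) eq) = n≢2k+4 (trans (sym (ℕ.+-identityʳ n)) (trans (sym eq) (ℕ.+-comm 4 (2 * k))))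
      multiples (ℕᵈ.divides (suc (suc q)) eq) = ℕ.<⇒≱ (ℕ.+-mono-< (ℕ.≤-trans (s≤s (s≤s (s≤s (s≤s (s≤s z≤n))))) 40<n) 2k<n)
        (ℕ.≤-trans (ℕ.+-monoʳ-≤ n (ℕ.m≤m+n n (q * n))) (ℕ.≤-reflexive (sym eq)))

    χ-4-2k : χ (at (+ 4 , -ᶻ + 2)) ≡ 0
    χ-4-2k = trans (cong χ flipped) (trans (χ-neg (+ (2 * k ℕ.∸ 4))) (χ-small (+ (2 * k ℕ.∸ 4))
      (ℕ.m<n⇒0<n∸m (ℕ.≤-trans (s≤s (s≤s (s≤s (s≤s (s≤s z≤n))))) (ℕ.≤-trans 6≤k (ℕ.m≤m+n k (k + 0)))))
      (ℕ.≤-<-trans (ℕ.m∸n≤m (2 * k) 4) 2k<n)))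
      where
      4≤2k : 4 ≤ 2 * k
      4≤2k = ℕ.≤-trans (s≤s (s≤s (s≤s (s≤s z≤n)))) (ℕ.≤-trans 6≤k (ℕ.m≤m+n k (k + 0)))
      lemma : ∀ k → + 4 +ᶻ (-ᶻ + 2) *ᶻ k ≡ -ᶻ (+ 2 *ᶻ k -ᶻ + 4)
      lemma = solve-∀
      flipped : at (+ 4 , -ᶻ + 2) ≡ -ᶻ + (2 * k ℕ.∸ 4)
      flipped = trans (lemma (+ k)) (cong ℤ.-_ (trans (cong (_-ᶻ + 4) (sym (ℤ.pos-* 2 k)))
        (trans (ℤ.m-n≡m⊖n (2 * k) 4) (ℤ.⊖-≥ 4≤2k))))

    χ-8 : χ (at (+ 8 , + 0)) ≡ 0
    χ-8 = χ-small (+ 8) (s≤s z≤n) (ℕ.<-trans (from-yes (8 ℕ.<? 40)) 40<n)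

    oblique? : ℤ × ℤ → Bool
    oblique? (p , q) = does (2 ℕ.≤? ℤ.∣ q ∣) ∧ does (1 ℕ.≤? ℤ.∣ p ∣) ∧ does (ℤ.∣ p ∣ ℕ.≤? 3)

    OO : F 6 out bwd fwd ≡ closed (filterᵇ oblique? (walks 6 out bwd fwd))
    OO = trans (closed-filter oblique? (walks 6 out bwd fwd))
      (trans (cong (λ m → closed (filterᵇ oblique? (walks 6 out bwd fwd)) + m) (vanish others)) (ℕ.+-identityʳ _))
      where
      vanish : ∀ {xs} → All (λ x → χ (at x) ≡ 0) xs → closed xs ≡ 0
      vanish [] = refl
      vanish (x≡0 ∷ rest) = cong₂ _+_ x≡0 (vanish rest)
      χ-[-2k] : χ (at (+ 0 , -ᶻ + 2)) ≡ 0
      χ-[-2k] = far (+ 0) (-ᶻ + 2) 0<2k 2k<n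
      others : All (λ x → χ (at x) ≡ 0) (filterᵇ (not ∘ oblique?) (walks 6 out bwd fwd))
      others =
        χ-8 ∷ near (+ 5) (+ 1) refl ∷ near (+ 5) (-ᶻ + 1) refl ∷
        χ-4+2k ∷ near (+ 5) (+ 1) refl ∷ near (+ 3) (+ 1) refl ∷
        χ-4-2k ∷ near (+ 5) (-ᶻ + 1) refl ∷ near (+ 3) (-ᶻ + 1) refl ∷
        χ-4+2k ∷ near (+ 5) (+ 1) refl ∷ near (+ 1) (+ 1) refl ∷
        χ-4-2k ∷ near (+ 5) (-ᶻ + 1) refl ∷ near (+ 1) (-ᶻ + 1) refl ∷
        χ-4+2k ∷ χ-2k ∷ near (+ 5) (+ 1) refl ∷
        near (-ᶻ + 1) (+ 1) refl ∷ χ-4-2k ∷ χ-[-2k] ∷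
        near (+ 5) (-ᶻ + 1) refl ∷ near (-ᶻ + 1) (-ᶻ + 1) refl ∷ []

    -- Selects the partners of the `oblique?` endpoints together with the two origins. Dropping the
    -- other endpoints only lowers the count, and a lower bound is enough.
    kept? : ℤ × ℤ → Bool
    kept? (p , q) = origin? (p , q) ∨ does (2 ℕ.≤? ℤ.∣ q ∣) ∧ does (ℤ.∣ q ∣ ℕ.≤? 4) ∧
      does (-ᶻ + 1 ℤ.≤? p) ∧ not (does (p ℤ.≟ + 0)) ∧ does (p ℤ.≤? + 3)

    c₊ c₋ : ℕ
    c₊ = χ (at (+ 3 , + 3))
    c₋ = χ (at (+ 3 , -ᶻ + 3))

    -- n would divide the sum 6 of 3 + 3 k and 3 - 3 k.
    c₊+c₋≤1 : c₊ + c₋ ≤ 1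
    c₊+c₋≤1 with n ∣ℕ? ℤ.∣ at (+ 3 , + 3) ∣ | n ∣ℕ? ℤ.∣ at (+ 3 , -ᶻ + 3) ∣
    ... | no _ | no _ = z≤n
    ... | no _ | yes _ = ℕ.≤-refl
    ... | yes _ | no _ = ℕ.≤-refl
    ... | yes n∣₊ | yes n∣₋ = contradiction (∣-small (ℕ.<-trans (from-yes (6 ℕ.<? 40)) 40<n) n∣6) λ ()
      where
      lemma : ∀ k → (+ 3 +ᶻ + 3 *ᶻ k) +ᶻ (+ 3 +ᶻ (-ᶻ + 3) *ᶻ k) ≡ + 6
      lemma = solve-∀
      n∣6 : n ∣ℕ 6
      n∣6 = ℤˢ.∣⇒∣ᵤ (subst (+ n ∣ˢ_) (lemma (+ k)) (ℤˢ.∣m∣n⇒∣m+n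
        (ℤˢ.∣ᵤ⇒∣ {+ n} {at (+ 3 , + 3)} n∣₊) (ℤˢ.∣ᵤ⇒∣ {+ n} {at (+ 3 , -ᶻ + 3)} n∣₋)))

    OO<OS : F 6 out bwd fwd < F 6 out bwd spk
    OO<OS = subst₂ _<_ (sym OO) (sym (closed-filter kept? (walks 6 out bwd spk)))
      (ℕ.≤-trans compare (ℕ.m≤m+n _ (closed (filterᵇ (not ∘ kept?) (walks 6 out bwd spk)))))
      where
      rearrange : ∀ c₊ c₋ x₊ x₋ y₊ y₋ w₊ w₋ →
        c₊ + (x₊ + (c₋ + (x₋ + (y₊ + (c₊ + (w₊ + (y₋ + (c₋ + (w₋ + 0)))))))))
        ≡ (c₊ + c₋) + (y₊ + (c₊ + (w₋ + (x₊ + (y₋ + (c₋ + (w₊ + x₋)))))))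
      rearrange = ℕSolver.solve-∀
      rearrange′ : ∀ c₊ c₋ x₊ x₋ y₊ y₋ w₊ w₋ →
        2 + (y₊ + (c₊ + (w₋ + (x₊ + (y₋ + (c₋ + (w₊ + x₋)))))))
        ≡ y₊ + (c₊ + (w₋ + (x₊ + (1 + (y₋ + (c₋ + (w₊ + (x₋ + (1 + 0)))))))))
      rearrange′ = ℕSolver.solve-∀
      x₊ x₋ y₊ y₋ w₊ w₋ : ℕ
      x₊ = χ (at (+ 2 , + 2))
      x₋ = χ (at (+ 2 , -ᶻ + 2))
      y₊ = χ (at (+ 2 , + 4))
      y₋ = χ (at (+ 2 , -ᶻ + 4))
      w₊ = χ (at (+ 1 , + 3))
      w₋ = χ (at (+ 1 , -ᶻ + 3))
      kept : closed (filterᵇ kept? (walks 6 out bwd spk)) ≡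
             y₊ + (c₊ + (w₋ + (x₊ + (1 + (y₋ + (c₋ + (w₊ + (x₋ + (1 + 0)))))))))
      kept = cong₂ (λ w ws → y₊ + (c₊ + (w + ws))) (χ-at-neg (+ 1) (-ᶻ + 3))
        (cong₂ (λ o os → x₊ + (o + (y₋ + (c₋ + os)))) χ-origin
          (cong₂ (λ w o → w + (x₋ + (o + 0))) (χ-at-neg (+ 1) (+ 3)) χ-origin))
      compare : closed (filterᵇ oblique? (walks 6 out bwd fwd)) < closed (filterᵇ kept? (walks 6 out bwd spk))
      compare = begin-strict
        closed (filterᵇ oblique? (walks 6 out bwd fwd)) ≡⟨ rearrange c₊ c₋ x₊ x₋ y₊ y₋ w₊ w₋ ⟩
        (c₊ + c₋) + rest <⟨ ℕ.+-monoˡ-< rest (s≤s c₊+c₋≤1) ⟩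
        2 + rest ≡⟨ rearrange′ c₊ c₋ x₊ x₋ y₊ y₋ w₊ w₋ ⟩
        y₊ + (c₊ + (w₋ + (x₊ + (1 + (y₋ + (c₋ + (w₊ + (x₋ + (1 + 0))))))))) ≡⟨ sym kept ⟩
        closed (filterᵇ kept? (walks 6 out bwd spk)) ∎
        where
        open ℕ.≤-Reasoning
        rest : ℕ
        rest = y₊ + (c₊ + (w₋ + (x₊ + (y₋ + (c₋ + (w₊ + x₋))))))

  varied : ¬ Constant 6
  varied with n ℕ.≟ 2 * k + 4 | 6 ℕ.≤? k
  ... | yes n≡ | _ = when-n≡2k+4 n≡
  ... | no n≢ | yes 6≤k = λ (OO≡OS , _) → ℕ.<⇒≢ (Generic.OO<OS 6≤k n≢) OO≡OS
  ... | no n≢ | no 6≰k = small k refl 2≤k (ℕ.≰⇒> 6≰k)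
    where
    small : ∀ m → k ≡ m → 2 ≤ m → m < 6 → ¬ Constant 6
    small 2 eq _ _ = when-k≡ 2 eq
    small 3 eq _ _ = when-k≡ 3 eq
    small 4 eq _ _ = when-k≡ 4 eq
    small 5 eq _ _ = when-k≡ 5 eq
    small 0 _ () _
    small 1 _ (s≤s ()) _
    small (suc (suc (suc (suc (suc (suc _)))))) _ _ (s≤s (s≤s (s≤s (s≤s (s≤s (s≤s ()))))))

-- Deciding facts about automorphisms of a given graph

all-Side? : ∀ {P : Side → Set} → (∀ s → Dec (P s)) → Dec (∀ s → P s)
all-Side? P? = map′ (λ { (p , q) out → p ; (p , q) inn → q }) (λ p → p out , p inn) (P? out ×-dec P? inn)

all-Dir? : ∀ {P : Dir → Set} → (∀ d → Dec (P d)) → Dec (∀ d → P d)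
all-Dir? P? = map′ (λ { (p , q , r) fwd → p ; (p , q , r) bwd → q ; (p , q , r) spk → r })
  (λ p → p fwd , p bwd , p spk) (P? fwd ×-dec P? bwd ×-dec P? spk)

any-Dir? : ∀ {P : Dir → Set} → (∀ d → Dec (P d)) → Dec (∃ P)
any-Dir? P? = map′ [ fwd ,_ , [ bwd ,_ , spk ,_ ]′ ]′
  (λ { (fwd , p) → inj₁ p ; (bwd , p) → inj₂ (inj₁ p) ; (spk , p) → inj₂ (inj₂ p) })
  (P? fwd ⊎-dec (P? bwd ⊎-dec P? spk))

module Finite {n k : ℕ} (0<k : 0 < k) (2k<n : 2 * k < n) where
  open Congruence n
  open Petersen n k
  open Distances n k 0<k 2k<n

  instance
    nonZero : NonZero n
    nonZero = n≢0

  infix 4 _~_ _~?_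
  _~_ : Label → Label → Set
  (s , i) ~ (t , j) = s ≡ t × i ≋ j

  _~?_ : ∀ l m → Dec (l ~ m)
  (s , i) ~? (t , j) = (s ≟ˢ t) ×-dec (i ≋? j)

  ~-P : ∀ {M} {Adj : M → M → Set} (L : Labelling Adj) {l m} → l ~ m → Labelling.P L l ≡ Labelling.P L m
  ~-P L {s , i} {s , j} (refl , i≋j) = Labelling.P-cong L i≋j

  Walk : ℕ → Label → Label → Set
  Walk zero l m = l ~ m
  Walk (suc r) l m = ∃ λ d → Walk r (nbr l d) m

  walk? : ∀ r l m → Dec (Walk r l m)
  walk? zero l m = l ~? m
  walk? (suc r) l m = any-Dir? λ d → walk? r (nbr l d) m

  vertices : List Label
  vertices = map (λ i → out , + i) (upTo n) ++ map (λ i → inn , + i) (upTo n)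

  ∈-vertices : ∀ l → ∃ λ v → v ∈ vertices × l ~ v
  ∈-vertices (out , i) = (out , + residue i) ,
    ∈.∈-++⁺ˡ (∈.∈-map⁺ _ (∈.∈-upTo⁺ (residue<n i))) , refl , ≋-residue i
  ∈-vertices (inn , i) = (inn , + residue i) ,
    ∈.∈-++⁺ʳ (map (λ i → out , + i) (upTo n)) (∈.∈-map⁺ _ (∈.∈-upTo⁺ (residue<n i))) , refl , ≋-residue i

  -- Necessary conditions for an automorphism with `l ↦ l′` to send `m` to `c`. Necessity suffices:
  -- a vertex that violates them is ruled out as an image, so no true image is ever lost.
  Consistent : Label → Label → Label × Label → Set
  Consistent m c (l , l′) = (l ~ m → l′ ~ c) × (l′ ~ c → l ~ m) ×
                            (Walk 1 l m → Walk 1 l′ c) × (Walk 2 l m → Walk 2 l′ c)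

  consistent? : ∀ m c p → Dec (Consistent m c p)
  consistent? m c (l , l′) = ((l ~? m) →-dec (l′ ~? c)) ×-dec ((l′ ~? c) →-dec (l ~? m)) ×-dec
    (walk? 1 l m →-dec walk? 1 l′ c) ×-dec (walk? 2 l m →-dec walk? 2 l′ c)

  candidates : List (Label × Label) → Label → List Label
  candidates known m = filter (λ c → All.all? (consistent? m c) known) vertices

  assign : List (Label × Label) → Label → List (Label × Label)
  assign known m with candidates known m
  ... | c ∷ [] = (m , c) ∷ known
  ... | _ = known

  -- Constraint propagation: m may only go to a vertex compatible with the known images (two passes suffice here).
  propagate : List (Label × Label) → List (Label × Label)
  propagate known = foldl assign (foldl assign known vertices) vertices

  Determined : List (Label × Label) → Label → Label → Set
  Determined known l l′ = Any (λ p → proj₁ p ~ l × proj₂ p ~ l′) known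

  determined? : ∀ known l l′ → Dec (Determined known l l′)
  determined? known l l′ = Any.any? (λ p → (proj₁ p ~? l) ×-dec (proj₂ p ~? l′)) known

  shift : ℤ → Label → Label
  shift K (s , i) = s , i +ᶻ K

  record Moves (known : List (Label × Label)) (f : Label → Label) : Set where
    constructor moves
    field moved : ∀ s → ∀ {i} → i < n → Determined (propagate known) (s , + i) (f (s , + i))

  moves? : ∀ known f → Dec (Moves known f)
  moves? known f = map′ moves Moves.moved (moved? (propagate known))
    where
    moved? : ∀ images → Dec (∀ s → ∀ {i} → i < n → Determined images (s , + i) (f (s , + i)))
    moved? images = all-Side? λ s → ℕ.allUpTo? (λ i → determined? images (s , + i) (f (s , + i))) n

  record Stuck (known : List (Label × Label)) : Set where
    constructor stuck
    field nowhere : Any (λ m → candidates (propagate known) m ≡ []) vertices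

  stuck? : ∀ known → Dec (Stuck known)
  stuck? known = map′ stuck Stuck.nowhere (nowhere? (propagate known))
    where
    empty? : (xs : List Label) → Dec (xs ≡ [])
    empty? [] = yes refl
    empty? (_ ∷ _) = no λ ()
    nowhere? : ∀ images → Dec (Any (λ m → candidates images m ≡ []) vertices)
    nowhere? images = Any.any? (λ m → empty? (candidates images m)) vertices

  module Propagation {M : Set} {Adj : M → M → Set} (L : Labelling Adj) (α : M → M)
                     (α-inj : ∀ {x y} → α x ≡ α y → x ≡ y) (α-adj : ∀ {x y} → Adj x y → Adj (α x) (α y)) where
    open Labelling L
    open Rigidity.Automorphism 0<k 2k<n L α α-inj α-adj using (image)

    Known : Label × Label → Set
    Known (l , l′) = α (P l) ≡ P l′

    walk-image : ∀ r {l l′ m c} → α (P l) ≡ P l′ → α (P m) ≡ P c → Walk r l m → Walk r l′ c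
    walk-image zero {l} αl αm l~m = P-inj (trans (sym αl) (trans (cong α (~-P L l~m)) αm))
    walk-image (suc r) {l} {l′} αl αm (d , w) = let f , αd = image {l} {l′} d αl in f , walk-image r αd αm w

    consistent : ∀ {known m c} → α (P m) ≡ P c → All Known known → All (Consistent m c) known
    consistent {m = m} {c} αm = All.map λ {p} αl →
      walk-image 0 {m = m} αl αm , (λ l′~c → P-inj (α-inj (trans αl (trans (~-P L l′~c) (sym αm))))) ,
      walk-image 1 {m = m} αl αm , walk-image 2 {m = m} αl αm

    candidate : ∀ {known} m → All Known known → ∃ λ c → c ∈ candidates known m × α (P m) ≡ P c
    candidate {known} m ok with cover (α (P m))
    ... | l , αm with ∈-vertices l
    ...   | c , c∈ , l~c = c , ∈.∈-filter⁺ (λ c → All.all? (consistent? m c) known) c∈ (consistent {m = m} αm′ ok) , αm′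
      where
      αm′ : α (P m) ≡ P c
      αm′ = trans αm (~-P L l~c)

    known-assign : ∀ {known} m → All Known known → All Known (assign known m)
    known-assign {known} m ok with candidates known m | candidate m ok
    ... | [] | _ = ok
    ... | c ∷ [] | _ , here refl , αm = αm ∷ ok
    ... | _ ∷ _ ∷ _ | _ = ok

    known-foldl : ∀ {known} ms → All Known known → All Known (foldl assign known ms)
    known-foldl [] ok = ok
    known-foldl (m ∷ ms) ok = known-foldl ms (known-assign m ok)

    known-propagate : ∀ {known} → All Known known → All Known (propagate known)
    known-propagate ok = known-foldl vertices (known-foldl vertices ok)

    determined : ∀ {known l l′} → All Known known → Determined known l l′ → α (P l) ≡ P l′
    determined (αl ∷ _) (here (m~l , c~l′)) = trans (cong α (sym (~-P L m~l))) (trans αl (~-P L c~l′))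
    determined (_ ∷ ok) (there det) = determined ok det

    not-stuck : ∀ known → All Known known → ¬ Stuck known
    not-stuck known ok (stuck nowhere) with Any.satisfied nowhere
    ... | m , none with candidate m (known-propagate ok)
    ...   | _ , c∈ , _ = case subst (_ ∈_) none c∈ of λ ()

    image-of : ∀ known f → All Known known → Moves known f → ∀ s {i} → i < n → α (P (s , + i)) ≡ P (f (s , + i))
    image-of known f ok (moves moved) s i<n = determined (known-propagate ok) (moved s i<n)

    translation : ∀ known K → All Known known → Moves known (shift K) → ∀ t i → α (P (t , i)) ≡ P (t , i +ᶻ K)
    translation known K ok m t i = trans (cong α (P-cong (≋-residue i)))
      (trans (image-of known _ ok m t (residue<n i)) (P-cong (+-congʳ-≋ K (≋-sym (≋-residue i)))))

  record Symmetry : Set where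
    field
      τ      : Label → Label
      τ-cong : ∀ {l m} → l ~ m → τ l ≡ τ m
      τ-inj  : ∀ {l m} → τ l ~ τ m → l ~ m
      τ-onto : ∀ l → ∃ λ m → l ~ τ m
      τ-nbr  : ∀ l d → ∃ λ d′ → nbr (τ l) d ~ τ (nbr l d′)
      τ-nbr′ : ∀ l d → ∃ λ d′ → τ (nbr l d) ~ nbr (τ l) d′

  relabel : ∀ {M} {Adj : M → M → Set} → Symmetry → Labelling Adj → Labelling Adj
  relabel {Adj = Adj} symmetry L = record
    { P      = P ∘ τ
    ; P-cong = λ i≋j → cong P (τ-cong (refl , i≋j))
    ; P-inj  = τ-inj ∘ P-inj
    ; cover  = λ x → let l , eq = cover x ; m , l~ = τ-onto l in m , trans eq (~-P L l~)
    ; adj⇒   = λ {l} adj → let d , eq = adj⇒ adj ; d′ , near = τ-nbr l d in d′ , trans eq (~-P L near)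
    ; adj⇐   = λ l d → let d′ , near = τ-nbr′ l d in subst (Adj (P (τ l))) (sym (~-P L near)) (adj⇐ (τ l) d′)
    }
    where
    open Symmetry symmetry
    open Labelling L

  -- Images of out 0, …, out (n - 1), inn 0, …, inn (n - 1), with inn i written as n + i.
  lookup : List ℕ → ℕ → ℕ
  lookup [] _ = 0
  lookup (c ∷ cs) zero = c
  lookup (c ∷ cs) (suc i) = lookup cs i

  decode : ℕ → Label
  decode c = if does (c ℕ.<? n) then (out , + c) else (inn , + c -ᶻ + n)

  tabulated : List ℕ → Label → Label
  tabulated cs (out , i) = decode (lookup cs (residue i))
  tabulated cs (inn , i) = decode (lookup cs (n + residue i))

  Each : (Label → Set) → Set
  Each Q = ∀ s → ∀ {i} → i < n → Q (s , + i)

  each? : ∀ {Q : Label → Set} → (∀ l → Dec (Q l)) → Dec (Each Q)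
  each? Q? = all-Side? λ s → ℕ.allUpTo? (λ i → Q? (s , + i)) n

  some? : ∀ {Q : Label → Set} → (∀ l → Dec (Q l)) → Dec (Any Q vertices)
  some? Q? = Any.any? Q? vertices

  Symmetric : List ℕ → Set
  Symmetric cs = Each (λ l → Each (λ m → τ l ~ τ m → l ~ m)) × Each (λ l → Any (λ m → l ~ τ m) vertices) ×
                 Each (λ l → ∀ d → ∃ λ d′ → nbr (τ l) d ~ τ (nbr l d′)) ×
                 Each (λ l → ∀ d → ∃ λ d′ → τ (nbr l d) ~ nbr (τ l) d′)
    where
    τ : Label → Label
    τ = tabulated cs

  symmetric? : ∀ cs → Dec (Symmetric cs)
  symmetric? cs = each? (λ l → each? λ m → (τ l ~? τ m) →-dec (l ~? m)) ×-dec each? (λ l → some? λ m → l ~? τ m) ×-dec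
                  each? (λ l → all-Dir? λ d → any-Dir? λ d′ → nbr (τ l) d ~? τ (nbr l d′)) ×-dec
                  each? (λ l → all-Dir? λ d → any-Dir? λ d′ → τ (nbr l d) ~? nbr (τ l) d′)
    where
    τ : Label → Label
    τ = tabulated cs

  ~-trans : ∀ {l m o} → l ~ m → m ~ o → l ~ o
  ~-trans (refl , p) (refl , q) = refl , ≋-trans p q

  ~-sym : ∀ {l m} → l ~ m → m ~ l
  ~-sym (refl , p) = refl , ≋-sym p

  ~-reflexive : ∀ {l m} → l ≡ m → l ~ m
  ~-reflexive refl = refl , ≡⇒≋ refl

  ~-nbr : ∀ {l m} d → l ~ m → nbr l d ~ nbr m d
  ~-nbr {s , i} {.s , j} fwd (refl , p) = refl , +-congʳ-≋ (κ s) p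
  ~-nbr {s , i} {.s , j} bwd (refl , p) = refl , +-congʳ-≋ (-ᶻ κ s) p
  ~-nbr {s , i} {.s , j} spk (refl , p) = refl , p

  symmetry : ∀ cs → Symmetric cs → Symmetry
  symmetry cs (inj , onto , near , near′) = record
    { τ      = τ
    ; τ-cong = τ-cong
    ; τ-inj  = λ {l} {m} eq → ~-trans (reduce l) (~-trans
        (inj (proj₁ l) (bound l) (proj₁ m) (bound m)
          (~-trans (~-reflexive (sym (τ-cong (reduce l)))) (~-trans eq (~-reflexive (τ-cong (reduce m))))))
        (~-sym (reduce m)))
    ; τ-onto = λ l → let m , eq = Any.satisfied (onto (proj₁ l) (bound l)) in m , ~-trans (reduce l) eq
    ; τ-nbr  = λ l d → let d′ , eq = near (proj₁ l) (bound l) d in d′ ,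
        ~-trans (~-reflexive (cong (λ m → nbr m d) (τ-cong (reduce l))))
          (~-trans eq (~-reflexive (τ-cong (~-nbr d′ (~-sym (reduce l))))))
    ; τ-nbr′ = λ l d → let d′ , eq = near′ (proj₁ l) (bound l) d in d′ ,
        ~-trans (~-reflexive (τ-cong (~-nbr d (reduce l))))
          (~-trans eq (~-reflexive (cong (λ m → nbr m d′) (sym (τ-cong (reduce l))))))
    }
    where
    τ : Label → Label
    τ = tabulated cs
    τ-cong : ∀ {l m} → l ~ m → τ l ≡ τ m
    τ-cong {s , i} {.s , j} (refl , i≋j) = by-side s
      where
      same : residue i ≡ residue j
      same = residue-unique (residue<n i) (residue<n j) (≋-trans (≋-sym (≋-residue i)) (≋-trans i≋j (≋-residue j)))
      by-side : ∀ s → τ (s , i) ≡ τ (s , j)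
      by-side out = cong (decode ∘ lookup cs) same
      by-side inn = cong (λ r → decode (lookup cs (n + r))) same
    reduce : ∀ l → l ~ (proj₁ l , + residue (proj₂ l))
    reduce (s , i) = refl , ≋-residue i
    bound : ∀ l → residue (proj₂ l) < n
    bound (s , i) = residue<n i

-- The dodecahedron G(10, 2) and the Desargues graph G(10, 3)

-- Symmetries of G(10, 2) and G(10, 3) that carry a path on a rim to any given path of length three:
-- see tabulated for the format. The remaining paths are mirror images.
mirrored : ℕ → ℕ
mirrored c = if does (c ℕ.<? 10) then (10 ℕ.∸ c) ℕ.% 10 else 10 + (20 ℕ.∸ c) ℕ.% 10

with-mirror-images : (Side → Dir → Dir → Dir → List ℕ) → Side → Dir → Dir → Dir → List ℕ
with-mirror-images table s bwd da d = map mirrored (table s fwd (mirror da) (mirror d))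
with-mirror-images table s spk bwd d = map mirrored (table s spk fwd (mirror d))
with-mirror-images table s dz da d = table s dz da d

dodecahedral : Side → Dir → Dir → Dir → List ℕ
dodecahedral out fwd bwd bwd = 0 ∷ 9 ∷ 8 ∷ 7 ∷ 6 ∷ 5 ∷ 4 ∷ 3 ∷ 2 ∷ 1 ∷ 10 ∷ 19 ∷ 18 ∷ 17 ∷ 16 ∷ 15 ∷ 14 ∷ 13 ∷ 12 ∷ 11 ∷ []
dodecahedral out fwd bwd spk = 10 ∷ 18 ∷ 8 ∷ 7 ∷ 17 ∷ 15 ∷ 13 ∷ 3 ∷ 2 ∷ 12 ∷ 0 ∷ 16 ∷ 9 ∷ 6 ∷ 19 ∷ 5 ∷ 11 ∷ 4 ∷ 1 ∷ 14 ∷ []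
dodecahedral out fwd spk fwd = 9 ∷ 8 ∷ 18 ∷ 16 ∷ 14 ∷ 4 ∷ 3 ∷ 13 ∷ 11 ∷ 19 ∷ 0 ∷ 7 ∷ 10 ∷ 6 ∷ 12 ∷ 5 ∷ 2 ∷ 15 ∷ 1 ∷ 17 ∷ []
dodecahedral out fwd spk bwd = 0 ∷ 10 ∷ 18 ∷ 16 ∷ 6 ∷ 5 ∷ 15 ∷ 13 ∷ 11 ∷ 1 ∷ 9 ∷ 12 ∷ 8 ∷ 14 ∷ 7 ∷ 4 ∷ 17 ∷ 3 ∷ 19 ∷ 2 ∷ []
dodecahedral out spk fwd fwd = 9 ∷ 19 ∷ 11 ∷ 13 ∷ 3 ∷ 4 ∷ 14 ∷ 16 ∷ 18 ∷ 8 ∷ 0 ∷ 17 ∷ 1 ∷ 15 ∷ 2 ∷ 5 ∷ 12 ∷ 6 ∷ 10 ∷ 7 ∷ []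
dodecahedral out spk fwd spk = 0 ∷ 1 ∷ 11 ∷ 13 ∷ 15 ∷ 5 ∷ 6 ∷ 16 ∷ 18 ∷ 10 ∷ 9 ∷ 2 ∷ 19 ∷ 3 ∷ 17 ∷ 4 ∷ 7 ∷ 14 ∷ 8 ∷ 12 ∷ []
dodecahedral inn fwd bwd bwd = 0 ∷ 9 ∷ 8 ∷ 7 ∷ 6 ∷ 5 ∷ 4 ∷ 3 ∷ 2 ∷ 1 ∷ 10 ∷ 19 ∷ 18 ∷ 17 ∷ 16 ∷ 15 ∷ 14 ∷ 13 ∷ 12 ∷ 11 ∷ []
dodecahedral inn fwd bwd spk = 10 ∷ 18 ∷ 8 ∷ 7 ∷ 17 ∷ 15 ∷ 13 ∷ 3 ∷ 2 ∷ 12 ∷ 0 ∷ 16 ∷ 9 ∷ 6 ∷ 19 ∷ 5 ∷ 11 ∷ 4 ∷ 1 ∷ 14 ∷ []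
dodecahedral inn fwd spk fwd = 18 ∷ 8 ∷ 9 ∷ 19 ∷ 11 ∷ 13 ∷ 3 ∷ 4 ∷ 14 ∷ 16 ∷ 10 ∷ 7 ∷ 0 ∷ 17 ∷ 1 ∷ 15 ∷ 2 ∷ 5 ∷ 12 ∷ 6 ∷ []
dodecahedral inn fwd spk bwd = 10 ∷ 0 ∷ 9 ∷ 19 ∷ 17 ∷ 15 ∷ 5 ∷ 4 ∷ 14 ∷ 12 ∷ 18 ∷ 1 ∷ 8 ∷ 11 ∷ 7 ∷ 13 ∷ 6 ∷ 3 ∷ 16 ∷ 2 ∷ []
dodecahedral inn spk fwd fwd = 10 ∷ 12 ∷ 14 ∷ 4 ∷ 5 ∷ 15 ∷ 17 ∷ 19 ∷ 9 ∷ 0 ∷ 18 ∷ 2 ∷ 16 ∷ 3 ∷ 6 ∷ 13 ∷ 7 ∷ 11 ∷ 8 ∷ 1 ∷ []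
dodecahedral inn spk fwd spk = 18 ∷ 16 ∷ 14 ∷ 4 ∷ 3 ∷ 13 ∷ 11 ∷ 19 ∷ 9 ∷ 8 ∷ 10 ∷ 6 ∷ 12 ∷ 5 ∷ 2 ∷ 15 ∷ 1 ∷ 17 ∷ 0 ∷ 7 ∷ []
dodecahedral _ _ _ _ = []

desarguesian : Side → Dir → Dir → Dir → List ℕ
desarguesian out fwd bwd bwd = 0 ∷ 9 ∷ 8 ∷ 7 ∷ 6 ∷ 5 ∷ 4 ∷ 3 ∷ 2 ∷ 1 ∷ 10 ∷ 19 ∷ 18 ∷ 17 ∷ 16 ∷ 15 ∷ 14 ∷ 13 ∷ 12 ∷ 11 ∷ []
desarguesian out fwd bwd spk = 0 ∷ 9 ∷ 19 ∷ 16 ∷ 6 ∷ 5 ∷ 4 ∷ 14 ∷ 11 ∷ 1 ∷ 10 ∷ 8 ∷ 12 ∷ 13 ∷ 7 ∷ 15 ∷ 3 ∷ 17 ∷ 18 ∷ 2 ∷ []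
desarguesian out fwd spk fwd = 0 ∷ 10 ∷ 13 ∷ 16 ∷ 6 ∷ 5 ∷ 15 ∷ 18 ∷ 11 ∷ 1 ∷ 9 ∷ 17 ∷ 3 ∷ 19 ∷ 7 ∷ 4 ∷ 12 ∷ 8 ∷ 14 ∷ 2 ∷ []
desarguesian out fwd spk bwd = 0 ∷ 10 ∷ 17 ∷ 7 ∷ 6 ∷ 5 ∷ 15 ∷ 12 ∷ 2 ∷ 1 ∷ 9 ∷ 13 ∷ 14 ∷ 8 ∷ 16 ∷ 4 ∷ 18 ∷ 19 ∷ 3 ∷ 11 ∷ []
desarguesian out spk fwd fwd = 0 ∷ 1 ∷ 2 ∷ 12 ∷ 15 ∷ 5 ∷ 6 ∷ 7 ∷ 17 ∷ 10 ∷ 9 ∷ 11 ∷ 3 ∷ 19 ∷ 18 ∷ 4 ∷ 16 ∷ 8 ∷ 14 ∷ 13 ∷ []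
desarguesian out spk fwd spk = 0 ∷ 1 ∷ 11 ∷ 18 ∷ 15 ∷ 5 ∷ 6 ∷ 16 ∷ 13 ∷ 10 ∷ 9 ∷ 2 ∷ 14 ∷ 8 ∷ 12 ∷ 4 ∷ 7 ∷ 19 ∷ 3 ∷ 17 ∷ []
desarguesian inn fwd bwd bwd = 10 ∷ 17 ∷ 14 ∷ 11 ∷ 18 ∷ 15 ∷ 12 ∷ 19 ∷ 16 ∷ 13 ∷ 0 ∷ 7 ∷ 4 ∷ 1 ∷ 8 ∷ 5 ∷ 2 ∷ 9 ∷ 6 ∷ 3 ∷ []
desarguesian inn fwd bwd spk = 10 ∷ 17 ∷ 7 ∷ 8 ∷ 18 ∷ 15 ∷ 12 ∷ 2 ∷ 3 ∷ 13 ∷ 0 ∷ 14 ∷ 6 ∷ 9 ∷ 11 ∷ 5 ∷ 19 ∷ 1 ∷ 4 ∷ 16 ∷ []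
desarguesian inn fwd spk fwd = 10 ∷ 0 ∷ 1 ∷ 11 ∷ 18 ∷ 15 ∷ 5 ∷ 6 ∷ 16 ∷ 13 ∷ 17 ∷ 9 ∷ 2 ∷ 14 ∷ 8 ∷ 12 ∷ 4 ∷ 7 ∷ 19 ∷ 3 ∷ []
desarguesian inn fwd spk bwd = 10 ∷ 0 ∷ 9 ∷ 8 ∷ 18 ∷ 15 ∷ 5 ∷ 4 ∷ 3 ∷ 13 ∷ 17 ∷ 1 ∷ 19 ∷ 7 ∷ 11 ∷ 12 ∷ 6 ∷ 14 ∷ 2 ∷ 16 ∷ []
desarguesian inn spk fwd fwd = 10 ∷ 13 ∷ 16 ∷ 6 ∷ 5 ∷ 15 ∷ 18 ∷ 11 ∷ 1 ∷ 0 ∷ 17 ∷ 3 ∷ 19 ∷ 7 ∷ 4 ∷ 12 ∷ 8 ∷ 14 ∷ 2 ∷ 9 ∷ []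
desarguesian inn spk fwd spk = 10 ∷ 13 ∷ 3 ∷ 4 ∷ 5 ∷ 15 ∷ 18 ∷ 8 ∷ 9 ∷ 0 ∷ 17 ∷ 16 ∷ 2 ∷ 14 ∷ 6 ∷ 12 ∷ 11 ∷ 7 ∷ 19 ∷ 1 ∷ []
desarguesian _ _ _ _ = []

module Ten {k : ℕ} (0<k : 0 < k) (2k<10 : 2 * k < 10) where
  open Congruence 10
  open Petersen 10 k
  open Distances 10 k 0<k 2k<10
  open Finite 0<k 2k<10

  multiple : Side → ℤ → Label
  multiple t m = t , m *ᶻ κ t

  Straightens : Side → List ℕ → Side → Dir → Dir → Dir → Set
  Straightens t cs s dz da d = (tabulated cs (multiple t (-ᶻ + 1)) ~ nbr (s , + 0) dz) × (tabulated cs (multiple t (+ 0)) ~ (s , + 0)) ×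
    (tabulated cs (multiple t (+ 1)) ~ nbr (s , + 0) da) × (tabulated cs (multiple t (+ 2)) ~ nbr (nbr (s , + 0) da) d)

  straightens? : ∀ t cs s dz da d → Dec (Straightens t cs s dz da d)
  straightens? t cs s dz da d = (_ ~? _) ×-dec (_ ~? _) ×-dec (_ ~? _) ×-dec (_ ~? _)

  Table : Set
  Table = Side → Dir → Dir → Dir → List ℕ

  Complete : (Side → Set) → Table → Set
  Complete Rim table = ∀ s dz da d → dz ≢ da → ¬ nbr (nbr (s , + 0) da) d ~ (s , + 0) →
                       let cs = table s dz da d in Symmetric cs × ∃ λ t → Rim t × Straightens t cs s dz da d

  any-Side? : ∀ {P : Side → Set} → (∀ s → Dec (P s)) → Dec (∃ P)
  any-Side? P? = map′ [ out ,_ , inn ,_ ]′ (λ { (out , p) → inj₁ p ; (inn , p) → inj₂ p }) (P? out ⊎-dec P? inn)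

  complete? : ∀ {Rim} → (∀ t → Dec (Rim t)) → ∀ table → Dec (Complete Rim table)
  complete? rim? table = all-Side? λ s → all-Dir? λ dz → all-Dir? λ da → all-Dir? λ d →
    ¬? (dz ≟ᵈ da) →-dec (¬? (_ ~? _) →-dec (symmetric? _ ×-dec any-Side? λ t → rim? t ×-dec straightens? t _ s dz da d))

  -- The path `z`, `e`, `a`, `a ∙ a` is non-backtracking since a² is not `e`; a symmetry of the
  -- graph lays it along a rim.
  record Straight (t : Side) : Set₁ where
    field R : UnitRep 10 k
    open UnitRep R
    field
      z≡  : z ≡ P (multiple t (-ᶻ + 1))
      e≡  : e ≡ P (multiple t (+ 0))
      a≡  : a ≡ P (multiple t (+ 1))
      aa≡ : a ∙ a ≡ P (multiple t (+ 2))

  straighten : ∀ {Rim table} → Complete Rim table → UnitRep 10 k → ∃ λ t → Rim t × Straight t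
  straighten {Rim} {table} complete R with centred R
  ... | s , R₀ , e≡₀ = directions (nbr-of-e e≡₀ e-z) (nbr-of-e e≡₀ e-a)
    where
    open UnitRep R₀
    open Core 0<k 2k<10 R₀
    directions : (∃ λ d → z ≡ P (nbr (s , + 0) d)) → (∃ λ d → a ≡ P (nbr (s , + 0) d)) → ∃ λ t → Rim t × Straight t
    directions (dz , z≡) (da , a≡) =
      walk (adj⇒ (subst (λ x → Adj x (a ∙ a)) a≡ (subst (λ x → Adj x (a ∙ a)) (∙e a) (a∙-adj e-a))))
      where
      walk : (∃ λ d → a ∙ a ≡ P (nbr (nbr (s , + 0) da) d)) → ∃ λ t → Rim t × Straight t
      walk (d , aa≡) with complete s dz da d (λ { refl → z≢a (trans z≡ (sym a≡)) })
                                             (λ back → aa≢e (trans aa≡ (trans (~-P lab back) (sym e≡₀))))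
      ... | sym-cs , t , rim , τz , τe , τa , τaa = t , rim , record
        { R   = with-labelling R₀ (relabel (symmetry (table s dz da d) sym-cs) lab)
        ; z≡  = trans z≡ (sym (~-P lab τz))
        ; e≡  = trans e≡₀ (sym (~-P lab τe))
        ; a≡  = trans a≡ (sym (~-P lab τa))
        ; aa≡ = trans aa≡ (sym (~-P lab τaa)) }

  -- The image of a² is a³, and its direction `f` is the one datum left open: `fwd` stays on the
  -- rim, `spk` leaves it, and `bwd` would mean a³ = a.
  known : Side → Dir → List (Label × Label)
  known t f = (multiple t (+ 2) , nbr (multiple t (+ 2)) f) ∷ (multiple t (+ 1) , multiple t (+ 2)) ∷
              (multiple t (+ 0) , multiple t (+ 1)) ∷ (multiple t (-ᶻ + 1) , multiple t (+ 0)) ∷ []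

  module _ {t : Side} (straight : Straight t) where
    open Straight straight
    open UnitRep R
    open Core 0<k 2k<10 R

    αz : a ∙ P (multiple t (-ᶻ + 1)) ≡ P (multiple t (+ 0))
    αz = trans (cong (a ∙_) (sym z≡)) (trans az≡e e≡)

    αe : a ∙ P (multiple t (+ 0)) ≡ P (multiple t (+ 1))
    αe = trans (cong (a ∙_) (sym e≡)) (trans (∙e a) a≡)

    αa : a ∙ P (multiple t (+ 1)) ≡ P (multiple t (+ 2))
    αa = trans (cong (a ∙_) (sym a≡)) aa≡

    open Propagation lab (a ∙_) cancelˡ a∙-adj public using (Known; translation; not-stuck; image-of)

    fourth : ∃ λ f → All Known (known t f)
    fourth = f , αaa ∷ αa ∷ αe ∷ αz ∷ []
      where
      next : ∀ κ → + 1 *ᶻ κ +ᶻ κ ≡ + 2 *ᶻ κ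
      next = solve-∀
      image₂ : ∃ λ f → a ∙ P (nbr (multiple t (+ 1)) fwd) ≡ P (nbr (multiple t (+ 2)) f)
      image₂ = image {multiple t (+ 1)} {multiple t (+ 2)} fwd αa
      f : Dir
      f = proj₁ image₂
      αaa : a ∙ P (multiple t (+ 2)) ≡ P (nbr (multiple t (+ 2)) f)
      αaa = trans (cong (a ∙_) (P-≡ lab t (sym (next (κ t))))) (proj₂ image₂)

    b-spoke : b ≡ P (flip t , + 0)
    b-spoke = b-nbr e≡ spk (λ eq → sides-disjoint lab (trans (sym a≡) eq)) (λ eq → sides-disjoint lab (trans (sym z≡) eq))

    translation⇒good : All Known (known t fwd) → Moves (known t fwd) (shift (κ t)) → Good 10 k
    translation⇒good ok moved = rotation⇒good 0<k 2k<10 R record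
      { s = t ; K = κ t ; K≡ = inj₁ refl ; e≡ = e≡ ; b≡ = b-spoke
      ; rot = translation (known t fwd) (κ t) ok moved }

    contradictory : ∀ f → Stuck (known t f) → ¬ All Known (known t f)
    contradictory f is-stuck ok = not-stuck (known t f) ok is-stuck

0<2 : 0 < 2
0<2 = s≤s z≤n

4<10 : 2 * 2 < 10
4<10 = from-yes (4 ℕ.<? 10)

0<3 : 0 < 3
0<3 = s≤s z≤n

6<10 : 2 * 3 < 10
6<10 = from-yes (6 ℕ.<? 10)

-- Paths of length three in the dodecahedron form two orbits, according to whether they lie on a
-- face: those on inner rims do, those on the outer rim do not, so both rims are needed as models.
-- The Desargues graph is 3-arc-transitive, hence `OuterRim` serves there.
data AnyRim : Side → Set where
  any : ∀ {t} → AnyRim t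

data OuterRim : Side → Set where
  out : OuterRim out

dodecahedral-complete : Ten.Complete 0<2 4<10 AnyRim (with-mirror-images dodecahedral)
dodecahedral-complete = from-yes (Ten.complete? 0<2 4<10 (λ _ → yes any) (with-mirror-images dodecahedral))

module Dodecahedral where
  open Petersen 10 2
  open Finite 0<2 4<10
  open Ten 0<2 4<10

  translations : ∀ t → Moves (known t fwd) (shift (κ t))
  translations out = from-yes (moves? (known out fwd) (shift (+ 1)))
  translations inn = from-yes (moves? (known inn fwd) (shift (+ 2)))

  stuck-bwd : ∀ t → Stuck (known t bwd)
  stuck-bwd out = from-yes (stuck? (known out bwd))
  stuck-bwd inn = from-yes (stuck? (known inn bwd))

  stuck-spk : ∀ t → Stuck (known t spk)
  stuck-spk out = from-yes (stuck? (known out spk))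
  stuck-spk inn = from-yes (stuck? (known inn spk))

not-dodecahedral : ¬ UnitRep 10 2
not-dodecahedral R = by-straight (Ten.straighten 0<2 4<10 dodecahedral-complete R)
  where
  open Dodecahedral
  open Ten 0<2 4<10
  by-straight : (∃ λ t → AnyRim t × Straight t) → ⊥
  by-straight (t , _ , straight) = by-direction (fourth straight)
    where
    by-direction : (∃ λ f → All (Known straight) (known t f)) → ⊥
    by-direction (fwd , ok) = from-no (good? 10 2) (translation⇒good straight ok (translations t))
    by-direction (bwd , ok) = contradictory straight bwd (stuck-bwd t) ok
    by-direction (spk , ok) = contradictory straight spk (stuck-spk t) ok

desarguesian-complete : Ten.Complete 0<3 6<10 OuterRim (with-mirror-images desarguesian)
desarguesian-complete = from-yes (Ten.complete? 0<3 6<10 (λ { out → yes out ; inn → no λ () }) (with-mirror-images desarguesian))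

module Desarguesian where
  open Congruence 10
  open Petersen 10 3
  open Distances 10 3 0<3 6<10
  open Finite 0<3 6<10 hiding (nonZero)
  open Ten 0<3 6<10

  -- The rotation by one step of the hexagon u₉ u₀ u₁ u₂ v₂ v₉, which contains the first four powers
  -- of `a` starting from `z`.
  hexagonal : Label → Label
  hexagonal = tabulated (1 ∷ 2 ∷ 12 ∷ 15 ∷ 5 ∷ 6 ∷ 7 ∷ 17 ∷ 10 ∷ 0 ∷ 11 ∷ 3 ∷ 19 ∷ 18 ∷ 4 ∷ 16 ∷ 8 ∷ 14 ∷ 13 ∷ 9 ∷ [])

  moves-fwd : Moves (known out fwd) (shift (+ 1))
  moves-fwd = from-yes (moves? (known out fwd) (shift (+ 1)))

  moves-spk : Moves (known out spk) hexagonal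
  moves-spk = from-yes (moves? (known out spk) hexagonal)

  stuck-bwd : Stuck (known out bwd)
  stuck-bwd = from-yes (stuck? (known out bwd))

  -- Left multiplication by a rotates a hexagon, its neighbours v₀, v₁, u₃, v₅, v₆, u₈, and the opposite hexagon
  -- v₇, v₄, u₄, u₅, u₆, u₇; it exchanges the two remaining vertices v₃ and v₈.
  module Hexagon (straight : Straight out) (ok : All (Known straight) (known out spk)) where
    open Straight straight
    open UnitRep R
    open Core 0<3 6<10 R hiding (nonZero)

    U V : ℕ → M
    U i = P (out , + i)
    V i = P (inn , + i)

    α : ∀ s i → {True (i ℕ.<? 10)} → a ∙ P (s , + i) ≡ P (hexagonal (s , + i))
    α s i {i<10} = image-of straight (known out spk) hexagonal ok moves-spk s (toWitness i<10)

    b≡ : b ≡ V 0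
    b≡ = b-spoke straight

    same : ∀ l m → {True (l ~? m)} → P l ≡ P m
    same l m {l~m} = ~-P lab (toWitness l~m)

    differ : ∀ l m → {True (¬? (l ~? m))} → P l ≢ P m
    differ l m {l≁m} = toWitness l≁m ∘ P-inj

    back : ∀ {x y x′ y′ c} → a ∙ x ≡ x′ → a ∙ y ≡ y′ → x′ ∙ c ≡ y′ → x ∙ c ≡ y
    back {x} {c = c} ax ay eq = cancelˡ (trans (sym (assoc a x c)) (trans (cong (_∙ c) ax) (trans eq (sym ay))))

    forth : ∀ {x y x′ y′ c} → a ∙ x ≡ x′ → a ∙ y ≡ y′ → x ∙ c ≡ y → x′ ∙ c ≡ y′
    forth {x} {c = c} ax ay eq = trans (cong (_∙ c) (sym ax)) (trans (assoc a x c) (trans (cong (a ∙_) eq) ay))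

    _∈~_ : Label → List Label → Set
    l ∈~ S = Any (l ~_) S

    _∈~?_ : ∀ l S → Dec (l ∈~ S)
    l ∈~? S = Any.any? (l ~?_) S

    ∈~-resp : ∀ {l m S} → l ~ m → l ∈~ S → m ∈~ S
    ∈~-resp l~m = Any.map (~-trans (~-sym l~m))

    Entrances : List Label → List (Label × Label) → Set
    Entrances S gates = Each λ m → ∀ d → ¬ m ∈~ S → nbr m d ∈~ S → Any (λ g → m ~ proj₁ g × nbr m d ~ proj₂ g) gates

    entrances? : ∀ S gates → Dec (Entrances S gates)
    entrances? S gates = each? λ m → all-Dir? λ d → ¬? (m ∈~? S) →-dec (nbr m d ∈~? S →-dec
      Any.any? (λ g → (m ~? proj₁ g) ×-dec (nbr m d ~? proj₂ g)) gates)

    Entered : List (Label × Label) → Set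
    Entered gates = Any (λ g → ∃ λ c → InC a b c × P (proj₁ g) ∙ c ≡ P (proj₂ g)) gates

    -- Starting from `e` outside `S`, a product of generators that lies in `S` uses an arc through
    -- one of the `gates`.
    entered : ∀ S gates → Entrances S gates → ¬ (out , + 0) ∈~ S → ∀ l → l ∈~ S → Entered gates
    entered S gates entrances e∉S l l∈S = path (generated (P l)) l refl l∈S
      where
      path : ∀ {x} → Gen _∙_ e a b x → ∀ l → x ≡ P l → l ∈~ S → Entered gates
      path gen-ε l eq l∈S = contradiction (∈~-resp (P-inj (trans (sym eq) e≡)) l∈S) e∉S
      path (gen-∙ {x} {c} gx c∈C) l eq l∈S with cover x
      ... | m , refl with m ∈~? S
      ...   | yes m∈S = path gx m refl m∈S
      ...   | no m∉S with move m c∈C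
      ...     | inj₁ stay = contradiction (∈~-resp (P-inj (trans (sym eq) stay)) l∈S) m∉S
      ...     | inj₂ (d , hop) = Any.map gate (entrances (proj₁ m) (residue<n (proj₂ m)) d
                  (m∉S ∘ ∈~-resp (~-sym m~r)) (∈~-resp (~-trans (P-inj (trans (sym eq) hop)) (~-nbr d m~r)) l∈S))
        where
        r : Label
        r = proj₁ m , + residue (proj₂ m)
        m~r : m ~ r
        m~r = refl , ≋-residue (proj₂ m)
        gate : ∀ {g} → r ~ proj₁ g × nbr r d ~ proj₂ g → ∃ λ c → InC a b c × P (proj₁ g) ∙ c ≡ P (proj₂ g)
        gate (near , far) = c , c∈C , trans (cong (_∙ c) (sym (~-P lab (~-trans m~r near))))
          (trans hop (~-P lab (~-trans (~-nbr d m~r) far)))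

    v₃-gates : List (Label × Label)
    v₃-gates = ((inn , + 0) , (inn , + 3)) ∷ ((out , + 3) , (inn , + 3)) ∷ ((inn , + 6) , (inn , + 3)) ∷ []

    -- Left multiplication by a² fixes v₃ and permutes its neighbours v₀, u₃, v₆ cyclically, so an
    -- arc into v₃ can be moved to one from v₀, which is `b`.
    to-v₃ : ∃ λ c → InC a b c × b ∙ c ≡ V 3
    to-v₃ = by-gate (entered ((inn , + 3) ∷ []) v₃-gates (from-yes (entrances? ((inn , + 3) ∷ []) v₃-gates))
      (from-no ((out , + 0) ∈~? ((inn , + 3) ∷ []))) (inn , + 3) (here (~-reflexive refl)))
      where
      from-u₃ : ∀ {c} → U 3 ∙ c ≡ V 3 → V 0 ∙ c ≡ V 3
      from-u₃ = back (α inn 0) (α inn 3) ∘ back (α inn 1) (α inn 8)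
      from-v₆ : ∀ {c} → V 6 ∙ c ≡ V 3 → U 3 ∙ c ≡ V 3
      from-v₆ = back (α out 3) (α inn 3) ∘ back (α inn 5) (α inn 8)
      by-gate : Entered v₃-gates → ∃ λ c → InC a b c × b ∙ c ≡ V 3
      by-gate (here (c , c∈C , eq)) = c , c∈C , trans (cong (_∙ c) b≡) eq
      by-gate (there (here (c , c∈C , eq))) = c , c∈C , trans (cong (_∙ c) b≡) (from-u₃ eq)
      by-gate (there (there (here (c , c∈C , eq)))) = c , c∈C , trans (cong (_∙ c) b≡) (from-u₃ (from-v₆ eq))

    bb : b ∙ a ≢ V 3 → b ∙ b ≡ V 3
    bb ba≢v₃ with to-v₃
    ... | _ , inj₁ refl , eq = contradiction eq ba≢v₃
    ... | _ , inj₂ refl , eq = eq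

    opposite : List Label
    opposite = (inn , + 7) ∷ (inn , + 4) ∷ (out , + 4) ∷ (out , + 5) ∷ (out , + 6) ∷ (out , + 7) ∷ []

    opposite-gates : List (Label × Label)
    opposite-gates = ((inn , + 0) , (inn , + 7)) ∷ ((inn , + 1) , (inn , + 4)) ∷ ((out , + 3) , (out , + 4)) ∷
                     ((inn , + 5) , (out , + 5)) ∷ ((inn , + 6) , (out , + 6)) ∷ ((out , + 8) , (out , + 7)) ∷ []

    -- The six edges that enter the opposite hexagon are permuted cyclically by `a`, so an arc along
    -- one of them can be moved to the one at `b`.
    to-v₇ : ∃ λ c → InC a b c × b ∙ c ≡ V 7
    to-v₇ = by-gate (entered opposite opposite-gates (from-yes (entrances? opposite opposite-gates))
      (from-no ((out , + 0) ∈~? opposite)) (inn , + 7) (here (~-reflexive refl)))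
      where
      g₁ : ∀ {c} → V 1 ∙ c ≡ V 4 → V 0 ∙ c ≡ V 7
      g₁ = back (α inn 0) (α inn 7)
      g₂ : ∀ {c} → U 3 ∙ c ≡ U 4 → V 0 ∙ c ≡ V 7
      g₂ = g₁ ∘ back (α inn 1) (α inn 4)
      g₃ : ∀ {c} → V 5 ∙ c ≡ U 5 → V 0 ∙ c ≡ V 7
      g₃ = g₂ ∘ back (α out 3) (α out 4)
      g₄ : ∀ {c} → V 6 ∙ c ≡ U 6 → V 0 ∙ c ≡ V 7
      g₄ = g₃ ∘ back (α inn 5) (α out 5)
      g₅ : ∀ {c} → U 8 ∙ c ≡ U 7 → V 0 ∙ c ≡ V 7
      g₅ = g₄ ∘ back (α inn 6) (α out 6)
      by-gate : Entered opposite-gates → ∃ λ c → InC a b c × b ∙ c ≡ V 7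
      by-gate (here (c , c∈C , eq)) = c , c∈C , trans (cong (_∙ c) b≡) eq
      by-gate (there (here (c , c∈C , eq))) = c , c∈C , trans (cong (_∙ c) b≡) (g₁ eq)
      by-gate (there (there (here (c , c∈C , eq)))) = c , c∈C , trans (cong (_∙ c) b≡) (g₂ eq)
      by-gate (there (there (there (here (c , c∈C , eq))))) = c , c∈C , trans (cong (_∙ c) b≡) (g₃ eq)
      by-gate (there (there (there (there (here (c , c∈C , eq)))))) = c , c∈C , trans (cong (_∙ c) b≡) (g₄ eq)
      by-gate (there (there (there (there (there (here (c , c∈C , eq))))))) = c , c∈C , trans (cong (_∙ c) b≡) (g₅ eq)

    -- a² fixes v₃ but not b.
    ba≢v₃ : b ∙ a ≢ V 3
    ba≢v₃ ba≡ = differ (out , + 3) (inn , + 0) (cancelʳ (trans u₃a (sym v₀a)))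
      where
      v₀a : V 0 ∙ a ≡ V 3
      v₀a = trans (cong (_∙ a) (sym b≡)) ba≡
      u₃a : U 3 ∙ a ≡ V 3
      u₃a = forth (α inn 1) (α inn 8) (forth (α inn 0) (α inn 3) v₀a)

    bb≡v₃ : b ∙ b ≡ V 3
    bb≡v₃ = bb ba≢v₃

    ba≡v₇ : b ∙ a ≡ V 7
    ba≡v₇ with to-v₇
    ... | _ , inj₁ refl , eq = eq
    ... | _ , inj₂ refl , eq = contradiction (trans (sym bb≡v₃) eq) (differ (inn , + 3) (inn , + 7))

    -- The vertex `b ∙ z` has an `a`-arc to `b`. If it were v₃, applying a² would give v₃ a second
    -- value under `a`; if it were `e`, then `a` and `b` would coincide.
    v₇a : V 7 ∙ a ≡ V 0
    v₇a = by-nbr (adj⇒ (subst (λ x → Adj x (b ∙ z)) b≡ (b≢bz , a , inj₁ refl , inj₂ (sym (∙z∙a b)))))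
      where
      b≢bz : b ≢ b ∙ z
      b≢bz eq = differ (inn , + 7) (inn , + 0) (trans (sym ba≡v₇) (trans (trans (cong (_∙ a) eq) (∙z∙a b)) b≡))
      bza : ∀ {x} → b ∙ z ≡ x → x ∙ a ≡ V 0
      bza eq = trans (cong (_∙ a) (sym eq)) (trans (∙z∙a b) b≡)
      by-nbr : (∃ λ d → b ∙ z ≡ P (nbr (inn , + 0) d)) → V 7 ∙ a ≡ V 0
      by-nbr (fwd , eq) = contradiction
        (trans (sym (bza eq)) (forth (α inn 8) (α inn 1) (forth (α inn 3) (α inn 0) (bza eq))))
        (differ (inn , + 0) (out , + 3))
      by-nbr (bwd , eq) = bza (trans eq (same (nbr (inn , + 0) bwd) (inn , + 7)))
      by-nbr (spk , eq) = contradiction (trans (sym (e∙ a)) (trans (bza (trans eq (sym e≡))) (sym b≡))) a≢b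

    v₄a : V 4 ∙ a ≡ V 1
    v₄a = forth (α inn 7) (α inn 0) v₇a

    u₄a : U 4 ∙ a ≡ U 3
    u₄a = forth (α inn 4) (α inn 1) v₄a

    u₆a : U 6 ∙ a ≡ V 6
    u₆a = forth (α out 5) (α inn 5) (forth (α out 4) (α out 3) u₄a)

    u₇a : U 7 ∙ a ≡ U 8
    u₇a = forth (α out 6) (α inn 6) u₆a

    -- Each of the three neighbours of v₃ already receives an `a`-arc, from u₆, v₇ or u₄.
    v₃a : V 3 ∙ a ≡ V 3
    v₃a = by-move (move (inn , + 3) (inj₁ refl))
      where
      by-move : V 3 ∙ a ≡ V 3 ⊎ (∃ λ d → V 3 ∙ a ≡ P (nbr (inn , + 3) d)) → V 3 ∙ a ≡ V 3
      by-move (inj₁ stay) = stay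
      by-move (inj₂ (fwd , eq)) = contradiction (cancelʳ (trans eq (sym u₆a))) (differ (inn , + 3) (out , + 6))
      by-move (inj₂ (bwd , eq)) = contradiction (cancelʳ (trans eq (sym v₇a))) (differ (inn , + 3) (inn , + 7))
      by-move (inj₂ (spk , eq)) = contradiction (cancelʳ (trans eq (sym u₄a))) (differ (inn , + 3) (out , + 4))

    -- The edge between v₇ and v₄ cannot be an `a`-arc. If it is a `b`-arc into v₇, rotating it back
    -- makes it leave v₇ for u₇.
    v₇b : V 7 ∙ b ≡ V 4 ⊎ V 7 ∙ b ≡ U 7
    v₇b with arc (inn , + 7) bwd
    ... | _ , inj₁ refl , inj₁ eq = contradiction (trans (sym v₇a) eq) (differ (inn , + 0) (inn , + 4))
    ... | _ , inj₂ refl , inj₁ eq = inj₁ eq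
    ... | _ , inj₁ refl , inj₂ eq = contradiction (trans (sym v₄a) eq) (differ (inn , + 1) (inn , + 7))
    ... | _ , inj₂ refl , inj₂ eq = inj₂ (back (α inn 7) (α out 7) eq)

    v₇v₇ : V 7 ∙ V 7 ≡ (V 7 ∙ b) ∙ a
    v₇v₇ = trans (cong (V 7 ∙_) (sym ba≡v₇)) (sym (assoc _ b a))

    v₃b : V 3 ∙ b ≡ b ∙ (V 7 ∙ b)
    v₃b = begin
      V 3 ∙ b ≡⟨ cong (_∙ b) (sym v₃a) ⟩
      (V 3 ∙ a) ∙ b ≡⟨ cong (λ x → (x ∙ a) ∙ b) (sym bb≡v₃) ⟩
      ((b ∙ b) ∙ a) ∙ b ≡⟨ cong (_∙ b) (trans (assoc b b a) (cong (b ∙_) ba≡v₇)) ⟩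
      (b ∙ V 7) ∙ b ≡⟨ assoc b _ b ⟩
      b ∙ (V 7 ∙ b) ∎
      where open ≡-Reasoning

    forth² : ∀ {x} → V 3 ∙ b ≡ x → V 3 ∙ b ≡ a ∙ (a ∙ x)
    forth² eq = forth (α inn 8) refl (forth (α inn 3) refl eq)

    -- Either way v₇ b is a v₇ or z v₇, and both b a and b z are v₇. Hence v₃ b = v₇ v₇ = v₇ b a,
    -- which is v₁ or u₈. But v₃ b is fixed by a², since v₃ is, while v₁ and u₈ are not.
    impossible : ⊥
    impossible = [ ahead , behind ]′ v₇b
      where
      ahead : V 7 ∙ b ≡ V 4 → ⊥
      ahead eq = differ (inn , + 1) (inn , + 5) (trans (sym v₃b≡v₁) (trans (forth² v₃b≡v₁)
          (trans (cong (a ∙_) (α inn 1)) (α out 3))))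
        where
        v₃b≡v₁ : V 3 ∙ b ≡ V 1
        v₃b≡v₁ = begin
          V 3 ∙ b ≡⟨ trans v₃b (cong (b ∙_) (trans eq (sym (α inn 7)))) ⟩
          b ∙ (a ∙ V 7) ≡⟨ trans (sym (assoc b a _)) (cong (_∙ V 7) ba≡v₇) ⟩
          V 7 ∙ V 7 ≡⟨ trans v₇v₇ (cong (_∙ a) eq) ⟩
          V 4 ∙ a ≡⟨ v₄a ⟩
          V 1 ∎
          where open ≡-Reasoning
      behind : V 7 ∙ b ≡ U 7 → ⊥
      behind eq = differ (out , + 8) (inn , + 1) (trans (sym v₃b≡u₈) (trans (forth² v₃b≡u₈)
          (trans (cong (a ∙_) (α out 8)) (α inn 0))))
        where
        bz≡v₇ : b ∙ z ≡ V 7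
        bz≡v₇ = trans (cong (_∙ z) (trans b≡ (sym v₇a))) (∙a∙z (V 7))
        zv₇ : z ∙ V 7 ≡ U 7
        zv₇ = trans (cong (z ∙_) (sym (α out 7))) (z∙a∙ (U 7))
        v₃b≡u₈ : V 3 ∙ b ≡ U 8
        v₃b≡u₈ = begin
          V 3 ∙ b ≡⟨ trans v₃b (cong (b ∙_) (trans eq (sym zv₇))) ⟩
          b ∙ (z ∙ V 7) ≡⟨ trans (sym (assoc b z _)) (cong (_∙ V 7) bz≡v₇) ⟩
          V 7 ∙ V 7 ≡⟨ trans v₇v₇ (cong (_∙ a) eq) ⟩
          U 7 ∙ a ≡⟨ u₇a ⟩
          U 8 ∎
          where open ≡-Reasoning

not-desarguesian : ¬ UnitRep 10 3
not-desarguesian R = by-straight (Ten.straighten 0<3 6<10 desarguesian-complete R)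
  where
  open Desarguesian
  open Ten 0<3 6<10
  by-straight : (∃ λ t → OuterRim t × Straight t) → ⊥
  by-straight (out , out , straight) = by-direction (fourth straight)
    where
    by-direction : (∃ λ f → All (Known straight) (known out f)) → ⊥
    by-direction (fwd , ok) = from-no (good? 10 3) (translation⇒good straight ok moves-fwd)
    by-direction (bwd , ok) = contradictory straight bwd stuck-bwd ok
    by-direction (spk , ok) = Hexagon.impossible straight ok

-- Monoids that represent the graphs

GPAdj-sym : ∀ {n k x y} → GPAdj n k x y → GPAdj n k y x
GPAdj-sym (outer c) = outer′ c
GPAdj-sym (outer′ c) = outer c
GPAdj-sym (inner c) = inner′ c
GPAdj-sym (inner′ c) = inner c
GPAdj-sym (spoke i) = spoke′ i
GPAdj-sym (spoke′ i) = spoke i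

-- The semidirect product of ℤ/n by the monoid {1 , b}, where b acts as multiplication by l:
-- u i and v i stand for (i , 1) and (i , b), and side is the rim of b².
module Semidirect {n k : ℕ} (0<k : 0 < k) (2k<n : 2 * k < n) (l : ℤ) (side : Side) where
  open Congruence n
  open Petersen n k
  open Distances n k 0<k 2k<n

  instance
    nonZero : NonZero n
    nonZero = n≢0

  open Vertices n k

  act : Side → ℤ → ℤ
  act out j = j
  act inn j = l *ᶻ j

  _·_ : Side → Side → Side
  out · t = t
  inn · out = inn
  inn · inn = side

  label : PVertex n → Label
  label (u f) = out , + toℕ f
  label (v f) = inn , + toℕ f

  vertex-label : ∀ x → vertex (label x) ≡ x
  vertex-label (u f) = cong u (sym (modFin-unique (≡⇒≋ refl)))
  vertex-label (v f) = cong v (sym (modFin-unique (≡⇒≋ refl)))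

  _⊙_ : Label → Label → Label
  (s , i) ⊙ (t , j) = s · t , i +ᶻ act s j

  infixl 7 _∙_
  _∙_ : PVertex n → PVertex n → PVertex n
  x ∙ y = vertex (label x ⊙ label y)

  act-cong : ∀ s {i j} → i ≋ j → act s i ≋ act s j
  act-cong out i≋j = i≋j
  act-cong inn {i} {j} = linear l (lemma l i j)
    where
    lemma : ∀ l i j → l *ᶻ i -ᶻ l *ᶻ j ≡ l *ᶻ (i -ᶻ j)
    lemma = solve-∀

  +-cong-≋ : ∀ {i i′ j j′} → i ≋ i′ → j ≋ j′ → i +ᶻ j ≋ i′ +ᶻ j′
  +-cong-≋ {i} {i′} {j} {j′} = linear₂ (+ 1) (+ 1) (lemma i i′ j j′)
    where
    lemma : ∀ i i′ j j′ → (i +ᶻ j) -ᶻ (i′ +ᶻ j′) ≡ + 1 *ᶻ (i -ᶻ i′) +ᶻ + 1 *ᶻ (j -ᶻ j′)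
    lemma = solve-∀

  +-congˡ-≋ : ∀ i {j j′} → j ≋ j′ → i +ᶻ j ≋ i +ᶻ j′
  +-congˡ-≋ i = +-cong-≋ (≡⇒≋ {i} refl)

  label-vertex : ∀ s i → ∃ λ i′ → label (vertex (s , i)) ≡ (s , i′) × i ≋ i′
  label-vertex out i = _ , refl , modFin-≋ i
  label-vertex inn i = _ , refl , modFin-≋ i

  vertex-∙ : ∀ s i t j → vertex (s , i) ∙ vertex (t , j) ≡ vertex (s · t , i +ᶻ act s j)
  vertex-∙ s i t j with label-vertex s i | label-vertex t j
  ... | i′ , eq , i≋i′ | j′ , eq′ , j≋j′ rewrite eq | eq′ =
    vertex-cong {s · t} {i′ +ᶻ act s j′} {i +ᶻ act s j} (+-cong-≋ (≋-sym i≋i′) (act-cong s (≋-sym j≋j′)))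

  module _ (l² : ∀ j → act inn (act inn j) ≋ act side j) (l≋k : l ≋ + k ⊎ l ≋ -ᶻ + k) where

    act-· : ∀ s t j → act (s · t) j ≋ act s (act t j)
    act-· out t j = ≡⇒≋ refl
    act-· inn out j = ≡⇒≋ refl
    act-· inn inn j = ≋-sym (l² j)

    act-+ : ∀ s i j → act s (i +ᶻ j) ≡ act s i +ᶻ act s j
    act-+ out i j = refl
    act-+ inn i j = ℤ.*-distribˡ-+ l i j

    ·-assoc : ∀ s t r → (s · t) · r ≡ s · (t · r)
    ·-assoc out t r = refl
    ·-assoc inn out r = refl
    ·-assoc inn inn out = ·-identityʳ side
      where
      ·-identityʳ : ∀ s → s · out ≡ s
      ·-identityʳ out = refl
      ·-identityʳ inn = refl
    ·-assoc inn inn inn = commutes side refl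
      where
      commutes : ∀ s → side ≡ s → s · inn ≡ inn · s
      commutes out _ = refl
      commutes inn _ = refl

    ∙-assoc : ∀ x y w → (x ∙ y) ∙ w ≡ x ∙ (y ∙ w)
    ∙-assoc x y w = begin
      (x ∙ y) ∙ w ≡⟨ cong (x ∙ y ∙_) (sym (vertex-label w)) ⟩
      vertex (s · t , i +ᶻ act s j) ∙ vertex (r , h) ≡⟨ vertex-∙ (s · t) (i +ᶻ act s j) r h ⟩
      vertex ((s · t) · r , (i +ᶻ act s j) +ᶻ act (s · t) h)
        ≡⟨ cong (λ q → vertex (q , (i +ᶻ act s j) +ᶻ act (s · t) h)) (·-assoc s t r) ⟩
      vertex (s · (t · r) , (i +ᶻ act s j) +ᶻ act (s · t) h)
        ≡⟨ vertex-cong {s · (t · r)} (≋-trans (+-congˡ-≋ (i +ᶻ act s j) (act-· s t h))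
             (≡⇒≋ (trans (ℤ.+-assoc i (act s j) (act s (act t h))) (cong (i +ᶻ_) (sym (act-+ s j (act t h))))))) ⟩
      vertex (s · (t · r) , i +ᶻ act s (j +ᶻ act t h)) ≡⟨ sym (vertex-∙ s i (t · r) (j +ᶻ act t h)) ⟩
      vertex (s , i) ∙ vertex (t · r , j +ᶻ act t h) ≡⟨ cong (_∙ (y ∙ w)) (vertex-label x) ⟩
      x ∙ (y ∙ w) ∎
      where
      open ≡-Reasoning
      s t r : Side
      s = proj₁ (label x)
      t = proj₁ (label y)
      r = proj₁ (label w)
      i j h : ℤ
      i = proj₂ (label x)
      j = proj₂ (label y)
      h = proj₂ (label w)

    e c₁ c₂ : PVertex n
    e = vertex (out , + 0)
    c₁ = vertex (out , + 1)
    c₂ = vertex (inn , + 0)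

    act-0 : ∀ s → act s (+ 0) ≡ + 0
    act-0 out = refl
    act-0 inn = ℤ.*-zeroʳ l

    e∙ : ∀ x → e ∙ x ≡ x
    e∙ x = begin
      e ∙ x ≡⟨ cong (e ∙_) (sym (vertex-label x)) ⟩
      e ∙ vertex (s , i) ≡⟨ vertex-∙ out (+ 0) s i ⟩
      vertex (s , + 0 +ᶻ i) ≡⟨ cong (λ i → vertex (s , i)) (ℤ.+-identityˡ i) ⟩
      vertex (s , i) ≡⟨ vertex-label x ⟩
      x ∎
      where
      open ≡-Reasoning
      s : Side
      s = proj₁ (label x)
      i : ℤ
      i = proj₂ (label x)

    ∙e : ∀ x → x ∙ e ≡ x
    ∙e x = begin
      x ∙ e ≡⟨ cong (_∙ e) (sym (vertex-label x)) ⟩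
      vertex (s , i) ∙ e ≡⟨ vertex-∙ s i out (+ 0) ⟩
      vertex (s · out , i +ᶻ act s (+ 0)) ≡⟨ cong₂ (λ t j → vertex (t , j)) (·-out s)
                                                (trans (cong (i +ᶻ_) (act-0 s)) (ℤ.+-identityʳ i)) ⟩
      vertex (s , i) ≡⟨ vertex-label x ⟩
      x ∎
      where
      open ≡-Reasoning
      s : Side
      s = proj₁ (label x)
      i : ℤ
      i = proj₂ (label x)
      ·-out : ∀ s → s · out ≡ s
      ·-out out = refl
      ·-out inn = refl

    ∙c₁-out : ∀ i → vertex (out , i) ∙ c₁ ≡ vertex (out , i +ᶻ + 1)
    ∙c₁-out i = vertex-∙ out i out (+ 1)

    ∙c₁-inn : ∀ i → vertex (inn , i) ∙ c₁ ≡ vertex (inn , i +ᶻ l)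
    ∙c₁-inn i = trans (vertex-∙ inn i out (+ 1)) (cong (λ j → vertex (inn , i +ᶻ j)) (ℤ.*-identityʳ l))

    ∙c₂-out : ∀ i → vertex (out , i) ∙ c₂ ≡ vertex (inn , i)
    ∙c₂-out i = trans (vertex-∙ out i inn (+ 0)) (cong (λ j → vertex (inn , j)) (ℤ.+-identityʳ i))

    -- For `side = inn` these arcs are loops, which the underlying graph drops; the spokes are
    -- covered from their outer ends.
    ∙c₂-inn : ∀ i → vertex (inn , i) ∙ c₂ ≡ vertex (side , i)
    ∙c₂-inn i = trans (vertex-∙ inn i inn (+ 0))
      (cong (λ j → vertex (side , j)) (trans (cong (i +ᶻ_) (ℤ.*-zeroʳ l)) (ℤ.+-identityʳ i)))

    powers : ∀ m → Gen _∙_ e c₁ c₂ (vertex (out , + m))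
    powers zero = gen-ε
    powers (suc m) = subst (Gen _∙_ e c₁ c₂)
      (trans (∙c₁-out (+ m)) (cong (λ i → vertex (out , i)) (cong +_ (ℕ.+-comm m 1))))
      (gen-∙ (powers m) (inj₁ refl))

    generated : ∀ x → Gen _∙_ e c₁ c₂ x
    generated (u f) = subst (Gen _∙_ e c₁ c₂) (vertex-label (u f)) (powers (toℕ f))
    generated (v f) = subst (Gen _∙_ e c₁ c₂) (trans (∙c₂-out (+ toℕ f)) (vertex-label (v f)))
      (gen-∙ (powers (toℕ f)) (inj₂ refl))

    sides : ∀ {i j} → vertex (out , i) ≢ vertex (inn , j)
    sides {i} {j} eq = case proj₁ (vertex-inj {out} {i} {inn} {j} eq) of λ ()

    irreflexive : ∀ l d → vertex l ≢ vertex (nbr l d)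
    irreflexive (s , i) fwd eq = κ≢0 s i (≋-sym (proj₂ (vertex-inj eq)))
    irreflexive (s , i) bwd eq = κ≢0 s (i -ᶻ κ s) (≋-trans (≡⇒≋ (lemma i (κ s))) (proj₂ (vertex-inj eq)))
      where
      lemma : ∀ i κ → i -ᶻ κ +ᶻ κ ≡ i
      lemma = solve-∀
    irreflexive (s , i) spk eq = flip-≢ (proj₁ (vertex-inj eq))

    inner-step : ∀ i → vertex (inn , i +ᶻ l) ≡ vertex (nbr (inn , i) fwd) ⊎ vertex (inn , i +ᶻ l) ≡ vertex (nbr (inn , i) bwd)
    inner-step i = [ (λ l≋ → inj₁ (vertex-cong (+-congˡ-≋ i l≋))) , (λ l≋ → inj₂ (vertex-cong (+-congˡ-≋ i l≋))) ]′ l≋k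

    arcs : ∀ x d → let y = vertex (nbr x d) in ∃ λ c → InC c₁ c₂ c × (y ≡ vertex x ∙ c ⊎ vertex x ≡ y ∙ c)
    arcs (out , i) fwd = c₁ , inj₁ refl , inj₁ (sym (∙c₁-out i))
    arcs (out , i) bwd = c₁ , inj₁ refl , inj₂ (sym (trans (∙c₁-out (i -ᶻ + 1)) (cong (λ j → vertex (out , j)) (lemma i))))
      where
      lemma : ∀ i → i -ᶻ + 1 +ᶻ + 1 ≡ i
      lemma = solve-∀
    arcs (out , i) spk = c₂ , inj₂ refl , inj₁ (sym (∙c₂-out i))
    arcs (inn , i) spk = c₂ , inj₂ refl , inj₂ (sym (∙c₂-out i))
    arcs (inn , i) fwd = c₁ , inj₁ refl , by-sign l≋k
      where
      cancel : ∀ i k → i +ᶻ k -ᶻ k ≡ i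
      cancel = solve-∀
      by-sign : l ≋ + k ⊎ l ≋ -ᶻ + k → vertex (inn , i +ᶻ + k) ≡ vertex (inn , i) ∙ c₁ ⊎
                                        vertex (inn , i) ≡ vertex (inn , i +ᶻ + k) ∙ c₁
      by-sign (inj₁ l≋) = inj₁ (sym (trans (∙c₁-inn i) (vertex-cong (+-congˡ-≋ i l≋))))
      by-sign (inj₂ l≋) = inj₂ (sym (trans (∙c₁-inn (i +ᶻ + k))
        (vertex-cong (≋-trans (+-congˡ-≋ (i +ᶻ + k) l≋) (≡⇒≋ (cancel i (+ k)))))))
    arcs (inn , i) bwd = c₁ , inj₁ refl , by-sign l≋k
      where
      cancel : ∀ i k → i -ᶻ k +ᶻ k ≡ i
      cancel = solve-∀
      by-sign : l ≋ + k ⊎ l ≋ -ᶻ + k → vertex (inn , i -ᶻ + k) ≡ vertex (inn , i) ∙ c₁ ⊎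
                                        vertex (inn , i) ≡ vertex (inn , i -ᶻ + k) ∙ c₁
      by-sign (inj₂ l≋) = inj₁ (sym (trans (∙c₁-inn i) (vertex-cong (+-congˡ-≋ i l≋))))
      by-sign (inj₁ l≋) = inj₂ (sym (trans (∙c₁-inn (i -ᶻ + k))
        (vertex-cong (≋-trans (+-congˡ-≋ (i -ᶻ + k) l≋) (≡⇒≋ (cancel i (+ k)))))))

    edge : ∀ l {c} → InC c₁ c₂ c → vertex l ≢ vertex l ∙ c → GPAdj n k (vertex l) (vertex l ∙ c)
    edge (out , i) (inj₁ refl) _ = subst (GPAdj n k (vertex (out , i))) (sym (∙c₁-out i)) (gpadj⇐ (out , i) fwd)
    edge (out , i) (inj₂ refl) _ = subst (GPAdj n k (vertex (out , i))) (sym (∙c₂-out i)) (gpadj⇐ (out , i) spk)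
    edge (inn , i) (inj₁ refl) _ = [ via fwd , via bwd ]′ (inner-step i)
      where
      via : ∀ d → vertex (inn , i +ᶻ l) ≡ vertex (nbr (inn , i) d) → GPAdj n k (vertex (inn , i)) (vertex (inn , i) ∙ c₁)
      via d eq = subst (GPAdj n k (vertex (inn , i))) (sym (trans (∙c₁-inn i) eq)) (gpadj⇐ (inn , i) d)
    edge (inn , i) (inj₂ refl) ≢ = by-side side (∙c₂-inn i)
      where
      by-side : ∀ s → vertex (inn , i) ∙ c₂ ≡ vertex (s , i) → GPAdj n k (vertex (inn , i)) (vertex (inn , i) ∙ c₂)
      by-side out eq = subst (GPAdj n k (vertex (inn , i))) (sym eq) (gpadj⇐ (inn , i) spk)
      by-side inn eq = contradiction (sym eq) ≢

    edge′ : ∀ x {c} → InC c₁ c₂ c → x ≢ x ∙ c → GPAdj n k x (x ∙ c)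
    edge′ x {c} c∈C = subst (λ x → x ≢ x ∙ c → GPAdj n k x (x ∙ c)) (vertex-label x) (edge (label x) c∈C)

    adjacency : ∀ x y → GPAdj n k x y ⇔ CayAdj _∙_ c₁ c₂ x y
    adjacency x y = mk⇔ to′ from′
      where
      to′ : GPAdj n k x y → CayAdj _∙_ c₁ c₂ x y
      to′ adj with gpadj⇒ (label x) (subst (λ x → GPAdj n k x y) (sym (vertex-label x)) adj)
      ... | d , refl = subst (λ x′ → CayAdj _∙_ c₁ c₂ x′ (vertex (nbr (label x) d))) (vertex-label x) (irreflexive (label x) d , arcs (label x) d)
      from′ : CayAdj _∙_ c₁ c₂ x y → GPAdj n k x y
      from′ (x≢y , c , c∈C , inj₁ refl) = edge′ x c∈C x≢y
      from′ (x≢y , c , c∈C , inj₂ refl) = GPAdj-sym (edge′ y c∈C (x≢y ∘ sym))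

    rep : MonoidCayleyRep n k
    rep = record
      { M = PVertex n ; _∙_ = _∙_ ; e = e
      ; isMonoid = record
        { isSemigroup = record
          { isMagma = record { isEquivalence = isEquivalence ; ∙-cong = cong₂ _∙_ }
          ; assoc = ∙-assoc }
        ; identity = e∙ , ∙e }
      ; c₁ = c₁ ; c₂ = c₂ ; c₁≢c₂ = sides {+ 1} {+ 0}
      ; generated = generated
      ; iso = mk↔ₛ′ id id (λ _ → refl) (λ _ → refl)
      ; iso-adj = adjacency }

-- The Petersen graph: ℤ/6 = ⟨a⟩, three elements a^i b with b a = b, and a zero b b.
module PetersenGraph where
  product : ℕ → ℕ → ℕ
  product i j = if does (i ℕ.<? 6)
    -- The codes are 0 to 5 for a^i, 6 to 8 for a^i b, and 9 for the zero. As 6 is divisible by 3,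
    -- codes can be added modulo 3 without removing the offset of the second one.
    then (if does (j ℕ.<? 6) then (i + j) ℕ.% 6 else if does (j ℕ.<? 9) then 6 + (i + j) ℕ.% 3 else 9)
    else (if does (i ℕ.<? 9) ∧ does (j ℕ.<? 6) then i else 9)

  _∙_ : Fin 10 → Fin 10 → Fin 10
  x ∙ y = product (toℕ x) (toℕ y) ℕ.mod 10

  e c₁ c₂ : Fin 10
  e = Fin.# 0
  c₁ = Fin.# 1
  c₂ = Fin.# 6

  generated : ∀ x → Gen _∙_ e c₁ c₂ x
  generated = λ { 0F → g₀ ; 1F → g₁ ; 2F → g₂ ; 3F → gen-∙ g₂ (inj₁ refl) ; 4F → gen-∙ (gen-∙ g₂ (inj₁ refl)) (inj₁ refl)
                ; 5F → gen-∙ (gen-∙ (gen-∙ g₂ (inj₁ refl)) (inj₁ refl)) (inj₁ refl)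
                ; 6F → gen-∙ g₀ (inj₂ refl) ; 7F → gen-∙ g₁ (inj₂ refl) ; 8F → gen-∙ g₂ (inj₂ refl)
                ; 9F → gen-∙ (gen-∙ g₀ (inj₂ refl)) (inj₂ refl) }
    where
    g₀ : Gen _∙_ e c₁ c₂ 0F
    g₀ = gen-ε
    g₁ : Gen _∙_ e c₁ c₂ 1F
    g₁ = gen-∙ g₀ (inj₁ refl)
    g₂ : Gen _∙_ e c₁ c₂ 2F
    g₂ = gen-∙ g₁ (inj₁ refl)

  -- The Petersen graph is seen as the hexagon of the a^i, three vertices a^i b each joined to the
  -- opposite corners a^i and a^(i+3), and the zero joined to these three.
  to : PVertex 5 → Fin 10
  to = λ { (u 0F) → 9F ; (u 1F) → 6F ; (u 2F) → 0F ; (u 3F) → 1F ; (u 4F) → 7F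
         ; (v 0F) → 8F ; (v 1F) → 3F ; (v 2F) → 5F ; (v 3F) → 2F ; (v 4F) → 4F }

  from : Fin 10 → PVertex 5
  from = λ { 0F → u 2F ; 1F → u 3F ; 2F → v 3F ; 3F → v 1F ; 4F → v 4F
           ; 5F → v 2F ; 6F → u 1F ; 7F → u 4F ; 8F → v 0F ; 9F → u 0F }

  from∘to : ∀ x → from (to x) ≡ x
  from∘to = λ { (u 0F) → refl ; (u 1F) → refl ; (u 2F) → refl ; (u 3F) → refl ; (u 4F) → refl
              ; (v 0F) → refl ; (v 1F) → refl ; (v 2F) → refl ; (v 3F) → refl ; (v 4F) → refl }

  gpadj? : ∀ x y → Dec (GPAdj 5 2 x y)
  gpadj? (u i) (u j) = map′ [ outer , outer′ ]′ (λ { (outer c) → inj₁ c ; (outer′ c) → inj₂ c }) ((_ ∣ℕ? _) ⊎-dec (_ ∣ℕ? _))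
  gpadj? (v i) (v j) = map′ [ inner , inner′ ]′ (λ { (inner c) → inj₁ c ; (inner′ c) → inj₂ c }) ((_ ∣ℕ? _) ⊎-dec (_ ∣ℕ? _))
  gpadj? (u i) (v j) = map′ (λ { refl → spoke i }) (λ { (spoke _) → refl }) (i Fin.≟ j)
  gpadj? (v i) (u j) = map′ (λ { refl → spoke′ i }) (λ { (spoke′ _) → refl }) (i Fin.≟ j)

  cayadj? : ∀ s t → Dec (CayAdj _∙_ c₁ c₂ s t)
  cayadj? s t = ¬? (s Fin.≟ t) ×-dec map′ [ (λ p → c₁ , inj₁ refl , p) , (λ p → c₂ , inj₂ refl , p) ]′
    (λ { (_ , inj₁ refl , p) → inj₁ p ; (_ , inj₂ refl , p) → inj₂ p }) (arc? c₁ ⊎-dec arc? c₂)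
    where
    arc? : ∀ c → Dec (t ≡ s ∙ c ⊎ s ≡ t ∙ c)
    arc? c = (t Fin.≟ s ∙ c) ⊎-dec (s Fin.≟ t ∙ c)

  every? : ∀ {P : PVertex 5 → Set} → (∀ x → Dec (P x)) → Dec (∀ x → P x)
  every? P? = map′ (λ { (p , q) (u i) → p i ; (p , q) (v i) → q i }) (λ p → p ∘ u , p ∘ v)
    (Fin.all? (P? ∘ u) ×-dec Fin.all? (P? ∘ v))

  adjacency : ∀ x y → (GPAdj 5 2 x y → CayAdj _∙_ c₁ c₂ (to x) (to y)) × (CayAdj _∙_ c₁ c₂ (to x) (to y) → GPAdj 5 2 x y)
  adjacency = from-yes (every? λ x → every? λ y →
    (gpadj? x y →-dec cayadj? (to x) (to y)) ×-dec (cayadj? (to x) (to y) →-dec gpadj? x y))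

  rep : MonoidCayleyRep 5 2
  rep = record
    { M = Fin 10 ; _∙_ = _∙_ ; e = e
    ; isMonoid = record
      { isSemigroup = record
        { isMagma = record { isEquivalence = isEquivalence ; ∙-cong = cong₂ _∙_ }
        ; assoc = from-yes (Fin.all? λ x → Fin.all? λ y → Fin.all? λ w → ((x ∙ y) ∙ w) Fin.≟ (x ∙ (y ∙ w))) }
      ; identity = from-yes (Fin.all? λ x → (e ∙ x) Fin.≟ x) , from-yes (Fin.all? λ x → (x ∙ e) Fin.≟ x) }
    ; c₁ = c₁ ; c₂ = c₂ ; c₁≢c₂ = λ ()
    ; generated = generated
    ; iso = mk↔ₛ′ to from (from-yes (Fin.all? λ x → to (from x) Fin.≟ x)) from∘to
    ; iso-adj = λ x y → mk⇔ (proj₁ (adjacency x y)) (proj₂ (adjacency x y)) }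

-- The two directions of the equivalence

module _ {n k : ℕ} (0<k : 0 < k) (2k<n : 2 * k < n) where
  open Congruence n

  necessary : MonoidCayleyRep n k → (n ≡ 5 × k ≡ 2) ⊎ Good n k
  necessary representation = by-outcome (outcome k refl)
    where
    R : UnitRep n k
    R = Units.unitRep 0<k 2k<n representation

    k<n : k < n
    k<n = ℕ.≤-<-trans (ℕ.m≤m+n k (k + 0)) 2k<n

    outcome : ∀ m → k ≡ m → Outcome n k
    outcome zero refl = case 0<k of λ ()
    outcome (suc zero) refl = inj₂ (inj₂ (inj₁ (inj₁ (n ℕᵈ.∣0))))
    outcome (suc (suc m)) refl with n ℕ.<? 41
    ... | yes n<41 = small-outcome n<41 k<n 0<k 2k<n
    ... | no n≮41 = inj₁ (Large.varied (ℕ.≮⇒≥ n≮41) (s≤s (s≤s z≤n)) 2k<n)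

    varied : ∀ m → ¬ Walks.Constant n k m → Good n k
    varied m ¬constant with centred R
    ... | s , R₀ , e≡ = rotation⇒good 0<k 2k<n R₀ (rotational (spokes-preserved m ¬constant) s e≡)
      where open Core 0<k 2k<n R₀

    by-outcome : Outcome n k → (n ≡ 5 × k ≡ 2) ⊎ Good n k
    by-outcome (inj₁ ¬constant) = inj₂ (varied 6 ¬constant)
    by-outcome (inj₂ (inj₁ ¬constant)) = inj₂ (varied 8 ¬constant)
    by-outcome (inj₂ (inj₂ (inj₁ fine))) = inj₂ fine
    by-outcome (inj₂ (inj₂ (inj₂ (inj₁ petersen)))) = inj₁ petersen
    by-outcome (inj₂ (inj₂ (inj₂ (inj₂ (n≡10 , inj₁ k≡2))))) = ⊥-elim (not-dodecahedral (subst₂ UnitRep n≡10 k≡2 R))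
    by-outcome (inj₂ (inj₂ (inj₂ (inj₂ (n≡10 , inj₂ k≡3))))) = ⊥-elim (not-desarguesian (subst₂ UnitRep n≡10 k≡3 R))

  scale : ∀ {l m} → l *ᶻ l ≋ m → ∀ j → l *ᶻ (l *ᶻ j) ≋ m *ᶻ j
  scale {l} {m} eq j = ≋-trans (≡⇒≋ (sym (ℤ.*-assoc l l j))) (*-congʳ-≋ j eq)

  sufficient : (n ≡ 5 × k ≡ 2) ⊎ Good n k → MonoidCayleyRep n k
  sufficient (inj₁ (refl , refl)) = PetersenGraph.rep
  sufficient (inj₂ (inj₁ n∣)) = Semidirect.rep 0<k 2k<n (+ k) out
    (λ j → ≋-trans (scale {+ k} {+ 1} (∣⇒≋ n∣) j) (≡⇒≋ (ℤ.*-identityˡ j))) (inj₁ (≡⇒≋ refl))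
  sufficient (inj₂ (inj₂ (inj₁ n∣))) = Semidirect.rep 0<k 2k<n (+ k) inn (scale {+ k} {+ k} (∣⇒≋ n∣)) (inj₁ (≡⇒≋ refl))
  sufficient (inj₂ (inj₂ (inj₂ n∣))) = Semidirect.rep 0<k 2k<n (-ᶻ + k) inn (scale { -ᶻ + k} { -ᶻ + k} (linear (+ 1) (lemma (+ k)) k²≋-k))
      (inj₂ (≡⇒≋ refl))
    where
    k²≋-k : + k *ᶻ + k ≋ -ᶻ + k
    k²≋-k = ∣⇒≋ (subst (λ d → n ∣ℕ ℤ.∣ + k *ᶻ + k +ᶻ d ∣) (sym (ℤ.neg-involutive (+ k))) n∣)
    lemma : ∀ k → -ᶻ k *ᶻ -ᶻ k -ᶻ (-ᶻ k) ≡ + 1 *ᶻ (k *ᶻ k -ᶻ (-ᶻ k))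
    lemma = solve-∀

theorem3p13 : (n k : ℕ) → 0 < k → 2 * k < n →
    (MonoidCayleyRep n k ⇔
    ((n ≡ 5 × k ≡ 2)
    ⊎ (+ n) ∣ ((+ k) ℤ.* (+ k) ℤ.- + 1)
    ⊎ ((+ n) ∣ ((+ k) ℤ.* (+ k) ℤ.- (+ k)) ⊎ (+ n) ∣ ((+ k) ℤ.* (+ k) ℤ.+ (+ k)))))
theorem3p13 n k 0<k 2k<n = mk⇔ (necessary 0<k 2k<n) (sufficient 0<k 2k<n)
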